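{- Let $\mathbb{F}_q$ be a finite field of order $q=p^s$ with $p$ prime. Let $P_1,\dots,P_r \in \mathbb{F}_q[t_1,\dots,t_n]$ be nonzero polynomials, and let $\mathcal{I}\subseteq\{1,\dots,n\}$ be a nonempty subset such that $\max_{1\le j\le r}\deg_{\mathcal{I}}(P_j)>0$. Let $f_1,\dots,f_n \in \mathbb{F}_q[t]$ and assume that $f_i$ is nonconstant for all $i\in\mathcal{I}$. Suppose that $(q-1)\sum_{j=1}^r \deg_{\mathcal{I}}(P_j) < \sum_{i\in\mathcal{I}} \omega(f_i)$. Then \[ q^{\left\lceil\left(\sum_{i\in\mathcal{I}} \frac{\omega(f_i)}{q-1}-\sum_{j=1}^r \deg_{\mathcal{I}}(P_j)\right)/\max_{1\le j\le r}\deg_{\mathcal{I}}(P_j)\right\rceil} \] divides $\# \{ (x_1,\dots,x_n) \in \mathbb{F}_q^n \mid P_j(f_1(x_1),\dots,f_n(x_n)) = 0 \text{ for all } 1 \leq j \leq r\}$.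
   Context: For nonconstant $f\in\mathbb{F}_q[t]$, write $f(t)=\sum_{\ell=1}^R b_{\ell}t^{m_{\ell}}$ with $b_{\ell}\neq 0$ and pairwise distinct exponents $m_\ell\geq 0$, and define $\omega(f)= \min\{\sum_{\ell=1}^R \gamma_{\ell} \mid 0\le\gamma_1,\dots,\gamma_R\le q-1 \text{ integers and } \sum_{\ell=1}^R m_{\ell}\gamma_{\ell}\in (q-1)\mathbb{Z}^+\}$ (one has $1\le\omega(f)\le q-1$). For nonempty $\mathcal{I}\subseteq\{1,\dots,n\}$ and a monomial $a t_1^{m_1}\cdots t_n^{m_n}$ with $a\neq 0$, its $\mathcal{I}$-degree is $\sum_{i\in\mathcal{I}} m_i$; for $P\in\mathbb{F}_q[t_1,\dots,t_n]$, $\deg_{\mathcal{I}}(P)$ is the maximum of the $\mathcal{I}$-degrees of its monomial terms. -}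

module Defs where

open import Level using (Level; _⊔_) renaming (suc to lsuc)
open import Algebra.Bundles using (CommutativeRing)
open import Data.Bool using (Bool; true; false)
open import Data.Nat using (ℕ; zero; suc; _∸_; _≤_; _/_)
  renaming (_+_ to _+ℕ_; _*_ to _*ℕ_)
  renaming (_⊔_ to _⊔ₙ_)
open import Data.Fin using (Fin; toℕ)
import Data.Fin as Fin
import Data.Fin.Properties as FinP
open import Data.Fin.Subset using (Subset)
open import Data.Vec using (Vec; []; _∷_; lookup; tabulate)
open import Data.Nat.ListAction using (sum)
open import Data.List using (List; []; _∷_; map; foldr; length; filter; allFin; concatMap)
import Data.List as L
open import Data.List.Relation.Unary.All using (All)
open import Data.List.Relation.Unary.Any using (Any)
open import Data.List.Relation.Unary.Unique.Propositional using (Unique)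
open import Data.Product using (Σ; ∃; _×_; _,_; proj₁; proj₂)
open import Relation.Nullary using (¬_; Dec; yes; no)
open import Relation.Binary using (Decidable)
open import Relation.Binary.PropositionalEquality using (_≡_; refl)
open import Data.Nat using (_<_)

record FiniteField (c ℓ : Level) : Set (lsuc (c ⊔ ℓ)) where
  field
    commRing : CommutativeRing c ℓ
  open CommutativeRing commRing public
  field
    1≉0       : ¬ (1# ≈ 0#)
    inverse   : ∀ x → ¬ (x ≈ 0#) → ∃ λ y → x * y ≈ 1#
    q         : ℕ
    enum      : Fin q → Carrier
    enum-inj  : ∀ i j → enum i ≈ enum j → i ≡ j
    enum-surj : ∀ x → ∃ λ i → enum i ≈ x

  _≟F_ : Decidable _≈_
  x ≟F y with enum-surj x | enum-surj y
  ... | i , ex | j , ey with i FinP.≟ j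
  ... | yes refl = yes (trans (sym ex) ey)
  ... | no ne = no (λ xy → ne (enum-inj i j (trans ex (trans xy (sym ey)))))

  _^F_ : Carrier → ℕ → Carrier
  x ^F zero = 1#
  x ^F suc m = x * (x ^F m)

module _ {c ℓ : Level} (F : FiniteField c ℓ) where
  open FiniteField F

  -- Univariate polynomial f(t) = Σ_ℓ b_ℓ t^{m_ℓ} in F_q[t], given by its list
  -- of terms (b_ℓ , m_ℓ) with b_ℓ ≠ 0 and pairwise distinct exponents m_ℓ.
  -- (The zero polynomial is the empty list.)
  record UPoly : Set (c ⊔ ℓ) where
    field
      terms    : List (Carrier × ℕ)
      coeff≉0  : All (λ t → ¬ (proj₁ t ≈ 0#)) terms
      distinct : Unique (map proj₂ terms)

  -- Polynomial in F_q[t_1,…,t_n], given by its list of monomial terms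
  -- (a , (m_1,…,m_n)) with a ≠ 0 and pairwise distinct exponent vectors.
  record MPoly (n : ℕ) : Set (c ⊔ ℓ) where
    field
      terms    : List (Carrier × Vec ℕ n)
      coeff≉0  : All (λ t → ¬ (proj₁ t ≈ 0#)) terms
      distinct : Unique (map proj₂ terms)

  NonzeroPoly : ∀ {n} → MPoly n → Set c
  NonzeroPoly P = ¬ (MPoly.terms P ≡ [])

  NonConstant : UPoly → Set c
  NonConstant f = Any (λ t → 0 < proj₂ t) (UPoly.terms f)

  evalU : UPoly → Carrier → Carrier
  evalU f x = foldr (λ t acc → (proj₁ t * (x ^F proj₂ t)) + acc) 0# (UPoly.terms f)

  monoVal : ∀ {n} → Vec Carrier n → Vec ℕ n → Carrier
  monoVal [] [] = 1#
  monoVal (x ∷ xs) (m ∷ ms) = (x ^F m) * monoVal xs ms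

  evalM : ∀ {n} → MPoly n → Vec Carrier n → Carrier
  evalM P v = foldr (λ t acc → (proj₁ t * monoVal v (proj₂ t)) + acc) 0# (MPoly.terms P)

  Gamma : UPoly → Set
  Gamma f = Fin (length (UPoly.terms f)) → Fin q

  γsum : (f : UPoly) → Gamma f → ℕ
  γsum f γ = sum (map (λ k → toℕ (γ k)) (allFin _))

  weightedSum : (f : UPoly) → Gamma f → ℕ
  weightedSum f γ = sum (map (λ k → proj₂ (L.lookup (UPoly.terms f) k) *ℕ toℕ (γ k)) (allFin _))

  Admissible : (f : UPoly) → Gamma f → Set
  Admissible f γ = ∃ λ k → suc k *ℕ (q ∸ 1) ≡ weightedSum f γ

  IsOmega : UPoly → ℕ → Set
  IsOmega f w = (∃ λ γ → Admissible f γ × γsum f γ ≡ w)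
              × (∀ γ → Admissible f γ → w ≤ γsum f γ)

  allTuples : (n : ℕ) → List (Vec (Fin q) n)
  allTuples zero = [] ∷ []
  allTuples (suc n) = concatMap (λ a → map (a ∷_) (allTuples n)) (allFin q)

  point : ∀ {n} → (Fin n → UPoly) → Vec (Fin q) n → Vec Carrier n
  point f k = tabulate (λ i → evalU (f i) (enum (lookup k i)))

  IsZero : ∀ {n r} → (Fin r → MPoly n) → (Fin n → UPoly) → Vec (Fin q) n → Set ℓ
  IsZero P f k = ∀ j → evalM (P j) (point f k) ≈ 0#

  IsZero? : ∀ {n r} (P : Fin r → MPoly n) (f : Fin n → UPoly) → ∀ k → Dec (IsZero P f k)
  IsZero? P f k = FinP.all? (λ j → evalM (P j) (point f k) ≟F 0#)

  zeroCount : ∀ n {r} → (Fin r → MPoly n) → (Fin n → UPoly) → ℕ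
  zeroCount n P f = length (filter (IsZero? P f) (allTuples n))

sumI : ∀ {n} → Subset n → (Fin n → ℕ) → ℕ
sumI [] a = 0
sumI (true ∷ I) a = a Fin.zero +ℕ sumI I (λ i → a (Fin.suc i))
sumI (false ∷ I) a = sumI I (λ i → a (Fin.suc i))

module _ {c ℓ : Level} {F : FiniteField c ℓ} where
  -- I-degree of a polynomial (max of I-degrees of its terms; 0 for zero poly)
  degI : ∀ {n} → Subset n → MPoly F n → ℕ
  degI I P = foldr _⊔ₙ_ 0 (map (λ t → sumI I (lookup (proj₂ t))) (MPoly.terms P))

  maxDegI : ∀ {n r} → Subset n → (Fin r → MPoly F n) → ℕ
  maxDegI I P = foldr _⊔ₙ_ 0 (map (λ j → degI I (P j)) (allFin _))

  sumDegI : ∀ {n r} → Subset n → (Fin r → MPoly F n) → ℕ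
  sumDegI I P = sum (map (λ j → degI I (P j)) (allFin _))

-- ⌈ a / b ⌉ for natural numbers (b > 0); value 0 for b = 0 (never used)
ceilDiv : ℕ → ℕ → ℕ
ceilDiv a zero = 0
ceilDiv a (suc k) = (a +ℕ k) / suc k

{-# OPTIONS --safe #-}
module Submission where

-- Let q = p ^ s.  In the monoid ring ℤ[F] the powers of the kernel of the augmentation π : ℤ[F] → F
-- play the role of the p-adic filtration of the Witt vectors of F: the Frobenius lift φ [x] = [xᵖ] has
-- the p-derivation (φ a − aᵖ) / p, which maps the (k+1)-st power into the k-th, so an integer lying in
-- the k-th power is divisible by p ^ k.
--
-- With coefficients lifted by x ↦ [x], the number of zeros is Σₓ ∏ⱼ (1 − Pⱼ(f(x)) ^ ((q − 1) p ^ M))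
-- modulo the M-th power.  Taking p-th powers repeatedly, (Σ y) ^ ((q − 1) p ^ M) expands into monomials
-- p ^ v · ∏ y ^ κ whose exponents κ, written as sums of powers of p, have s (p − 1) + (p − 1) v summands
-- in total.  For each l < s, replacing every summand p ^ a by p ^ ((a + l) mod s) multiplies the exponents
-- by p ^ l modulo q − 1.  The sum Σₓ [x] ^ u lies in all powers of the kernel unless q − 1 ∣ u, it is q
-- for u = 0, and for u > 0 the definition of ω bounds the replaced exponents from below.  This yields the
-- asserted ceiling as a lower bound for each l, and summing over the s values of l gives p ^ (s ⌈…⌉) = q ^ ⌈…⌉.
open import Defs
open import Level using (Level; _⊔_; 0ℓ)
open import Algebra.Bundles using (CommutativeMonoid; CommutativeRing)
import Algebra.Construct.Pointwise as Pointwise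
open import Data.Bool using (Bool; true; false; if_then_else_)
open import Data.Fin as Fin using (Fin; toℕ; fromℕ; fromℕ<; inject₁; punchIn; combine; remQuot)
open import Data.Fin.Permutation using (Permutation; permutation)
import Data.Fin.Properties as Finₚ
open import Data.Fin.Subset using (Subset; _∈_; Nonempty)
open import Data.Integer as ℤ using (ℤ)
import Data.Integer.Properties as ℤₚ
open import Data.List as List using (List; []; _∷_; _++_; length; replicate; allFin; tabulate; concatMap; filter)
open import Data.List.Membership.Propositional using () renaming (_∈_ to _∈ˡ_)
open import Data.List.Membership.Propositional.Properties using (∈-map⁺; ∈-allFin; ∈-lookup)
open import Data.List.Properties using (length-replicate; map-tabulate; map-++; map-∘)
open import Data.List.Relation.Unary.All using (All; []; _∷_)
import Data.List.Relation.Unary.Any as Any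
open import Data.List.Relation.Unary.Any.Properties using (lookup-index)
open import Data.Nat as ℕ using (ℕ; zero; suc; _∸_; _<_; _≤_; s≤s; z≤n; NonZero; _%_; _/_)
open import Data.Nat.Combinatorics using (_C_; nCn≡1; nCk+nC[k+1]≡[n+1]C[k+1])
open import Data.Nat.Coprimality using (prime⇒coprime; coprime-Bézout)
open import Data.Nat.Divisibility using (_∣_; divides; quotient; 1∣_; >⇒∤; _∣?_; m∣m*n; ∣n⇒∣m*n; *-monoʳ-∣; m%n≡0⇒n∣m)
open import Data.Nat.DivMod using (m≡m%n+[m/n]*n; m%n<n)
open import Data.Nat.GCD using (module Bézout)
open import Data.Nat.ListAction as ListAction using (product)
open import Data.Nat.Primality using (Prime; prime⇒nonZero; prime⇒nonTrivial; euclidsLemma)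
open import Data.Nat.Primality.Factorisation using (factorise; PrimeFactorisation)
import Data.Nat.Properties as ℕₚ
import Data.Nat.Solver as NatSolver
open import Data.Product using (∃; ∃₂; _×_; _,_; proj₁; proj₂; uncurry)
open import Data.Sum using (inj₁; inj₂)
open import Data.Unit using (⊤; tt)
open import Data.Vec using (Vec; []; _∷_; lookup; here; there; head; tail)
open import Function using (_∘_)
open import Relation.Binary using (tri<; tri≈; tri>)
open import Relation.Binary.PropositionalEquality as ≡ using (_≡_)
open import Relation.Nullary using (¬_; Dec; yes; no; contradiction; does)
open import Relation.Nullary.Decidable using (¬?; _×-dec_; decidable-stable; dec-true; dec-false)

-- The lift x ↦ [x] must be multiplicative, into a ring without p-torsion. In the monoid ring
-- multiplicativity holds by construction, and the p-th power map of F extends linearly to a lift of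
-- Frobenius, so no Witt vectors have to be built. The price is that the kernel of π is larger than
-- the ideal (p): valuations exist only as membership in powers of the kernel, and the return to
-- divisibility is made once, for the final integer. The maximal degree in the denominator comes
-- from a trade. For shift l the folded degree is a positive multiple r (1 + ε l) of r = q - 1, and
-- the sum of the ε l over all shifts is v. At shift l a monomial can thus lose r · ε l times the
-- maximal I-degree against the bound by ω, while p ^ v pays one factor p for each unit of that sum.
-- A single shift controls only its own ε l, and v need not be a multiple of s; the s shifts
-- together account for v exactly, which is what produces a power of q.

-- Binomial coefficients modulo p and p-th powers of sums

absorption : ∀ n k → suc k ℕ.* (suc n C suc k) ≡ suc n ℕ.* (n C k)
absorption zero    zero    = ≡.refl
absorption zero    (suc k) = ℕₚ.*-zeroʳ k
absorption (suc n) zero    = begin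
  (2+n C 1) ℕ.+ 0        ≡⟨ ≡.cong (ℕ._+ 0) (≡.sym (nCk+nC[k+1]≡[n+1]C[k+1] (suc n) 0)) ⟩
  1 ℕ.+ (suc n C 1) ℕ.+ 0     ≡⟨ ≡.cong suc (absorption n zero) ⟩
  1 ℕ.+ suc n ℕ.* 1           ≡⟨ ≡.refl ⟩
  2+n ℕ.* 1                   ∎
  where open ≡.≡-Reasoning
        2+n = suc (suc n)
absorption (suc n) (suc k) = begin
  suc (suc k) ℕ.* (suc (suc n) C suc (suc k))
    ≡⟨ ≡.cong (suc (suc k) ℕ.*_) (≡.sym (nCk+nC[k+1]≡[n+1]C[k+1] (suc n) (suc k))) ⟩
  suc (suc k) ℕ.* (a ℕ.+ b)
    ≡⟨ solve 3 (λ k a b → (con 2 :+ k) :* (a :+ b) := a :+ ((con 1 :+ k) :* a :+ (con 2 :+ k) :* b)) ≡.refl k a b ⟩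
  a ℕ.+ (suc k ℕ.* a ℕ.+ suc (suc k) ℕ.* b)
    ≡⟨ ≡.cong (a ℕ.+_) (≡.cong₂ ℕ._+_ (absorption n k) (absorption n (suc k))) ⟩
  a ℕ.+ (suc n ℕ.* (n C k) ℕ.+ suc n ℕ.* (n C suc k))
    ≡⟨ ≡.cong (a ℕ.+_) (≡.sym (ℕₚ.*-distribˡ-+ (suc n) (n C k) (n C suc k))) ⟩
  a ℕ.+ suc n ℕ.* ((n C k) ℕ.+ (n C suc k))
    ≡⟨ ≡.cong (λ z → a ℕ.+ suc n ℕ.* z) (nCk+nC[k+1]≡[n+1]C[k+1] n k) ⟩
  suc (suc n) ℕ.* a ∎
  where open ≡.≡-Reasoning
        open NatSolver.+-*-Solver
        a = suc n C suc k
        b = suc n C suc (suc k)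

-- By `absorption`, p divides (k + 1) · C(p, k + 1), and the positive factor k + 1 is too small to
-- be divisible by p.
prime∣C : ∀ {p} → Prime p → ∀ k → suc k < p → p ∣ (p C suc k)
prime∣C {zero} _ k ()
prime∣C {suc n} pr k k<p
  with euclidsLemma (suc k) (suc n C suc k) pr (≡.subst (suc n ∣_) (≡.sym (absorption n k)) (m∣m*n (n C k)))
... | inj₁ p∣k = contradiction p∣k (>⇒∤ k<p)
... | inj₂ p∣C = p∣C

module Freshman {c ℓ : Level} (R : CommutativeRing c ℓ) where
  open CommutativeRing R
  open import Algebra.Properties.Semiring.Mult semiring renaming (_×_ to _·_)
  open import Algebra.Properties.CommutativeMonoid.Mult +-commutativeMonoid using () renaming
      (×-distrib-+ to ·-distrib-+)
  open import Algebra.Properties.CommutativeSemiring.Exp commutativeSemiring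
  open import Algebra.Properties.Semiring.Sum semiring
  open import Relation.Binary.Reasoning.Setoid setoid
  import Algebra.Properties.CommutativeSemiring.Binomial commutativeSemiring as B
  import Algebra.Properties.Semiring.Binomial semiring as SB

  -- `Q` is a sum of natural multiples of the mixed monomials, so it inherits every additive
  -- property `S` that they have. Later `S` is a power of an ideal, the trivial property, or "p
  -- times it lies in a given span".
  freshman : ∀ {t} {p} → Prime p → (S : Carrier → Set t) → S 0# → (∀ {a b} → S a → S b → S (a + b)) →
             ∀ x y → (∀ i j → suc i ℕ.+ suc j ≡ p → S (x ^ suc i * y ^ suc j)) →
             ∃ λ Q → S Q × ((x + y) ^ p ≈ x ^ p + y ^ p + p · Q)
  freshman {p = suc n} pr S S0 S+ x y Sxy =
    sum Q , S-sum Q SQ , (begin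
      (x + y) ^ p
        ≈⟨ B.theorem p x y ⟩
      T Fin.zero + sum (λ i → T (Fin.suc i))
        ≈⟨ +-cong T0 (sum-init-last {n} (λ i → T (Fin.suc i))) ⟩
      y ^ p + (sum (λ i → T (Fin.suc (inject₁ i))) + T (fromℕ p))
        ≈⟨ +-congˡ (+-cong (trans (sum-cong-≋ mid) (dist Q)) Tp) ⟩
      y ^ p + (p · sum Q + x ^ p)
        ≈⟨ trans (sym (+-assoc _ _ _)) (trans (+-comm _ _) (sym (+-assoc _ _ _))) ⟩
      x ^ p + y ^ p + p · sum Q ∎)
    where
    p = suc n
    T : Fin (suc p) → Carrier
    T = SB.binomialTerm x y p
    T0 : T Fin.zero ≈ y ^ p
    T0 = trans (×-homo-1 _) (*-identityˡ _)
    Tp : T (fromℕ p) ≈ x ^ p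
    Tp = begin
      (p C toℕ (fromℕ p)) · (x ^ toℕ (fromℕ p) * y ^ (p ∸ toℕ (fromℕ p)))
        ≡⟨ ≡.cong (λ z → (p C z) · (x ^ z * y ^ (p ∸ z))) (Finₚ.toℕ-fromℕ p) ⟩
      (p C p) · (x ^ p * y ^ (p ∸ p))
        ≡⟨ ≡.cong₂ (λ u v → u · (x ^ p * y ^ v)) (nCn≡1 p) (ℕₚ.n∸n≡0 p) ⟩
      1 · (x ^ p * 1#) ≈⟨ trans (×-homo-1 _) (*-identityʳ _) ⟩
      x ^ p ∎
    k : Fin n → ℕ
    k i = toℕ (inject₁ i)
    k<n : ∀ i → k i < n
    k<n i = ≡.subst (_< n) (≡.sym (Finₚ.toℕ-inject₁ i)) (Finₚ.toℕ<n i)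
    p∣ : ∀ i → p ∣ (p C suc (k i))
    p∣ i = prime∣C pr (k i) (s≤s (k<n i))
    Q : Fin n → Carrier
    Q i = quotient (p∣ i) · (x ^ suc (k i) * y ^ (n ∸ k i))
    mid : ∀ i → T (Fin.suc (inject₁ i)) ≈ p · Q i
    mid i = trans (×-congˡ {m} (≡.trans (_∣_.equality (p∣ i)) (ℕₚ.*-comm (quotient (p∣ i)) p))) (sym (×-assocˡ m p
        (quotient (p∣ i))))
      where m = x ^ suc (k i) * y ^ (n ∸ k i)
    dist : ∀ {m} (f : Fin m → Carrier) → sum (λ i → p · f i) ≈ p · sum f
    dist {zero} f = sym (0·  p)
      where 0· : ∀ m → m · 0# ≈ 0#
            0· zero = refl
            0· (suc m) = trans (+-identityˡ _) (0· m)
    dist {suc m} f = trans (+-congˡ (dist (λ i → f (Fin.suc i)))) (sym (·-distrib-+ _ _ p))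
    S· : ∀ m {a} → S a → S (m · a)
    S· zero s = S0
    S· (suc m) s = S+ s (S· m s)
    SQ : ∀ i → S (Q i)
    SQ i = S· (quotient (p∣ i)) (≡.subst (λ z → S (x ^ suc (k i) * y ^ z)) (≡.sym e)
             (Sxy (k i) (n ∸ suc (k i)) (≡.trans (≡.cong (suc (k i) ℕ.+_) (≡.sym e)) (≡.cong suc (ℕₚ.m+[n∸m]≡n (ℕₚ.<⇒≤
                 (k<n i)))))))
      where e : n ∸ k i ≡ suc (n ∸ suc (k i))
            e = ℕₚ.+-∸-assoc 1 (k<n i)
    S-sum : ∀ {m} (f : Fin m → Carrier) → (∀ i → S (f i)) → S (sum f)
    S-sum {zero} f s = S0
    S-sum {suc m} f s = S+ (s Fin.zero) (S-sum (λ i → f (Fin.suc i)) (λ i → s (Fin.suc i)))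

-- Arithmetic of finite fields

module Field {c ℓ : Level} (F : FiniteField c ℓ) where
  open FiniteField F
  open import Algebra.Properties.Semiring.Mult semiring renaming (_×_ to _·_)
  open import Algebra.Properties.CommutativeMonoid.Mult +-commutativeMonoid using () renaming
      (×-distrib-+ to ·-distrib-+)
  open import Algebra.Properties.CommutativeSemiring.Exp commutativeSemiring
  open import Algebra.Properties.Ring ring using (+-cancelˡ) renaming (x∙y⁻¹≈ε⇒x≈y to x-y≈0⇒x≈y)
  open import Algebra.Solver.Ring.NaturalCoefficients.Default commutativeSemiring
  open import Relation.Binary.Reasoning.Setoid setoid

  idx : Carrier → Fin q
  idx x = proj₁ (enum-surj x)

  enum-idx : ∀ x → enum (idx x) ≈ x
  enum-idx x = proj₂ (enum-surj x)

  idx-cong : ∀ {x y} → x ≈ y → idx x ≡ idx y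
  idx-cong {x} {y} e = enum-inj _ _ (trans (enum-idx x) (trans e (sym (enum-idx y))))

  idx-enum : ∀ i → idx (enum i) ≡ i
  idx-enum i = enum-inj _ _ (enum-idx (enum i))

  ^F≈^ : ∀ x m → x ^F m ≈ x ^ m
  ^F≈^ x zero = refl
  ^F≈^ x (suc m) = *-congˡ (^F≈^ x m)

  *-cancel-≉0 : ∀ {x y} → ¬ x ≈ 0# → x * y ≈ 0# → y ≈ 0#
  *-cancel-≉0 {x} {y} x≉0 xy≈0 with inverse x x≉0
  ... | z , xz≈1 = begin
    y              ≈⟨ *-identityˡ y ⟨
    1# * y         ≈⟨ *-congʳ xz≈1 ⟨
    (x * z) * y    ≈⟨ solve 3 (λ x y z → (x :* z) :* y := z :* (x :* y)) refl x y z ⟩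
    z * (x * y)    ≈⟨ *-congˡ xy≈0 ⟩
    z * 0#         ≈⟨ zeroʳ z ⟩
    0#             ∎

  *-≉0 : ∀ {x y} → ¬ x ≈ 0# → ¬ y ≈ 0# → ¬ x * y ≈ 0#
  *-≉0 x≉0 y≉0 xy≈0 = y≉0 (*-cancel-≉0 x≉0 xy≈0)

  *-cancelˡ-≉0 : ∀ {x y z} → ¬ x ≈ 0# → x * y ≈ x * z → y ≈ z
  *-cancelˡ-≉0 {x} {y} {z} x≉0 e = begin
    y                ≈⟨ lemma y ⟨
    w * (x * y)      ≈⟨ *-congˡ e ⟩
    w * (x * z)      ≈⟨ lemma z ⟩
    z                ∎
    where
    w = proj₁ (inverse x x≉0)
    lemma : ∀ y → w * (x * y) ≈ y
    lemma y = trans (trans (sym (*-assoc w x y)) (*-congʳ (trans (*-comm w x) (proj₂ (inverse x x≉0))))) (*-identityˡ y)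

  module Reindex {a b} (M : CommutativeMonoid a b) where
    private module M = CommutativeMonoid M
    open import Algebra.Properties.CommutativeMonoid.Sum M public

    -- Stated over any commutative monoid, since translation by 1 and scaling reindex sums, while
    -- `fermat` reindexes a product.
    ∑-reindex : (h : Carrier → M.Carrier) → (∀ {x y} → x ≈ y → h x M.≈ h y) →
      (f g : Carrier → Carrier) → (∀ {x y} → x ≈ y → f x ≈ f y) → (∀ {x y} → x ≈ y → g x ≈ g y) →
      (∀ x → f (g x) ≈ x) → (∀ x → g (f x) ≈ x) →
      sum (λ i → h (enum i)) M.≈ sum (λ i → h (f (enum i)))
    ∑-reindex h h-cong f g f-cong g-cong fg gf = M.trans (sum-permute (λ i → h (enum i)) π)
      (sum-cong-≋ (λ i → h-cong (enum-idx (f (enum i)))))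
      where
      inv : ∀ f g → (∀ {x y} → x ≈ y → f x ≈ f y) → (∀ x → f (g x) ≈ x) → ∀ i → idx (f (enum (idx (g (enum i))))) ≡ i
      inv f g f-cong fg i = ≡.trans (idx-cong (trans (f-cong (enum-idx _)) (fg (enum i)))) (idx-enum i)
      π : Permutation q q
      π = permutation (λ i → idx (f (enum i))) (λ i → idx (g (enum i))) (inv f g f-cong fg) (inv g f g-cong gf)

  module _ where
    open Reindex +-commutativeMonoid

    -- Translation by 1 permutes F, so the sum of all elements does not change when 1 is added to
    -- each of the q summands.
    q·1≈0 : q · 1# ≈ 0#
    q·1≈0 = +-cancelˡ S (q · 1#) 0# (begin
      S + q · 1#                          ≈⟨ +-congˡ (sum-replicate q) ⟨
      S + sum {q} (λ _ → 1#)              ≈⟨ ∑-distrib-+ {q} enum (λ _ → 1#) ⟨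
      sum {q} (λ i → enum i + 1#)         ≈⟨ ∑-reindex (λ x → x) (λ e → e) (_+ 1#) (_- 1#) +-congʳ +-congʳ
                                              (λ x → trans (+-assoc x _ _) (trans (+-congˡ (-‿inverseˡ 1#))
                                                  (+-identityʳ x)))
                                              (λ x → trans (+-assoc x _ _) (trans (+-congˡ (-‿inverseʳ 1#))
                                                  (+-identityʳ x))) ⟨
      S                                   ≈⟨ +-identityʳ S ⟨
      S + 0#                              ∎)
      where S = sum {q} enum

  -- F has no zero divisors, so if a product of primes vanishes in F, one of the primes does;
  -- applied to the factorisation of q.
  primeFactor : ∀ {ps} → All Prime ps → product ps · 1# ≈ 0# → ∃ λ p → Prime p × p · 1# ≈ 0#
  primeFactor [] e = contradiction (trans (sym (×-homo-1 1#)) e) 1≉0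
  primeFactor {p ∷ ps} (pr ∷ prs) e with (p · 1#) ≟F 0#
  ... | yes p≈0 = p , pr , p≈0
  ... | no p≉0 = primeFactor prs (*-cancel-≉0 p≉0 (trans (sym (×1-homo-* p (product ps))) e))

  instance
    q-nonZero : NonZero q
    q-nonZero = ℕ.>-nonZero (ℕₚ.≤-<-trans z≤n (Finₚ.toℕ<n (idx 0#)))

  characteristic : ∃ λ p → Prime p × p · 1# ≈ 0#
  characteristic = primeFactor factorsPrime (≡.subst (λ n → n · 1# ≈ 0#) isFactorisation q·1≈0)
    where open PrimeFactorisation (factorise q)

  1<q : 1 < q
  1<q = ≡.subst (1 <_) (ℕₚ.suc-pred q) (s≤s (ℕₚ.≤∧≢⇒< z≤n λ e → no-unit (≡.trans (≡.sym (ℕₚ.suc-pred q)) (≡.cong suc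
      (≡.sym e)))))
    where
    no-unit : ¬ (q ≡ 1)
    no-unit q≡1 = 1≉0 (begin
      1#            ≈⟨ enum-idx 1# ⟨
      enum (idx 1#) ≡⟨ ≡.cong enum (Finₚ.toℕ-injective (≡.trans (z (idx 1#)) (≡.sym (z (idx 0#))))) ⟩
      enum (idx 0#) ≈⟨ enum-idx 0# ⟩
      0#            ∎)
      where z : ∀ i → toℕ i ≡ 0
            z i = ℕₚ.n<1⇒n≡0 (≡.subst (toℕ i <_) q≡1 (Finₚ.toℕ<n i))

  module _ where
    open Reindex *-commutativeMonoid
    open CommutativeRing commRing using (*-commutativeMonoid)

    ∏-const-except : ∀ m (i₀ : Fin m) (g : Carrier) (k : Fin m → Carrier) → k i₀ ≈ 1# →
                     (∀ i → ¬ i ≡ i₀ → k i ≈ g) → sum k ≈ g ^ (m ∸ 1)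
    ∏-const-except (suc m) i₀ g k k₀ kᵢ = begin
      sum k                               ≈⟨ sum-remove {m} {i₀} k ⟩
      k i₀ * sum (λ j → k (punchIn i₀ j)) ≈⟨ *-cong k₀ (sum-cong-≋ (λ j → kᵢ _ (Finₚ.punchInᵢ≢i i₀ j))) ⟩
      1# * sum {m} (λ _ → g)              ≈⟨ *-identityˡ _ ⟩
      sum {m} (λ _ → g)                   ≈⟨ sum-replicate m ⟩
      g ^ m                               ∎

    ∏-≉0 : ∀ {m} (k : Fin m → Carrier) → (∀ i → ¬ k i ≈ 0#) → ¬ sum k ≈ 0#
    ∏-≉0 {zero} k k≉0 = 1≉0
    ∏-≉0 {suc m} k k≉0 = *-≉0 (k≉0 Fin.zero) (∏-≉0 (λ i → k (Fin.suc i)) (λ i → k≉0 (Fin.suc i)))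

    -- Multiplication by g permutes F; replacing the value at 0 by 1 keeps the product nonzero.
    fermat : ∀ g → ¬ g ≈ 0# → g ^ (q ∸ 1) ≈ 1#
    fermat g g≉0 = *-cancelˡ-≉0 P≉0 (begin
      P * g ^ (q ∸ 1)                        ≈⟨ *-congˡ (∏-const-except q (idx 0#) g (λ i →
          k (enum i)) (k≈1 _ (enum-idx 0#)) (λ i ne → k≈g _ (λ e → ne (≡.trans (≡.sym (idx-enum i)) (idx-cong e))))) ⟨
      P * sum (λ i → k (enum i))             ≈⟨ ∑-distrib-+ (λ i → h (enum i)) (λ i → k (enum i)) ⟨
      sum (λ i → h (enum i) * k (enum i))    ≈⟨ sum-cong-≋ (λ i → hk (enum i)) ⟩
      sum (λ i → h (g * enum i))             ≈⟨ ∑-reindex h h-cong (g *_) (g⁻¹ *_) *-congˡ *-congˡ gg⁻¹ g⁻¹g ⟨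
      P                                      ≈⟨ *-identityʳ P ⟨
      P * 1#                                 ∎)
      where
      g⁻¹ = proj₁ (inverse g g≉0)
      gg⁻¹ : ∀ x → g * (g⁻¹ * x) ≈ x
      gg⁻¹ x = trans (sym (*-assoc _ _ _)) (trans (*-congʳ (proj₂ (inverse g g≉0))) (*-identityˡ x))
      g⁻¹g : ∀ x → g⁻¹ * (g * x) ≈ x
      g⁻¹g x = trans (solve 3 (λ a b x → a :* (b :* x) := b :* (a :* x)) refl g⁻¹ g x) (gg⁻¹ x)
      h k : Carrier → Carrier
      h x with x ≟F 0#
      ... | yes _ = 1#
      ... | no _ = x
      k x with x ≟F 0#
      ... | yes _ = 1#
      ... | no _ = g
      h≈1 : ∀ x → x ≈ 0# → h x ≈ 1#
      h≈1 x e with x ≟F 0#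
      ... | yes _ = refl
      ... | no ne = contradiction e ne
      h≈x : ∀ x → ¬ x ≈ 0# → h x ≈ x
      h≈x x ne with x ≟F 0#
      ... | yes e = contradiction e ne
      ... | no _ = refl
      k≈1 : ∀ x → x ≈ 0# → k x ≈ 1#
      k≈1 x e with x ≟F 0#
      ... | yes _ = refl
      ... | no ne = contradiction e ne
      k≈g : ∀ x → ¬ x ≈ 0# → k x ≈ g
      k≈g x ne with x ≟F 0#
      ... | yes e = contradiction e ne
      ... | no _ = refl
      h-cong : ∀ {x y} → x ≈ y → h x ≈ h y
      h-cong {x} {y} e with x ≟F 0#
      ... | yes x≈0 = sym (h≈1 y (trans (sym e) x≈0))
      ... | no x≉0 = trans e (sym (h≈x y (λ y≈0 → x≉0 (trans e y≈0))))
      hk : ∀ x → h x * k x ≈ h (g * x)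
      hk x with x ≟F 0#
      ... | yes x≈0 = trans (*-identityˡ 1#) (sym (h≈1 _ (trans (*-congˡ x≈0) (zeroʳ g))))
      ... | no x≉0 = trans (*-comm x g) (sym (h≈x _ (*-≉0 g≉0 x≉0)))
      h≉0 : ∀ x → ¬ h x ≈ 0#
      h≉0 x with x ≟F 0#
      ... | yes _ = 1≉0
      ... | no x≉0 = x≉0
      P = sum (λ i → h (enum i))
      P≉0 : ¬ P ≈ 0#
      P≉0 = ∏-≉0 _ (λ i → h≉0 (enum i))

  -- Horner form, lowest coefficient first, with an implicit leading coefficient 1, so that the
  -- degree is the length of the list.
  evalMonic : List Carrier → Carrier → Carrier
  evalMonic [] x = 1#
  evalMonic (c ∷ cs) x = c + x * evalMonic cs x

  -- Synthetic division: the listed coefficients of the quotient are the values at `a` of the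
  -- successive tails. The factor x - a appears as a `y` with x ≈ y + a, which keeps the computation
  -- free of subtraction.
  monic-divide : ∀ d cs → length cs ≡ suc d → ∀ a → ∃ λ ks → length ks ≡ d ×
    (∀ x y → x ≈ y + a → evalMonic cs x ≈ y * evalMonic ks x + evalMonic cs a)
  monic-divide zero (c ∷ []) _ a = [] , ≡.refl , λ x y e → begin
    c + x * 1#              ≈⟨ +-congˡ (*-congʳ e) ⟩
    c + (y + a) * 1#        ≈⟨ solve 4 (λ c y a o → c :+ (y :+ a) :* o := y :* o :+ (c :+ a :* o)) refl c y a 1# ⟩
    y * 1# + (c + a * 1#)   ∎
  monic-divide (suc d) (c ∷ cs) len a with monic-divide d cs (ℕₚ.suc-injective len) a
  ... | ks , lenks , div = evalMonic cs a ∷ ks , ≡.cong suc lenks , λ x y e → begin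
    c + x * evalMonic cs x
      ≈⟨ +-congˡ (*-congˡ (div x y e)) ⟩
    c + x * (y * evalMonic ks x + evalMonic cs a)
      ≈⟨ solve 5 (λ c x y k v → c :+ x :* (y :* k :+ v) := y :* (x :* k) :+ (c :+ x :* v)) refl c x y (evalMonic ks x)
          (evalMonic cs a) ⟩
    y * (x * evalMonic ks x) + (c + x * evalMonic cs a)
      ≈⟨ +-congˡ (+-congˡ (*-congʳ e)) ⟩
    y * (x * evalMonic ks x) + (c + (y + a) * evalMonic cs a)
      ≈⟨ solve 5 (λ c y a v k → y :* k :+ (c :+ (y :+ a) :* v) := y :* (v :+ k) :+ (c :+ a :* v)) refl c y a
          (evalMonic cs a) (x * evalMonic ks x) ⟩
    y * (evalMonic cs a + x * evalMonic ks x) + (c + a * evalMonic cs a) ∎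

  monic-roots : ∀ d cs → length cs ≡ d → ∀ m (ρ : Fin m → Carrier) → (∀ i j → ρ i ≈ ρ j → i ≡ j) →
                (∀ i → evalMonic cs (ρ i) ≈ 0#) → m ≤ d
  monic-roots d cs len zero ρ inj root = z≤n
  monic-roots zero [] len (suc m) ρ inj root = contradiction (root Fin.zero) 1≉0
  monic-roots (suc d) cs len (suc m) ρ inj root with monic-divide d cs len (ρ Fin.zero)
  ... | ks , lenks , div = s≤s (monic-roots d ks lenks m (λ i → ρ (Fin.suc i))
    (λ i j e → Finₚ.suc-injective (inj _ _ e))
    (λ i → *-cancel-≉0 (λ e → contradiction (inj (Fin.suc i) Fin.zero (x-y≈0⇒x≈y _ _ e)) λ ()) (begin
      (ρ (Fin.suc i) - a) * evalMonic ks (ρ (Fin.suc i))                        ≈⟨ +-identityʳ _ ⟨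
      (ρ (Fin.suc i) - a) * evalMonic ks (ρ (Fin.suc i)) + 0#                   ≈⟨ +-congˡ (root Fin.zero) ⟨
      (ρ (Fin.suc i) - a) * evalMonic ks (ρ (Fin.suc i)) + evalMonic cs a       ≈⟨ div _ _ (sym (trans (+-assoc _ _ _)
          (trans (+-congˡ (-‿inverseˡ a)) (+-identityʳ _)))) ⟨
      evalMonic cs (ρ (Fin.suc i))                                              ≈⟨ root (Fin.suc i) ⟩
      0#                                                                        ∎)))
    where a = ρ Fin.zero

  roots-of-unity : ∀ k → (∀ x → ¬ x ≈ 0# → x ^ suc k ≈ 1#) → q ∸ 1 ≤ suc k
  roots-of-unity k all1 = lemma q (idx 0#) ≡.refl ≡.refl
    where
    cs = - 1# ∷ replicate k 0#
    eval-cs : ∀ x → evalMonic cs x ≈ - 1# + x ^ suc k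
    eval-cs x = +-congˡ (*-congˡ (ev k))
      where ev : ∀ k → evalMonic (replicate k 0#) x ≈ x ^ k
            ev zero = refl
            ev (suc k) = trans (+-identityˡ _) (*-congˡ (ev k))
    -- q is generalised to a variable `m` that can be matched against a successor; `punchIn` then
    -- enumerates F without its zero.
    lemma : ∀ m (i₀ : Fin m) (e : m ≡ q) → ≡.subst Fin e i₀ ≡ idx 0# → m ∸ 1 ≤ suc k
    lemma (suc m) i₀ ≡.refl i₀≡ = monic-roots (suc k) cs (≡.cong suc (length-replicate k)) m
      (λ i → enum (punchIn i₀ i))
      (λ i j e → Finₚ.punchIn-injective i₀ i j (enum-inj _ _ e))
      (λ i → trans (eval-cs _) (trans (+-congˡ (all1 _ (λ e → Finₚ.punchInᵢ≢i i₀ i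
        (≡.trans (≡.sym (idx-enum _)) (≡.trans (idx-cong e) (≡.sym i₀≡)))))) (-‿inverseˡ 1#)))

  instance
    r-nonZero : NonZero (q ∸ 1)
    r-nonZero = ℕ.>-nonZero (ℕₚ.m<n⇒0<n∸m 1<q)

  1^ : ∀ m → 1# ^ m ≈ 1#
  1^ zero = refl
  1^ (suc m) = trans (*-identityˡ _) (1^ m)

  -- This takes the place of a generator of the multiplicative group. If g ^ u ≈ 1 for all g ≠ 0,
  -- then by Fermat also g ^ (u % r) ≈ 1, with r = q - 1, and a monic polynomial of positive degree
  -- below r would have r roots.
  nontrivial-power : ∀ u → ¬ (q ∸ 1) ∣ u → ∃ λ g → ¬ g ≈ 0# × ¬ g ^ u ≈ 1#
  nontrivial-power u r∤u with Finₚ.any? (λ i → ¬? (enum i ≟F 0#) ×-dec ¬? ((enum i ^ u) ≟F 1#))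
  ... | yes (i , w) = enum i , w
  ... | no none = contradiction (roots-of-unity′ (u % r) ≡.refl all-k) (ℕₚ.<⇒≱ (m%n<n u r))
    where
    r = q ∸ 1
    all-u : ∀ x → ¬ x ≈ 0# → x ^ u ≈ 1#
    all-u x x≉0 = decidable-stable ((x ^ u) ≟F 1#) λ ne →
      none (idx x , (λ e → x≉0 (trans (sym (enum-idx x)) e)) , λ e → ne (trans (^-congˡ u (sym (enum-idx x))) e))
    all-k : ∀ x → ¬ x ≈ 0# → x ^ (u % r) ≈ 1#
    all-k x x≉0 = begin
      x ^ (u % r)                               ≈⟨ *-identityʳ _ ⟨
      x ^ (u % r) * 1#                          ≈⟨ *-congˡ (trans (^-congˡ (u / r) (fermat x x≉0)) (1^ (u / r))) ⟨
      x ^ (u % r) * (x ^ r) ^ (u / r)           ≈⟨ *-congˡ (trans (^-assocʳ x r (u / r)) (^-congʳ x (ℕₚ.*-comm r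
          (u / r)))) ⟩
      x ^ (u % r) * x ^ (u / r ℕ.* r)           ≈⟨ ^-homo-* x (u % r) _ ⟨
      x ^ (u % r ℕ.+ u / r ℕ.* r)               ≡⟨ ≡.cong (x ^_) (m≡m%n+[m/n]*n u r) ⟨
      x ^ u                                     ≈⟨ all-u x x≉0 ⟩
      1#                                        ∎
    roots-of-unity′ : ∀ k → u % r ≡ k → (∀ x → ¬ x ≈ 0# → x ^ k ≈ 1#) → r ≤ k
    roots-of-unity′ zero e _ = contradiction (m%n≡0⇒n∣m u r e) r∤u
    roots-of-unity′ (suc k) e all1 = roots-of-unity k all1

  -- Characteristic p, and the order of F as a power of p

  IsCharacteristic : ℕ → Set ℓ
  IsCharacteristic p = p · 1# ≈ 0#

  module Characteristic {p : ℕ} (p-prime : Prime p) (p·1≈0 : IsCharacteristic p) where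

    instance
      p-nonZero : NonZero p
      p-nonZero = prime⇒nonZero p-prime

    ·-as-* : ∀ n x → n · x ≈ (n · 1#) * x
    ·-as-* n x = trans (×-congʳ n (sym (*-identityˡ x))) (sym (×-assoc-* n 1# x))

    p·x≈0 : ∀ x → p · x ≈ 0#
    p·x≈0 x = trans (·-as-* p x) (trans (*-congʳ p·1≈0) (zeroˡ x))

    ·-0# : ∀ n → n · 0# ≈ 0#
    ·-0# n = trans (·-as-* n 0#) (zeroʳ _)

    [kp]·x≈0 : ∀ k x → (k ℕ.* p) · x ≈ 0#
    [kp]·x≈0 k x = trans (sym (×-assocˡ x k p)) (trans (×-congʳ k (p·x≈0 x)) (·-0# k))

    ·-mod : ∀ n x → n · x ≈ (n % p) · x
    ·-mod n x = begin
      n · x                                 ≡⟨ ≡.cong (_· x) (m≡m%n+[m/n]*n n p) ⟩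
      (n % p ℕ.+ n / p ℕ.* p) · x           ≈⟨ ×-homo-+ x (n % p) _ ⟩
      (n % p) · x + (n / p ℕ.* p) · x       ≈⟨ +-congˡ ([kp]·x≈0 (n / p) x) ⟩
      (n % p) · x + 0#                      ≈⟨ +-identityʳ _ ⟩
      (n % p) · x                           ∎

    module _ {t} (M : Carrier → Set t) (resp : ∀ {x y} → x ≈ y → M x → M y) (M0 : M 0#)
             (M+ : ∀ {x y} → M x → M y → M (x + y)) where

      closed-· : ∀ n {x} → M x → M (n · x)
      closed-· zero m = M0
      closed-· (suc n) m = M+ m (closed-· n m)

      closed-neg : ∀ {x} → M x → M (- x)
      closed-neg {x} m = resp eq (closed-· (ℕ.pred p) m)
        where
        eq : ℕ.pred p · x ≈ - x
        eq = inverseʳ-unique x _ (trans (×-congˡ {x} (ℕₚ.suc-pred p)) (p·x≈0 x))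
          where open import Algebra.Properties.Group +-group using (inverseʳ-unique)

      -- By Bézout, d is invertible modulo p, so v is up to sign a natural multiple of d · v. With
      -- `M` the zero element this gives `char-∣`; with `M` a subgroup it separates the cosets in
      -- `extend-subgroup`.
      closed-divide : ∀ d → 0 < d → d < p → ∀ v → M (d · v) → M v
      closed-divide d 0<d d<p v m with coprime-Bézout (prime⇒coprime p-prime {{ℕ.>-nonZero 0<d}} d<p)
      ... | Bézout.+- x y eq = resp v≈ (closed-neg (closed-· y m))
        where
        open import Algebra.Properties.Group +-group using (inverseˡ-unique)
        v≈ : - (y · (d · v)) ≈ v
        v≈ = sym (inverseˡ-unique v _ (begin
          v + y · (d · v)          ≈⟨ +-congˡ (×-assocˡ v y d) ⟩
          (1 ℕ.+ y ℕ.* d) · v      ≡⟨ ≡.cong (_· v) eq ⟩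
          (x ℕ.* p) · v            ≈⟨ [kp]·x≈0 x v ⟩
          0#                       ∎))
      ... | Bézout.-+ x y eq = resp (begin
          y · (d · v)              ≈⟨ ×-assocˡ v y d ⟩
          (y ℕ.* d) · v            ≡⟨ ≡.cong (_· v) (≡.sym eq) ⟩
          v + (x ℕ.* p) · v        ≈⟨ +-congˡ ([kp]·x≈0 x v) ⟩
          v + 0#                   ≈⟨ +-identityʳ v ⟩
          v                        ∎) (closed-· y m)

    char-∣ : ∀ n → n · 1# ≈ 0# → p ∣ n
    char-∣ n n·1≈0 with n % p ℕ.≟ 0
    ... | yes e = m%n≡0⇒n∣m n p e
    ... | no ne = contradiction
      (closed-divide (_≈ 0#) (λ e x≈0 → trans (sym e) x≈0) refl (λ x≈0 y≈0 → trans (+-cong x≈0 y≈0) (+-identityˡ 0#))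
        (n % p) (ℕₚ.n≢0⇒n>0 ne) (m%n<n n p) 1# (trans (sym (·-mod n 1#)) n·1≈0)) 1≉0

    -- Closure under negation is automatic, as - x is (p - 1) · x. Such subgroups are enlarged until
    -- they exhaust F, which yields q = p ^ s without bases or dimension.
    record FinSubgroup (k : ℕ) : Set (c ⊔ ℓ) where
      field
        elt    : Fin (p ℕ.^ k) → Carrier
        inj    : ∀ i j → elt i ≈ elt j → i ≡ j
      Mem : Carrier → Set ℓ
      Mem x = ∃ λ i → elt i ≈ x
      field
        mem-0  : Mem 0#
        mem-+  : ∀ {x y} → Mem x → Mem y → Mem (x + y)
      resp : ∀ {x y} → x ≈ y → Mem x → Mem y
      resp e (i , m) = i , trans m e

    trivial-subgroup : FinSubgroup 0
    trivial-subgroup = record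
      { elt = λ _ → 0# ; inj = λ { Fin.zero Fin.zero _ → ≡.refl } ; mem-0 = Fin.zero , refl
      ; mem-+ = λ { (_ , a) (_ , b) → Fin.zero , trans (sym (+-identityˡ 0#)) (+-cong a b) } }

    -- The new subgroup is the union of the cosets c · v + S with c < p. If two of them met, some d
    -- · v with 0 < d < p would lie in S, and then v itself.
    extend-subgroup : ∀ {k} (S : FinSubgroup k) v → ¬ FinSubgroup.Mem S v → FinSubgroup (suc k)
    extend-subgroup {k} S v v∉S = record
      { elt = elt′ ; inj = inj′ ; mem-0 = Mem′-intro 0 mem-0 (+-identityˡ 0#)
      ; mem-+ = λ { (i , a) (j , b) → Mem′-intro (toℕ (proj₁ (split i)) ℕ.+ toℕ (proj₁ (split j)))
            (mem-+ (proj₂ (split i) , refl) (proj₂ (split j) , refl)) (add (proj₁ (split i)) (proj₂ (split i)) (proj₁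
                (split j)) (proj₂ (split j)) a b) } }
      where
      open FinSubgroup S
      split : Fin (p ℕ.* p ℕ.^ k) → Fin p × Fin (p ℕ.^ k)
      split = remQuot {p} (p ℕ.^ k)
      val : Fin p × Fin (p ℕ.^ k) → Carrier
      val (c , i) = toℕ c · v + elt i
      elt′ : Fin (p ℕ.* p ℕ.^ k) → Carrier
      elt′ z = val (split z)
      Mem′-intro : ∀ n {x y} → Mem x → n · v + x ≈ y → ∃ λ i → elt′ i ≈ y
      Mem′-intro n {x} {y} (i , m) e = combine (fromℕ< (m%n<n n p)) i , (begin
        val (split (combine (fromℕ< (m%n<n n p)) i)) ≡⟨ ≡.cong val (Finₚ.remQuot-combine {p} {p ℕ.^ k} _ i) ⟩
        toℕ (fromℕ< (m%n<n n p)) · v + elt i       ≡⟨ ≡.cong (λ c → c · v + elt i) (Finₚ.toℕ-fromℕ< (m%n<n n p)) ⟩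
        (n % p) · v + elt i                        ≈⟨ +-cong (sym (·-mod n v)) m ⟩
        n · v + x                                  ≈⟨ e ⟩
        y                                          ∎)
      add : ∀ c i d j {x y} → val (c , i) ≈ x → val (d , j) ≈ y → (toℕ c ℕ.+ toℕ d) · v + (elt i + elt j) ≈ x + y
      add c i d j a b = trans (+-congʳ (×-homo-+ v (toℕ c) (toℕ d))) (trans
        (solve 4 (λ a b c d → (a :+ b) :+ (c :+ d) := (a :+ c) :+ (b :+ d)) refl (toℕ c · v) (toℕ d · v) (elt i)
            (elt j)) (+-cong a b))
      distinct-coset : ∀ (c d : Fin p) i j → toℕ c < toℕ d → ¬ val (c , i) ≈ val (d , j)
      distinct-coset c d i j c<d e = v∉S (closed-divide Mem resp mem-0 mem-+ δ (ℕₚ.m<n⇒0<n∸m c<d)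
        (ℕₚ.≤-<-trans (ℕₚ.m∸n≤m (toℕ d) (toℕ c)) (Finₚ.toℕ<n d)) v
        (resp δv (mem-+ (i , refl) (closed-neg Mem resp mem-0 mem-+ (j , refl)))))
        where
        δ = toℕ d ∸ toℕ c
        eq : elt i ≈ δ · v + elt j
        eq = +-cancelˡ (toℕ c · v) _ _ (begin
          toℕ c · v + elt i                ≈⟨ e ⟩
          toℕ d · v + elt j                ≡⟨ ≡.cong (λ m → m · v + elt j) (≡.sym (ℕₚ.m+[n∸m]≡n (ℕₚ.<⇒≤ c<d))) ⟩
          (toℕ c ℕ.+ δ) · v + elt j        ≈⟨ +-congʳ (×-homo-+ v (toℕ c) δ) ⟩
          (toℕ c · v + δ · v) + elt j      ≈⟨ +-assoc _ _ _ ⟩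
          toℕ c · v + (δ · v + elt j)      ∎)
        δv : elt i - elt j ≈ δ · v
        δv = begin
          elt i - elt j                    ≈⟨ +-congʳ eq ⟩
          δ · v + elt j - elt j            ≈⟨ +-assoc _ _ _ ⟩
          δ · v + (elt j - elt j)          ≈⟨ +-congˡ (-‿inverseʳ _) ⟩
          δ · v + 0#                       ≈⟨ +-identityʳ _ ⟩
          δ · v                            ∎
      val-inj : ∀ z w → val z ≈ val w → z ≡ w
      val-inj (c , i) (d , j) e with ℕₚ.<-cmp (toℕ c) (toℕ d)
      ... | tri< c<d _ _ = contradiction e (distinct-coset c d i j c<d)
      ... | tri> _ _ d<c = contradiction (sym e) (distinct-coset d c j i d<c)
      ... | tri≈ _ c≡d _ with Finₚ.toℕ-injective c≡d
      ...   | ≡.refl = ≡.cong (c ,_) (inj i j (+-cancelˡ _ _ _ e))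
      inj′ : ∀ i j → elt′ i ≈ elt′ j → i ≡ j
      inj′ i j e = ≡.trans (≡.sym (Finₚ.combine-remQuot {p} (p ℕ.^ k) i))
        (≡.trans (≡.cong (uncurry combine) (val-inj _ _ e)) (Finₚ.combine-remQuot {p} (p ℕ.^ k) j))

    subgroup-order≤q : ∀ {k} → FinSubgroup k → p ℕ.^ k ≤ q
    subgroup-order≤q S = Finₚ.injective⇒≤ {f = λ i → idx (elt i)}
      (λ {i} {j} e → inj i j (trans (sym (enum-idx _)) (trans (reflexive (≡.cong enum e)) (enum-idx _))))
      where open FinSubgroup S

    k<p^k : ∀ k → k < p ℕ.^ k
    k<p^k zero = s≤s z≤n
    k<p^k (suc k) = ℕₚ.≤-trans (s≤s (k<p^k k)) (ℕₚ.^-monoʳ-< p (ℕ.nonTrivial⇒n>1 p {{prime⇒nonTrivial p-prime}})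
        (ℕₚ.n<1+n k))

    order-from : ∀ fuel k → q ≤ fuel ℕ.+ k → FinSubgroup k → ∃ λ s → q ≡ p ℕ.^ s
    -- Without fuel k is at least q, but k < p ^ k ≤ q.
    order-from zero k q≤k S = contradiction (ℕₚ.<-≤-trans (k<p^k k) (subgroup-order≤q S)) (ℕₚ.≤⇒≯ q≤k)
    order-from (suc fuel) k q≤ S with Finₚ.all? (λ j → Finₚ.any? (λ i → FinSubgroup.elt S i ≟F enum j))
    ... | yes surj = k , ℕₚ.≤-antisym
      (Finₚ.injective⇒≤ {f = λ j → proj₁ (surj j)}
        (λ {i} {j} e → enum-inj i j (trans (sym (proj₂ (surj i))) (trans (reflexive (≡.cong (FinSubgroup.elt S) e))
            (proj₂ (surj j))))))
      (subgroup-order≤q S)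
    ... | no ¬surj with Finₚ.¬∀⟶∃¬ q _ (λ j → Finₚ.any? (λ i → FinSubgroup.elt S i ≟F enum j)) ¬surj
    ...   | j , v∉S = order-from fuel (suc k) (≡.subst (q ≤_) (≡.sym (ℕₚ.+-suc fuel k)) q≤) (extend-subgroup S
        (enum j) v∉S)

    order : ∃ λ s → q ≡ p ℕ.^ s
    order = order-from q 0 (ℕₚ.m≤m+n q 0) trivial-subgroup

-- Powers of an ideal

module IdealPowers {c ℓ i : Level} (R : CommutativeRing c ℓ) (I : CommutativeRing.Carrier R → Set i)
  (I-*ˡ : ∀ x {y} → I y → I (CommutativeRing._*_ R x y)) where
  open CommutativeRing R
  open import Algebra.Properties.Semiring.Mult semiring renaming (_×_ to _·_)
  open import Algebra.Properties.CommutativeSemiring.Exp commutativeSemiring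
  open import Algebra.Properties.Ring ring using (-1*x≈-x)
  open import Relation.Binary.Reasoning.Setoid setoid
  open Freshman R using (freshman)

  -- Sums are adjoined at every level, so `I` enters only through its closure under multiplication
  -- by ring elements; negatives come from multiplication by - 1. Facts about powers become
  -- inductions on how an element was generated.
  data Pow : ℕ → Carrier → Set (c ⊔ ℓ ⊔ i) where
    pow0 : ∀ {a} → Pow 0 a
    prod : ∀ {k a b} → I a → Pow k b → Pow (suc k) (a * b)
    pow-0# : ∀ {k} → Pow k 0#
    pow-+ : ∀ {k a b} → Pow k a → Pow k b → Pow k (a + b)
    pow-resp : ∀ {k a b} → a ≈ b → Pow k a → Pow k b

  pow-*ˡ : ∀ {k} a {b} → Pow k b → Pow k (a * b)
  pow-*ˡ a pow0 = pow0
  pow-*ˡ a (prod {a = x} {b = y} ix py) = pow-resp (*-assoc a x y) (prod (I-*ˡ a ix) py)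
  pow-*ˡ a pow-0# = pow-resp (sym (zeroʳ a)) pow-0#
  pow-*ˡ a (pow-+ x y) = pow-resp (sym (distribˡ a _ _)) (pow-+ (pow-*ˡ a x) (pow-*ˡ a y))
  pow-*ˡ a (pow-resp e x) = pow-resp (*-congˡ e) (pow-*ˡ a x)

  pow-*ʳ : ∀ {k} a {b} → Pow k b → Pow k (b * a)
  pow-*ʳ a x = pow-resp (*-comm a _) (pow-*ˡ a x)

  pow-pred : ∀ {k a} → Pow (suc k) a → Pow k a
  pow-pred (prod {a = x} ix py) = pow-*ˡ x py
  pow-pred pow-0# = pow-0#
  pow-pred (pow-+ x y) = pow-+ (pow-pred x) (pow-pred y)
  pow-pred (pow-resp e x) = pow-resp e (pow-pred x)

  pow-≤ : ∀ {j k a} → j ≤ k → Pow k a → Pow j a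
  pow-≤ j≤k = go (ℕₚ.≤⇒≤′ j≤k)
    where
    go : ∀ {j k a} → j ℕ.≤′ k → Pow k a → Pow j a
    go ℕ.≤′-refl x = x
    go (ℕ.≤′-step le) x = go le (pow-pred x)

  pow-* : ∀ {j k a b} → Pow j a → Pow k b → Pow (j ℕ.+ k) (a * b)
  pow-* {a = a} pow0 y = pow-*ˡ a y
  pow-* {b = b} (prod {a = x} {b = z} ix pz) y = pow-resp (sym (*-assoc x z b)) (prod ix (pow-* pz y))
  pow-* {b = b} pow-0# y = pow-resp (sym (zeroˡ b)) pow-0#
  pow-* {b = b} (pow-+ x x′) y = pow-resp (sym (distribʳ b _ _)) (pow-+ (pow-* x y) (pow-* x′ y))
  pow-* (pow-resp e x) y = pow-resp (*-congʳ e) (pow-* x y)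

  pow-neg : ∀ {k a} → Pow k a → Pow k (- a)
  pow-neg {a = a} x = pow-resp (-1*x≈-x a) (pow-*ˡ (- 1#) x)

  pow-^ : ∀ {j a} k → Pow j a → Pow (k ℕ.* j) (a ^ k)
  pow-^ zero x = pow0
  pow-^ (suc k) x = pow-* x (pow-^ k x)

  pow-1 : ∀ {a} → I a → Pow 1 a
  pow-1 {a} ia = pow-resp (*-identityʳ a) (prod ia pow0)

  ·-as-* : ∀ n x → n · x ≈ (n · 1#) * x
  ·-as-* n x = trans (×-congʳ n (sym (*-identityˡ x))) (sym (×-assoc-* n 1# x))

  module _ {p : ℕ} (p-prime : Prime p) (p∈I : I (p · 1#)) where

    pow-p· : ∀ {k a} → Pow k a → Pow (suc k) (p · a)
    pow-p· {a = a} x = pow-resp (sym (·-as-* p a)) (prod p∈I x)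

    -- In 1 + e ^ p + p · Q both corrections gain a level: p · Q because p lies in `I`, and e ^ p
    -- because p ≥ 2.
    [1+e]^p : ∀ {j} e → Pow (suc j) e → ∃ λ e′ → Pow (suc (suc j)) e′ × (1# + e) ^ p ≈ 1# + e′
    [1+e]^p {j} e x with freshman p-prime (Pow (suc j)) pow-0# pow-+ 1# e
        (λ a b _ → pow-*ˡ (1# ^ suc a) (pow-≤ (ℕₚ.m≤m+n (suc j) (b ℕ.* suc j)) (pow-^ (suc b) x)))
    ... | Q , xQ , eq = e ^ p + p · Q , pow-+ (pow-≤ le (pow-^ p x)) (pow-p· xQ) , (begin
      (1# + e) ^ p              ≈⟨ eq ⟩
      1# ^ p + e ^ p + p · Q    ≈⟨ +-congʳ (+-congʳ (1^ p)) ⟩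
      1# + e ^ p + p · Q        ≈⟨ +-assoc _ _ _ ⟩
      1# + (e ^ p + p · Q)      ∎)
      where
      1^ : ∀ m → 1# ^ m ≈ 1#
      1^ zero = refl
      1^ (suc m) = trans (*-identityˡ _) (1^ m)
      le : suc (suc j) ≤ p ℕ.* suc j
      le = ℕₚ.≤-trans (s≤s (ℕₚ.≤-trans (ℕₚ.m≤n+m (suc j) j) (ℕₚ.≤-reflexive (≡.cong (j ℕ.+_) (≡.sym (ℕₚ.+-identityʳ
          (suc j)))))))
             (ℕₚ.*-monoˡ-≤ (suc j) (ℕ.nonTrivial⇒n>1 p {{prime⇒nonTrivial p-prime}}))

    [1+e]^p^k : ∀ k e → Pow 1 e → ∃ λ e′ → Pow (suc k) e′ × (1# + e) ^ (p ℕ.^ k) ≈ 1# + e′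
    [1+e]^p^k zero e x = e , x , *-identityʳ _
    [1+e]^p^k (suc k) e x with [1+e]^p^k k e x
    ... | e₁ , x₁ , eq₁ with [1+e]^p e₁ x₁
    ... | e₂ , x₂ , eq₂ = e₂ , x₂ , (begin
      (1# + e) ^ (p ℕ.* p ℕ.^ k)     ≈⟨ ^-congʳ (1# + e) (ℕₚ.*-comm p (p ℕ.^ k)) ⟩
      (1# + e) ^ (p ℕ.^ k ℕ.* p)     ≈⟨ ^-assocʳ (1# + e) (p ℕ.^ k) p ⟨
      ((1# + e) ^ (p ℕ.^ k)) ^ p     ≈⟨ ^-congˡ p eq₁ ⟩
      (1# + e₁) ^ p                  ≈⟨ eq₂ ⟩
      1# + e₂                        ∎)

-- The integral monoid ring

module MonoidRing {X : Set} (_∙_ : X → X → X) (ε : X) (∙-comm : ∀ i j → i ∙ j ≡ j ∙ i)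
  (∙-assoc : ∀ i j k → (i ∙ j) ∙ k ≡ i ∙ (j ∙ k)) (∙-identityˡ : ∀ i → ε ∙ i ≡ i) where

  infixl 7 _⊛_
  infixl 6 _⊕_
  infix 8 ⊖_
  infix 4 _≋_

  data A : Set where
    𝟘 : A
    gen : X → A
    _⊕_ _⊛_ : A → A → A
    ⊖_ : A → A

  -- Elements are formal expressions; two of them are identified when the linear extension ev
  -- of every function χ : X → ℤ takes the same value on both.
  module Eval {a b} (G : CommutativeRing a b) where
    open CommutativeRing G
    open import Algebra.Properties.AbelianGroup +-abelianGroup using (⁻¹-∙-comm)
    open import Algebra.Properties.CommutativeSemigroup
        (CommutativeMonoid.commutativeSemigroup +-commutativeMonoid) using (interchange)

    ev : A → (X → Carrier) → Carrier
    ev 𝟘 χ = 0#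
    ev (gen i) χ = χ i
    ev (x ⊕ y) χ = ev x χ + ev y χ
    ev (x ⊛ y) χ = ev x (λ i → ev y (λ j → χ (i ∙ j)))
    ev (⊖ x) χ = - ev x χ

    ev-cong : ∀ x {χ ψ} → (∀ i → χ i ≈ ψ i) → ev x χ ≈ ev x ψ
    ev-cong 𝟘 e = refl
    ev-cong (gen i) e = e i
    ev-cong (x ⊕ y) e = +-cong (ev-cong x e) (ev-cong y e)
    ev-cong (x ⊛ y) e = ev-cong x (λ i → ev-cong y (λ j → e (i ∙ j)))
    ev-cong (⊖ x) e = -‿cong (ev-cong x e)

    ev-+ : ∀ x χ ψ → ev x (λ i → χ i + ψ i) ≈ ev x χ + ev x ψ
    ev-+ 𝟘 χ ψ = sym (+-identityˡ 0#)
    ev-+ (gen i) χ ψ = refl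
    ev-+ (x ⊕ y) χ ψ = trans (+-cong (ev-+ x χ ψ) (ev-+ y χ ψ)) (interchange _ _ _ _)
    ev-+ (x ⊛ y) χ ψ = trans (ev-cong x (λ i → ev-+ y _ _)) (ev-+ x _ _)
    ev-+ (⊖ x) χ ψ = trans (-‿cong (ev-+ x χ ψ)) (sym (⁻¹-∙-comm _ _))

  module _ {a b a′ b′} (G : CommutativeRing a b) (H : CommutativeRing a′ b′) where
    private
      module G = CommutativeRing G
      module H = CommutativeRing H
      module EG = Eval G
      module EH = Eval H

    -- Taking for `η` negation, the zero map or right multiplication by a constant gives the
    -- linearity of evaluation in χ; taking the map from ℤ to F serves to show that π is well
    -- defined.
    ev-hom : (η : G.Carrier → H.Carrier) → η G.0# H.≈ H.0# →
      (∀ x y → η (x G.+ y) H.≈ η x H.+ η y) → (∀ x → η (G.- x) H.≈ H.- η x) →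
      ∀ x χ → η (EG.ev x χ) H.≈ EH.ev x (λ i → η (χ i))
    ev-hom η η0 η+ η- 𝟘 χ = η0
    ev-hom η η0 η+ η- (gen i) χ = H.refl
    ev-hom η η0 η+ η- (x ⊕ y) χ = H.trans (η+ _ _) (H.+-cong (ev-hom η η0 η+ η- x χ) (ev-hom η η0 η+ η- y χ))
    ev-hom η η0 η+ η- (x ⊛ y) χ = H.trans (ev-hom η η0 η+ η- x _) (EH.ev-cong x (λ i → ev-hom η η0 η+ η- y _))
    ev-hom η η0 η+ η- (⊖ x) χ = H.trans (η- _) (H.-‿cong (ev-hom η η0 η+ η- x χ))

  module _ {a b} (G : CommutativeRing a b) where
    open CommutativeRing G
    open Eval G
    open import Algebra.Properties.AbelianGroup +-abelianGroup using (⁻¹-∙-comm)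
    open import Algebra.Properties.Group +-group using (ε⁻¹≈ε)
    open import Algebra.Properties.Ring ring using (-‿distribˡ-*)

    ev-neg : ∀ x χ → ev x (λ i → - χ i) ≈ - ev x χ
    ev-neg x χ = sym (ev-hom G G (λ x → - x) ε⁻¹≈ε (λ x y → sym (⁻¹-∙-comm x y)) (λ _ → refl) x χ)

    ev-zero : ∀ x → ev x (λ _ → 0#) ≈ 0#
    ev-zero x = sym (ev-hom G G (λ _ → 0#) refl (λ x y → sym (+-identityˡ 0#)) (λ _ → sym ε⁻¹≈ε) x (λ _ → 0#))

    ev-*ʳ : ∀ x χ c → ev x (λ i → χ i * c) ≈ ev x χ * c
    ev-*ʳ x χ c = sym (ev-hom G G (_* c) (zeroˡ c) (λ x y → distribʳ c x y) (λ x → sym (-‿distribˡ-* x c)) x χ)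

    -- Evaluating a product nests two evaluations; exchanging them is what makes the ring
    -- commutative.
    fubini : ∀ x y (χ : X → X → Carrier) → ev x (λ i → ev y (χ i)) ≈ ev y (λ j → ev x (λ i → χ i j))
    fubini 𝟘 y χ = sym (ev-zero y)
    fubini (gen i) y χ = refl
    fubini (x ⊕ x′) y χ = trans (+-cong (fubini x y χ) (fubini x′ y χ)) (sym (ev-+ y _ _))
    fubini (x ⊛ x′) y χ = trans (ev-cong x (λ i → fubini x′ y _)) (fubini x y _)
    fubini (⊖ x) y χ = trans (-‿cong (fubini x y χ)) (sym (ev-neg y _))

  open Eval ℤₚ.+-*-commutativeRing public

  record _≋_ (x y : A) : Set where
    constructor mk
    field at : ∀ χ → ev x χ ≡ ev y χ
  open _≋_ public

  monoidRing : CommutativeRing 0ℓ 0ℓ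
  monoidRing = record
    { Carrier = A ; _≈_ = _≋_ ; _+_ = _⊕_ ; _*_ = _⊛_ ; -_ = ⊖_ ; 0# = 𝟘 ; 1# = gen ε
    ; isCommutativeRing = record
      { isRing = record
        { +-isAbelianGroup = record
          { isGroup = record
            { isMonoid = record
              { isSemigroup = record
                { isMagma = record
                  { isEquivalence = record
                    { refl = mk λ χ → ≡.refl ; sym = λ e → mk λ χ → ≡.sym (at e χ)
                    ; trans = λ e f → mk λ χ → ≡.trans (at e χ) (at f χ) }
                  ; ∙-cong = λ e f → mk λ χ → ≡.cong₂ ℤ._+_ (at e χ) (at f χ) }
                ; assoc = λ x y z → mk λ χ → ℤₚ.+-assoc (ev x χ) (ev y χ) (ev z χ) }
              ; identity = (λ x → mk λ χ → ℤₚ.+-identityˡ (ev x χ)) , (λ x → mk λ χ → ℤₚ.+-identityʳ (ev x χ)) }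
            ; inverse = (λ x → mk λ χ → ℤₚ.+-inverseˡ (ev x χ)) , (λ x → mk λ χ → ℤₚ.+-inverseʳ (ev x χ))
            ; ⁻¹-cong = λ e → mk λ χ → ≡.cong ℤ.-_ (at e χ) }
          ; comm = λ x y → mk λ χ → ℤₚ.+-comm (ev x χ) (ev y χ) }
        ; *-cong = λ {x} {y} {u} {v} e f → mk λ χ →
            ≡.trans (ev-cong x (λ i → at f (λ j → χ (i ∙ j)))) (at e (λ i → ev v (λ j → χ (i ∙ j))))
        ; *-assoc = λ x y z → mk λ χ → ev-cong x (λ i → ev-cong y (λ j → ev-cong z (λ k → ≡.cong χ (∙-assoc i j k))))
        ; *-identity = idˡ , (λ x → mk λ χ → ≡.trans (at (comm x (gen ε)) χ) (at (idˡ x) χ))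
        ; distrib = disˡ , (λ x y z → mk λ χ → ≡.refl) }
      ; *-comm = comm } }
    where
    idˡ : ∀ x → gen ε ⊛ x ≋ x
    idˡ x = mk λ χ → ev-cong x (λ j → ≡.cong χ (∙-identityˡ j))
    comm : ∀ x y → x ⊛ y ≋ y ⊛ x
    comm x y = mk λ χ → ≡.trans (fubini ℤₚ.+-*-commutativeRing x y _)
      (ev-cong y (λ j → ev-cong x (λ i → ≡.cong χ (∙-comm i j))))
    disˡ : ∀ x y z → x ⊛ (y ⊕ z) ≋ x ⊛ y ⊕ x ⊛ z
    disˡ x y z = mk λ χ → ev-+ x _ _

-- The p-derivation of a Frobenius lift

module Derivation {c ℓ i : Level} (R : CommutativeRing c ℓ) (I : CommutativeRing.Carrier R → Set i)
  (I-*ˡ : ∀ x {y} → I y → I (CommutativeRing._*_ R x y)) {p : ℕ} (p-prime : Prime p) where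
  open CommutativeRing R
  open import Algebra.Properties.Semiring.Mult semiring renaming (_×_ to _·_)
  open import Algebra.Properties.CommutativeMonoid.Mult +-commutativeMonoid using () renaming
      (×-distrib-+ to ·-distrib-+)
  open import Algebra.Properties.CommutativeSemiring.Exp commutativeSemiring
  open import Algebra.Solver.Ring.NaturalCoefficients.Default commutativeSemiring
  open import Relation.Binary.Reasoning.Setoid setoid
  open Freshman R using (freshman)
  open IdealPowers R I I-*ˡ

  module FrobeniusLift (φ : Carrier → Carrier)
    (φ-cong : ∀ {x y} → x ≈ y → φ x ≈ φ y) (φ-0# : φ 0# ≈ 0#) (φ-+ : ∀ x y → φ (x + y) ≈ φ x + φ y)
    (φ-* : ∀ x y → φ (x * y) ≈ φ x * φ y) (φ-neg : ∀ x → φ (- x) ≈ - φ x) where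

    -- d is the value at a of the p-derivation (φ a − aᵖ) / p.
    HasDerivation : ℕ → Carrier → Set (c ⊔ ℓ ⊔ i)
    HasDerivation k a = ∃ λ d → Pow k d × φ a ≈ a ^ p + p · d

    0^p≈0 : 0# ^ p ≈ 0#
    0^p≈0 = trans (^-congʳ 0# (≡.sym (ℕₚ.suc-pred p {{prime⇒nonZero p-prime}}))) (zeroˡ _)

    ·-zeroʳ : ∀ n → n · 0# ≈ 0#
    ·-zeroʳ n = trans (·-as-* n 0#) (zeroʳ _)

    ·-neg : ∀ n x → n · (- x) ≈ - (n · x)
    ·-neg n x = inverseʳ-unique _ _ (trans (sym (·-distrib-+ x (- x) n)) (trans (×-congʳ n (-‿inverseʳ x)) (·-zeroʳ n)))
      where open import Algebra.Properties.Group +-group using (inverseʳ-unique)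

    derivation-resp : ∀ {k a b} → a ≈ b → HasDerivation k a → HasDerivation k b
    derivation-resp e (d , x , eq) = d , x , trans (φ-cong (sym e)) (trans eq (+-congʳ (^-congˡ p e)))

    derivation-0# : ∀ {k} → HasDerivation k 0#
    derivation-0# = 0# , pow-0# , trans φ-0# (sym (trans (+-cong 0^p≈0 (·-zeroʳ p)) (+-identityˡ 0#)))

    -- δ(a + b) = δ a + δ b - Q, where p · Q is the mixed part of (a + b)ᵖ; `cross` keeps Q in the
    -- k-th power.
    derivation-+ : ∀ {k a b} → (∀ i j → Pow k (a ^ suc i * b ^ suc j)) →
                   HasDerivation k a → HasDerivation k b → HasDerivation k (a + b)
    derivation-+ {k} {a} {b} cross (d , x , eq) (e , y , eq′)
      with freshman p-prime (Pow k) pow-0# pow-+ a b (λ i j _ → cross i j)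
    ... | Q , xQ , fr = d + e - Q , pow-+ (pow-+ x y) (pow-neg xQ) , (begin
      φ (a + b)                                       ≈⟨ trans (φ-+ a b) (+-cong eq eq′) ⟩
      (a ^ p + p · d) + (b ^ p + p · e)               ≈⟨ solve 4 (λ a b c d → (a :+ b) :+ (c :+ d) := (a :+ c) :+
          (b :+ d)) refl (a ^ p) (p · d) (b ^ p) (p · e) ⟩
      (a ^ p + b ^ p) + (p · d + p · e)               ≈⟨ +-congˡ (trans (sym (·-distrib-+ d e p)) (×-congʳ p cancel)) ⟩
      (a ^ p + b ^ p) + p · (Q + (d + e - Q))         ≈⟨ +-congˡ (·-distrib-+ Q _ p) ⟩
      (a ^ p + b ^ p) + (p · Q + p · (d + e - Q))     ≈⟨ +-assoc _ _ _ ⟨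
      (a ^ p + b ^ p + p · Q) + p · (d + e - Q)       ≈⟨ +-congʳ fr ⟨
      (a + b) ^ p + p · (d + e - Q)                   ∎)
      where
      cancel : d + e ≈ Q + (d + e - Q)
      cancel = sym (trans (+-comm Q _) (trans (+-assoc _ _ _) (trans (+-congˡ (-‿inverseˡ Q)) (+-identityʳ _))))

    -- The twisted Leibniz rule δ(ab) = δ a · φ b + aᵖ · δ b. Levels are demanded of the two
    -- summands rather than of δ a and δ b, because `pow-derivation` obtains them with the help of φ
    -- b and aᵖ.
    derivation-* : ∀ {k a b} ((d , _) : HasDerivation 0 a) ((e , _) : HasDerivation 0 b) →
                   Pow k (d * φ b) → Pow k (a ^ p * e) → HasDerivation k (a * b)
    derivation-* {k} {a} {b} (d , _ , eq) (e , _ , eq′) x y = d * φ b + a ^ p * e , pow-+ x y , (begin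
      φ (a * b)                                        ≈⟨ trans (φ-* a b) (*-congʳ eq) ⟩
      (a ^ p + p · d) * φ b                            ≈⟨ distribʳ _ _ _ ⟩
      a ^ p * φ b + (p · d) * φ b                      ≈⟨ +-cong (*-congˡ eq′) (×-assoc-* p d _) ⟩
      a ^ p * (b ^ p + p · e) + p · (d * φ b)          ≈⟨ +-congʳ (distribˡ _ _ _) ⟩
      (a ^ p * b ^ p + a ^ p * (p · e)) + p · (d * φ b) ≈⟨ +-congʳ (+-cong (sym (^-distrib-* a b p)) (×-comm-* p _ _)) ⟩
      ((a * b) ^ p + p · (a ^ p * e)) + p · (d * φ b)  ≈⟨ solve 3 (λ x y z → (x :+ y) :+ z := x :+ (z :+ y)) refl
          ((a * b) ^ p) (p · (a ^ p * e)) (p · (d * φ b)) ⟩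
      (a * b) ^ p + (p · (d * φ b) + p · (a ^ p * e))  ≈⟨ +-congˡ (·-distrib-+ _ _ p) ⟨
      (a * b) ^ p + p · (d * φ b + a ^ p * e)          ∎)

    -- For p = 2 the p-th power is not an odd function, so (- x)ᵖ is compared with - xᵖ through the
    -- expansion of (x + (- x))ᵖ ≈ 0, for all p alike.
    derivation-neg : ∀ {x} → HasDerivation 0 x → HasDerivation 0 (- x)
    derivation-neg {x} (d , _ , eq) with freshman p-prime (λ _ → ⊤) tt (λ _ _ → tt) x (- x) (λ _ _ _ → tt)
    ... | Q , _ , fr = Q - d , pow0 , (begin
      φ (- x)                                     ≈⟨ φ-neg x ⟩
      - φ x                                       ≈⟨ -‿cong eq ⟩
      - (x ^ p + p · d)                           ≈⟨ ⁻¹-∙-comm _ _ ⟨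
      - (x ^ p) - p · d                           ≈⟨ +-cong (sym -x^p) (sym (·-neg p d)) ⟩
      ((- x) ^ p + p · Q) + p · (- d)             ≈⟨ +-assoc _ _ _ ⟩
      (- x) ^ p + (p · Q + p · (- d))             ≈⟨ +-congˡ (·-distrib-+ Q (- d) p) ⟨
      (- x) ^ p + p · (Q - d)                     ∎)
      where
      open import Algebra.Properties.Group +-group using (inverseʳ-unique)
      open import Algebra.Properties.AbelianGroup +-abelianGroup using (⁻¹-∙-comm)
      -x^p : (- x) ^ p + p · Q ≈ - (x ^ p)
      -x^p = inverseʳ-unique _ _ (trans (sym (+-assoc _ _ _)) (trans (sym fr) (trans (^-congˡ p (-‿inverseʳ x)) 0^p≈0)))

    module _ (derivation : ∀ a → HasDerivation 0 a) (pow-φ : ∀ {k a} → Pow k a → Pow k (φ a)) where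

      -- Leibniz on a · b with a in `I`: in δ a · φ b the factor φ b keeps the level of b, and in aᵖ
      -- · δ b the level lost from b to δ b is regained from aᵖ.
      pow-derivation : ∀ {k a} → Pow (suc k) a → HasDerivation k a
      pow-derivation {zero} {a} _ = derivation a
      pow-derivation {suc k} (prod {a = a} {b = b} a∈ y) with derivation a | pow-derivation y
      ... | δa@(d , _) | e , y′ , eq = derivation-* δa (e , pow0 , eq) (pow-*ˡ d (pow-φ y)) (pow-* pow-a^p y′)
        where
        pow-a^p : Pow 1 (a ^ p)
        pow-a^p = pow-≤ (ℕₚ.≤-trans (ℕ.>-nonZero⁻¹ p {{prime⇒nonZero p-prime}}) (ℕₚ.≤-reflexive (≡.sym
            (ℕₚ.*-identityʳ p)))) (pow-^ p (pow-1 a∈))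
      pow-derivation {suc k} pow-0# = derivation-0#
      pow-derivation {suc k} (pow-+ {a = a} {b = b} x y) =
        derivation-+ (λ i j → pow-*ʳ (b ^ suc j) (pow-*ʳ (a ^ i) (pow-pred x))) (pow-derivation x) (pow-derivation y)
      pow-derivation {suc k} (pow-resp e x) = derivation-resp e (pow-derivation x)

-- Teichmüller lifts: axioms and consequences

module _ {c ℓ : Level} (F : FiniteField c ℓ) (R : CommutativeRing 0ℓ 0ℓ) where
  private module F = FiniteField F
  open CommutativeRing R
  open import Algebra.Properties.Semiring.Mult semiring using () renaming (_×_ to _·_)
  open import Algebra.Properties.CommutativeSemiring.Exp commutativeSemiring using (_^_)

  -- Modelled on the Witt vectors of F: a reduction π, a multiplicative section τ and a lift φ of
  -- Frobenius, on a ring without p-torsion. The kernel of π may exceed the ideal (p), as it does in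
  -- the monoid ring.
  record TeichmüllerLift (p : ℕ) : Set (c ⊔ ℓ) where
    field
      π         : Carrier → F.Carrier
      π-cong    : ∀ {x y} → x ≈ y → π x F.≈ π y
      π-0#      : π 0# F.≈ F.0#
      π-1#      : π 1# F.≈ F.1#
      π-+       : ∀ x y → π (x + y) F.≈ π x F.+ π y
      π-*       : ∀ x y → π (x * y) F.≈ π x F.* π y
      π-neg     : ∀ x → π (- x) F.≈ F.- π x
      τ         : F.Carrier → Carrier
      τ-cong    : ∀ {x y} → x F.≈ y → τ x ≈ τ y
      τ-*       : ∀ x y → τ (x F.* y) ≈ τ x * τ y
      π-τ       : ∀ x → π (τ x) F.≈ x
      φ         : Carrier → Carrier
      φ-cong    : ∀ {x y} → x ≈ y → φ x ≈ φ y
      φ-0#      : φ 0# ≈ 0#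
      φ-1#      : φ 1# ≈ 1#
      φ-+       : ∀ x y → φ (x + y) ≈ φ x + φ y
      φ-*       : ∀ x y → φ (x * y) ≈ φ x * φ y
      φ-neg     : ∀ x → φ (- x) ≈ - φ x
      φ-lifts   : ∀ x → ∃ λ d → φ x ≈ x ^ p + p · d
      p·-cancel : ∀ {x y} → p · x ≈ p · y → x ≈ y

module LiftProperties {c ℓ : Level} (F : FiniteField c ℓ) {p : ℕ} (p-prime : Prime p)
  (p·1≈0 : Field.IsCharacteristic F p) (R : CommutativeRing 0ℓ 0ℓ) (lift : TeichmüllerLift F R p) where

  module F where
    open FiniteField F public
    open Field F public
    open Characteristic p-prime p·1≈0 public
    open import Algebra.Properties.Semiring.Mult semiring public renaming (_×_ to _·_)
    open import Algebra.Properties.CommutativeSemiring.Exp commutativeSemiring public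
  open F using (q; enum; enum-idx)
  open CommutativeRing R public
  open import Algebra.Properties.Semiring.Mult semiring public renaming (_×_ to _·_)
  open import Algebra.Properties.CommutativeSemiring.Exp commutativeSemiring public
  open TeichmüllerLift lift public
  open import Algebra.Properties.CommutativeMonoid.Mult +-commutativeMonoid using () renaming
      (×-distrib-+ to ·-distrib-+)
  open import Relation.Binary.Reasoning.Setoid setoid

  π-^ : ∀ x k → π (x ^ k) F.≈ π x F.^ k
  π-^ x zero = π-1#
  π-^ x (suc k) = F.trans (π-* _ _) (F.*-congˡ (π-^ x k))

  π-· : ∀ n → π (n · 1#) F.≈ n F.· F.1#
  π-· zero = π-0#
  π-· (suc n) = F.trans (π-+ _ _) (F.+-cong π-1# (π-· n))

  Ker : Carrier → Set ℓ
  Ker x = π x F.≈ F.0#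

  Ker-*ˡ : ∀ x {y} → Ker y → Ker (x * y)
  Ker-*ˡ x y∈ = F.trans (π-* _ _) (F.trans (F.*-congˡ y∈) (F.zeroʳ _))

  open IdealPowers R Ker Ker-*ˡ public
  open Derivation R Ker Ker-*ˡ p-prime using (module FrobeniusLift)
  open FrobeniusLift φ φ-cong φ-0# φ-+ φ-* φ-neg using (pow-derivation)

  p∈Ker : Ker (p · 1#)
  p∈Ker = F.trans (π-· p) p·1≈0

  pow-1⇒Ker : ∀ {k a} → Pow (suc k) a → Ker a
  pow-1⇒Ker (prod a∈ _) = F.trans (π-* _ _) (F.trans (F.*-congʳ a∈) (F.zeroˡ _))
  pow-1⇒Ker pow-0# = π-0#
  pow-1⇒Ker (pow-+ x y) = F.trans (π-+ _ _) (F.trans (F.+-cong (pow-1⇒Ker x) (pow-1⇒Ker y)) (F.+-identityˡ _))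
  pow-1⇒Ker (pow-resp e x) = F.trans (F.sym (π-cong e)) (pow-1⇒Ker x)

  -- The kernel is stable under φ because in φ a ≈ aᵖ + p · d both summands reduce to 0 when a does.
  pow-φ : ∀ {k a} → Pow k a → Pow k (φ a)
  pow-φ pow0 = pow0
  pow-φ (prod {a = a} {b = b} a∈ x) = pow-resp (sym (φ-* a b)) (prod φa∈ (pow-φ x))
    where
    φa∈ : Ker (φ a)
    φa∈ with φ-lifts a
    ... | d , eq = F.trans (π-cong eq) (F.trans (π-+ _ _) (F.trans (F.+-cong
      (F.trans (π-cong (^-congʳ a (≡.sym (ℕₚ.suc-pred p {{F.p-nonZero}})))) (F.trans (π-* _ _) (F.trans (F.*-congʳ a∈)
          (F.zeroˡ _))))
      (F.trans (π-cong (·-as-* p d)) (F.trans (π-* _ _) (F.trans (F.*-congʳ p∈Ker) (F.zeroˡ _)))))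
          (F.+-identityˡ F.0#)))
  pow-φ pow-0# = pow-resp (sym φ-0#) pow-0#
  pow-φ (pow-+ x y) = pow-resp (sym (φ-+ _ _)) (pow-+ (pow-φ x) (pow-φ y))
  pow-φ (pow-resp e x) = pow-resp (φ-cong e) (pow-φ x)

  φ-· : ∀ n → φ (n · 1#) ≈ n · 1#
  φ-· zero = φ-0#
  φ-· (suc n) = trans (φ-+ _ _) (+-cong φ-1# (φ-· n))

  -- Write N = p M. As φ fixes integers, cancelling p in φ N ≈ Nᵖ + p · d gives M ≈ M · N^(p-1) + d
  -- with d in the k-th power. Once M itself is placed in the k-th power, induction applies to M.
  pow-integer : ∀ k N → Pow k (N · 1#) → p ℕ.^ k ∣ N
  pow-integer zero N _ = 1∣ N
  pow-integer (suc k) N x with F.char-∣ N (F.trans (F.sym (π-· N)) (pow-1⇒Ker x)) | pow-derivation (λ a →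
      proj₁ (φ-lifts a) , pow0 , proj₂ (φ-lifts a)) pow-φ x
  ... | divides M N≡Mp | d , y , eq = ≡.subst (p ℕ.* p ℕ.^ k ∣_) (≡.sym (≡.trans N≡Mp (ℕₚ.*-comm M p)))
      (*-monoʳ-∣ p (pow-integer k M (pow-M k ℕₚ.≤-refl)))
    where
    n = N · 1#
    m = M · 1#
    e = n ^ ℕ.pred p
    n≈pm : n ≈ p · m
    n≈pm = trans (×-congˡ {1#} (≡.trans N≡Mp (ℕₚ.*-comm M p))) (sym (×-assocˡ 1# p M))
    e∈ : Pow 1 e
    e∈ = pow-≤ (ℕₚ.≤-trans (ℕₚ.suc[m]≤n⇒m≤pred[n] (ℕ.nonTrivial⇒n>1 p {{prime⇒nonTrivial p-prime}})) (ℕₚ.≤-reflexive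
        (≡.sym (ℕₚ.*-identityʳ _))))
           (pow-^ (ℕ.pred p) (pow-≤ (s≤s z≤n) x))
    m≈ : m ≈ m * e + d
    m≈ = p·-cancel (begin
      p · m                    ≈⟨ n≈pm ⟨
      n                        ≈⟨ φ-· N ⟨
      φ n                      ≈⟨ eq ⟩
      n ^ p + p · d            ≈⟨ +-congʳ (^-congʳ n (≡.sym (ℕₚ.suc-pred p {{F.p-nonZero}}))) ⟩
      n * e + p · d            ≈⟨ +-congʳ (*-congʳ n≈pm) ⟩
      (p · m) * e + p · d      ≈⟨ +-congʳ (×-assoc-* p m e) ⟩
      p · (m * e) + p · d      ≈⟨ ·-distrib-+ _ _ p ⟨
      p · (m * e + d)          ∎)
    -- Bootstrapping in m ≈ m · e + d: since e lies in the kernel, m in the j-th power puts m · e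
    -- into the next one, and d is there as long as j < k.
    pow-M : ∀ j → j ≤ k → Pow j m
    pow-M zero _ = pow0
    pow-M (suc j) j<k = pow-resp (sym m≈) (pow-+
      (≡.subst (λ i → Pow i (m * e)) (ℕₚ.+-comm j 1) (pow-* (pow-M j (ℕₚ.<⇒≤ j<k)) e∈)) (pow-≤ j<k y))

  module _ where
    open F.Reindex +-commutativeMonoid
    open import Algebra.Properties.Semiring.Sum semiring using (*-distribˡ-sum)

    powerSum : ℕ → Carrier
    powerSum u = sum (λ i → τ (enum i) ^ u)

    pow-p^s : ∀ s → Pow s ((p ℕ.^ s) · 1#)
    pow-p^s zero = pow0
    pow-p^s (suc s) = pow-resp (×-assocˡ 1# p (p ℕ.^ s)) (pow-p· p-prime p∈Ker (pow-p^s s))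

    powerSum-0 : ∀ s → q ≡ p ℕ.^ s → Pow s (powerSum 0)
    powerSum-0 s q≡ = pow-resp (trans (×-congˡ {1#} (≡.sym q≡)) (sym (sum-replicate q))) (pow-p^s s)

    -- With g ^ u ≠ 1, reindexing by g gives (τ g ^ u − 1) * powerSum u ≈ 0, and τ g ^ u − 1 is a unit modulo Ker.
    powerSum-∤ : ∀ u → ¬ (q ∸ 1) ∣ u → ∀ k → Pow k (powerSum u)
    powerSum-∤ u r∤u zero = pow0
    powerSum-∤ u r∤u (suc k) with F.nontrivial-power u r∤u
    ... | g , g≉0 , g^u≉1 = pow-resp eS (prod e∈ (powerSum-∤ u r∤u k))
      where
      open import Algebra.Properties.Ring ring using ([y-z]x≈yx-zx)
      S = powerSum u
      c₀ = τ g ^ u - 1#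
      πc : π c₀ F.≈ (g F.^ u) F.- F.1#
      πc = F.trans (π-+ _ _) (F.+-cong (F.trans (π-^ (τ g) u) (F.^-congˡ u (π-τ g))) (F.trans (π-neg 1#)
          (F.-‿cong π-1#)))
      πc≉0 : ¬ π c₀ F.≈ F.0#
      πc≉0 e = g^u≉1 (x-y≈0 _ _ (F.trans (F.sym πc) e))
        where open import Algebra.Properties.Group F.+-group using () renaming (x∙y⁻¹≈ε⇒x≈y to x-y≈0)
      inv = F.inverse (π c₀) πc≉0
      b = τ (proj₁ inv)
      e = 1# - b * c₀
      e∈ : Ker e
      e∈ = F.trans (π-+ _ _) (F.trans (F.+-cong π-1# (F.trans (π-neg _) (F.-‿cong (F.trans (π-* _ _) (F.trans (F.*-congʳ
          (π-τ _)) (F.trans (F.*-comm _ _) (proj₂ inv))))))) (F.-‿inverseʳ F.1#))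
      g⁻¹ = proj₁ (F.inverse g g≉0)
      gg⁻¹ : ∀ x → g F.* (g⁻¹ F.* x) F.≈ x
      gg⁻¹ x = F.trans (F.sym (F.*-assoc _ _ _)) (F.trans (F.*-congʳ (proj₂ (F.inverse g g≉0))) (F.*-identityˡ x))
      g⁻¹g : ∀ x → g⁻¹ F.* (g F.* x) F.≈ x
      g⁻¹g x = F.trans (F.sym (F.*-assoc _ _ _)) (F.trans (F.*-congʳ (F.trans (F.*-comm _ _) (proj₂ (F.inverse g g≉0))))
          (F.*-identityˡ x))
      gS : τ g ^ u * S ≈ S
      gS = begin
        τ g ^ u * S                                  ≈⟨ *-distribˡ-sum (τ g ^ u) (λ i → τ (enum i) ^ u) ⟩
        sum (λ i → τ g ^ u * τ (enum i) ^ u)              ≈⟨ sum-cong-≋ (λ i → trans (sym (^-distrib-* (τ g) (τ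
            (enum i)) u)) (^-congˡ u (sym (τ-* g (enum i))))) ⟩
        sum (λ i → τ (g F.* enum i) ^ u)             ≈⟨ F.Reindex.∑-reindex +-commutativeMonoid (λ x → τ x ^ u) (λ e →
            ^-congˡ u (τ-cong e)) (g F.*_) (g⁻¹ F.*_) F.*-congˡ F.*-congˡ gg⁻¹ g⁻¹g ⟨
        S                                            ∎
      cS : c₀ * S ≈ 0#
      cS = trans ([y-z]x≈yx-zx S (τ g ^ u) 1#) (trans (+-cong gS (-‿cong (*-identityˡ S))) (-‿inverseʳ S))
      eS : e * S ≈ S
      eS = begin
        e * S                        ≈⟨ [y-z]x≈yx-zx S 1# (b * c₀) ⟩
        1# * S - (b * c₀) * S        ≈⟨ +-cong (*-identityˡ S) (-‿cong (trans (*-assoc b c₀ S) (trans (*-congˡ cS)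
            (zeroʳ b)))) ⟩
        S - 0#                       ≈⟨ +-congˡ ε⁻¹≈ε ⟩
        S + 0#                       ≈⟨ +-identityʳ S ⟩
        S                            ∎
        where open import Algebra.Properties.Group +-group using (ε⁻¹≈ε)

-- The image of the integers in a ring

module IntegerImage {c ℓ : Level} (R : CommutativeRing c ℓ) where
  open import Data.Integer using (+_; -[1+_])
  open CommutativeRing R
  open import Algebra.Properties.Semiring.Mult semiring renaming (_×_ to _·_)
  open import Algebra.Properties.AbelianGroup +-abelianGroup using (⁻¹-∙-comm)
  open import Algebra.Properties.Group +-group using (ε⁻¹≈ε; ⁻¹-involutive)
  open import Relation.Binary.Reasoning.Setoid setoid

  η : ℤ → Carrier
  η (+ n) = n · 1#
  η -[1+ n ] = - (suc n · 1#)

  η-neg : ∀ i → η (ℤ.- i) ≈ - η i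
  η-neg (+ zero) = sym ε⁻¹≈ε
  η-neg (+ suc n) = refl
  η-neg -[1+ n ] = sym (⁻¹-involutive _)

  η-⊖ : ∀ m n → η (m ℤ.⊖ n) ≈ m · 1# - n · 1#
  η-⊖ m zero = trans (reflexive (≡.cong η (ℤₚ.⊖-≥ {m} z≤n))) (sym (trans (+-congˡ ε⁻¹≈ε) (+-identityʳ _)))
  η-⊖ zero (suc n) = sym (+-identityˡ _)
  η-⊖ (suc m) (suc n) = begin
    η (suc m ℤ.⊖ suc n)               ≡⟨ ≡.cong η (ℤₚ.[1+m]⊖[1+n]≡m⊖n m n) ⟩
    η (m ℤ.⊖ n)                       ≈⟨ η-⊖ m n ⟩
    m · 1# - n · 1#                   ≈⟨ +-identityˡ _ ⟨
    0# + (m · 1# - n · 1#)            ≈⟨ +-congʳ (-‿inverseʳ 1#) ⟨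
    (1# - 1#) + (m · 1# - n · 1#)     ≈⟨ interchange 1# _ _ _ ⟩
    (1# + m · 1#) + (- 1# - n · 1#)   ≈⟨ +-congˡ (⁻¹-∙-comm 1# _) ⟩
    suc m · 1# - suc n · 1#           ∎
    where open import Algebra.Properties.CommutativeSemigroup
            (CommutativeMonoid.commutativeSemigroup +-commutativeMonoid) using (interchange)

  η-+ : ∀ i j → η (i ℤ.+ j) ≈ η i + η j
  η-+ (+ m) (+ n) = ×-homo-+ 1# m n
  η-+ (+ m) -[1+ n ] = η-⊖ m (suc n)
  η-+ -[1+ m ] (+ n) = trans (η-⊖ n (suc m)) (+-comm _ _)
  η-+ -[1+ m ] -[1+ n ] = begin
    - (suc (suc (m ℕ.+ n)) · 1#)          ≡⟨ ≡.cong (λ k → - (suc k · 1#)) (≡.sym (ℕₚ.+-suc m n)) ⟩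
    - ((suc m ℕ.+ suc n) · 1#)            ≈⟨ -‿cong (×-homo-+ 1# (suc m) (suc n)) ⟩
    - (suc m · 1# + suc n · 1#)           ≈⟨ ⁻¹-∙-comm _ _ ⟨
    - (suc m · 1#) - (suc n · 1#)         ∎

-- The monoid ring of F as a Teichmüller lift

module MonoidRingLift {c ℓ : Level} (F : FiniteField c ℓ) {p : ℕ} (p-prime : Prime p)
  (p·1≈0 : Field.IsCharacteristic F p) where

  private module F where
    open FiniteField F public
    open Field F public using (idx; enum-idx; idx-cong; idx-enum; 1^; module Characteristic)
    open Characteristic p-prime p·1≈0 public using (p-nonZero)
    open import Algebra.Properties.CommutativeSemiring.Exp commutativeSemiring public using (_^_; ^-congˡ; ^-distrib-*)
    open IntegerImage commRing public using (η; η-+; η-neg)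
  open import Data.Integer using (+_)
  open F using (q; idx; enum; idx-cong; enum-idx; idx-enum)

  _∙_ : Fin q → Fin q → Fin q
  i ∙ j = idx (enum i F.* enum j)

  ∙-comm : ∀ i j → i ∙ j ≡ j ∙ i
  ∙-comm i j = idx-cong (F.*-comm _ _)

  ∙-assoc : ∀ i j k → (i ∙ j) ∙ k ≡ i ∙ (j ∙ k)
  ∙-assoc i j k = idx-cong (F.trans (F.*-congʳ (enum-idx _)) (F.trans (F.*-assoc _ _ _) (F.*-congˡ (F.sym
      (enum-idx _)))))

  ∙-identityˡ : ∀ i → idx F.1# ∙ i ≡ i
  ∙-identityˡ i = ≡.trans (idx-cong (F.trans (F.*-congʳ (enum-idx F.1#)) (F.*-identityˡ _))) (idx-enum i)

  open MonoidRing _∙_ (idx F.1#) ∙-comm ∙-assoc ∙-identityˡ public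
  open CommutativeRing monoidRing using (_≈_; _+_; _*_; 0#; 1#; refl; sym; trans; reflexive; *-congˡ; +-congˡ; +-identityʳ; semiring; commutativeSemiring)
  open import Algebra.Properties.Semiring.Mult semiring using () renaming (_×_ to _·_)
  open import Algebra.Properties.CommutativeSemiring.Exp commutativeSemiring using (_^_; ^-congˡ)

  π : A → F.Carrier
  π 𝟘 = F.0#
  π (gen i) = enum i
  π (x ⊕ y) = π x F.+ π y
  π (x ⊛ y) = π x F.* π y
  π (⊖ x) = F.- π x

  private
    module EF = Eval F.commRing
    module ΣF where
      open import Algebra.Properties.CommutativeMonoid.Sum F.+-commutativeMonoid public using
          (sum; sum-remove; sum-cong-≋; sum-replicate-zero)
    δ : ∀ {n} → Fin n → Fin n → ℤ
    δ k i = if does (k Finₚ.≟ i) then + 1 else + 0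

  π≈ev : ∀ x → π x F.≈ EF.ev x enum
  π≈ev 𝟘 = F.refl
  π≈ev (gen i) = F.refl
  π≈ev (x ⊕ y) = F.+-cong (π≈ev x) (π≈ev y)
  π≈ev (x ⊛ y) = F.sym (F.trans (EF.ev-cong x (λ i → F.trans (EF.ev-cong y (λ j → F.trans (enum-idx _) (F.*-comm _ _)))
      (F.trans (ev-*ʳ F.commRing y enum (enum i)) (F.*-comm _ _))))
    (F.trans (ev-*ʳ F.commRing x enum (EF.ev y enum)) (F.*-cong (F.sym (π≈ev x)) (F.sym (π≈ev y)))))
  π≈ev (⊖ x) = F.-‿cong (π≈ev x)

  ev-sum : ∀ x {n} (f : Fin n → Fin q → F.Carrier) → EF.ev x (λ i → ΣF.sum (λ k → f k i)) F.≈ ΣF.sum (λ k →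
      EF.ev x (f k))
  ev-sum x {zero} f = ev-zero F.commRing x
  ev-sum x {suc n} f = F.trans (EF.ev-+ x _ _) (F.+-congˡ (ev-sum x (λ k → f (Fin.suc k))))

  basis-expansion : ∀ {n} (χ : Fin n → F.Carrier) i → χ i F.≈ ΣF.sum (λ k → F.η (δ k i) F.* χ k)
  basis-expansion {suc n} χ i = F.sym (F.trans (ΣF.sum-remove {n} {i} (λ k → F.η (δ k i) F.* χ k)) (F.trans
      (F.+-cong diag off) (F.+-identityʳ _)))
    where
    diag : F.η (δ i i) F.* χ i F.≈ χ i
    diag rewrite dec-true (i Finₚ.≟ i) ≡.refl = F.trans (F.*-congʳ (F.+-identityʳ F.1#)) (F.*-identityˡ _)
    zero-term : ∀ j → F.η (δ (punchIn i j) i) F.* χ (punchIn i j) F.≈ F.0#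
    zero-term j rewrite dec-false (punchIn i j Finₚ.≟ i) (Finₚ.punchInᵢ≢i i j) = F.zeroˡ _
    off : ΣF.sum (λ j → F.η (δ (punchIn i j) i) F.* χ (punchIn i j)) F.≈ F.0#
    off = F.trans (ΣF.sum-cong-≋ zero-term) (ΣF.sum-replicate-zero n)

  ev-via-ℤ : ∀ x χ → EF.ev x χ F.≈ ΣF.sum (λ k → F.η (ev x (δ k)) F.* χ k)
  ev-via-ℤ x χ = F.trans (EF.ev-cong x (basis-expansion χ)) (F.trans (ev-sum x (λ k i → F.η (δ k i) F.* χ k))
    (ΣF.sum-cong-≋ (λ k → F.trans (ev-*ʳ F.commRing x _ (χ k)) (F.*-congʳ (F.sym
        (ev-hom ℤₚ.+-*-commutativeRing F.commRing F.η F.refl F.η-+ F.η-neg x (δ k)))))))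

  -- Equality in the monoid ring tests integer-valued functions only, while π extends the F-valued
  -- `enum`. Expanding `enum` in the indicator functions `δ` shows that π x is determined by the
  -- integers ev x (δ k).
  π-cong : ∀ {x y} → x ≈ y → π x F.≈ π y
  π-cong {x} {y} e = F.trans (lemma x) (F.trans (ΣF.sum-cong-≋ (λ k → F.*-congʳ (F.reflexive (≡.cong F.η (at e
      (δ k)))))) (F.sym (lemma y)))
    where lemma : ∀ x → π x F.≈ ΣF.sum (λ k → F.η (ev x (δ k)) F.* enum k)
          lemma x = F.trans (π≈ev x) (ev-via-ℤ x enum)

  τ : F.Carrier → A
  τ x = gen (idx x)

  τ-cong : ∀ {x y} → x F.≈ y → τ x ≈ τ y
  τ-cong e = reflexive (≡.cong gen (idx-cong e))

  τ-* : ∀ x y → τ (x F.* y) ≈ τ x * τ y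
  τ-* x y = mk λ χ → ≡.cong χ (idx-cong (F.*-cong (F.sym (enum-idx x)) (F.sym (enum-idx y))))

  τ-^ : ∀ x k → τ (x F.^ k) ≈ τ x ^ k
  τ-^ x zero = refl
  τ-^ x (suc k) = trans (τ-* x _) (*-congˡ (τ-^ x k))

  gen≈τ : ∀ i → gen i ≈ τ (enum i)
  gen≈τ i = reflexive (≡.cong gen (≡.sym (idx-enum i)))

  φ : A → A
  φ 𝟘 = 𝟘
  φ (gen i) = τ (enum i F.^ p)
  φ (x ⊕ y) = φ x ⊕ φ y
  φ (x ⊛ y) = φ x ⊛ φ y
  φ (⊖ x) = ⊖ φ x

  -- φ pushes forward along the p-th power map of F, which on functions is a pullback of χ; hence φ
  -- respects equality.
  ev-φ : ∀ x χ → ev (φ x) χ ≡ ev x (λ i → χ (idx (enum i F.^ p)))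
  ev-φ 𝟘 χ = ≡.refl
  ev-φ (gen i) χ = ≡.refl
  ev-φ (x ⊕ y) χ = ≡.cong₂ ℤ._+_ (ev-φ x χ) (ev-φ y χ)
  ev-φ (x ⊛ y) χ = ≡.trans (ev-φ x _) (ev-cong x (λ i → ≡.trans (ev-φ y _) (ev-cong y (λ j → ≡.cong χ (idx-cong
    (F.trans (F.*-cong (enum-idx _) (enum-idx _)) (F.trans (F.sym (F.^-distrib-* _ _ p)) (F.^-congˡ p (F.sym
        (enum-idx _))))))))))
  ev-φ (⊖ x) χ = ≡.cong ℤ.-_ (ev-φ x χ)

  φ-cong : ∀ {x y} → x ≈ y → φ x ≈ φ y
  φ-cong {x} {y} e = mk λ χ → ≡.trans (ev-φ x χ) (≡.trans (at e _) (≡.sym (ev-φ y χ)))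

  φ-1# : φ 1# ≈ 1#
  φ-1# = τ-cong (F.trans (F.^-congˡ p (enum-idx F.1#)) (F.1^ p))

  -- With the whole ring as ideal, membership carries no information, so `HasDerivation 0` says just
  -- that φ a - aᵖ is divisible by p.
  open Derivation monoidRing (λ _ → ⊤) (λ _ _ → tt) p-prime using (module FrobeniusLift)
  open FrobeniusLift φ φ-cong refl (λ _ _ → refl) (λ _ _ → refl) (λ _ → refl)
  open IdealPowers monoidRing (λ _ → ⊤) (λ _ _ → tt) using (pow0)

  φ-lifts : ∀ a → HasDerivation 0 a
  φ-lifts 𝟘 = derivation-0#
  φ-lifts (gen i) = 0# , pow0 , trans (τ-^ (enum i) p) (trans (^-congˡ p (sym (gen≈τ i))) (sym (trans (+-congˡ
      (·-zeroʳ p)) (+-identityʳ _))))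
  φ-lifts (x ⊕ y) = derivation-+ (λ _ _ → pow0) (φ-lifts x) (φ-lifts y)
  φ-lifts (x ⊛ y) = derivation-* (φ-lifts x) (φ-lifts y) pow0 pow0
  φ-lifts (⊖ x) = derivation-neg (φ-lifts x)

  ev-· : ∀ n x χ → ev (n · x) χ ≡ + n ℤ.* ev x χ
  ev-· zero x χ = ≡.refl
  ev-· (suc n) x χ = ≡.trans (≡.cong (ℤ._+_ (ev x χ)) (ev-· n x χ)) (≡.sym (ℤₚ.suc-* (+ n) (ev x χ)))

  p·-cancel : ∀ {x y} → p · x ≈ p · y → x ≈ y
  p·-cancel {x} {y} e = mk λ χ → ℤₚ.*-cancelˡ-≡ (+ p) (ev x χ) (ev y χ) {{F.p-nonZero}} (≡.trans (≡.sym (ev-· p x χ))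
      (≡.trans (at e χ) (ev-· p y χ)))

  lift : TeichmüllerLift F monoidRing p
  lift = record
    { π = π ; π-cong = π-cong ; π-0# = F.refl ; π-1# = enum-idx F.1# ; π-+ = λ _ _ → F.refl ; π-* = λ _ _ →
        F.refl ; π-neg = λ _ → F.refl
    ; τ = τ ; τ-cong = τ-cong ; τ-* = τ-* ; π-τ = enum-idx
    ; φ = φ ; φ-cong = φ-cong ; φ-0# = refl ; φ-1# = φ-1# ; φ-+ = λ _ _ → refl ; φ-* = λ _ _ → refl ; φ-neg = λ _ → refl
    ; φ-lifts = λ a → proj₁ (φ-lifts a) , proj₂ (proj₂ (φ-lifts a)) ; p·-cancel = p·-cancel }

-- Digit sums modulo q - 1

module DigitSums where
  open import Data.Nat
  open import Data.Nat.Properties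
  open import Data.Nat.DivMod using (m≡m%n+[m/n]*n; m<n⇒m%n≡m; [m+n]%n≡m%n; m<n*o⇒m/o<n)
  open import Data.Nat.Divisibility using (_∣_; ∣m+n∣m⇒∣n; ∣m∣n⇒∣m+n; n∣m*n)
  open import Relation.Binary.PropositionalEquality

  sumTo : ℕ → (ℕ → ℕ) → ℕ
  sumTo zero f = 0
  sumTo (suc n) f = f 0 + sumTo n (λ l → f (suc l))

  sumTo-cong : ∀ n {f g} → (∀ l → l < n → f l ≡ g l) → sumTo n f ≡ sumTo n g
  sumTo-cong zero e = refl
  sumTo-cong (suc n) e = cong₂ _+_ (e 0 (s≤s z≤n)) (sumTo-cong n (λ l l<n → e (suc l) (s≤s l<n)))

  sumTo-+ : ∀ n f g → sumTo n (λ l → f l + g l) ≡ sumTo n f + sumTo n g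
  sumTo-+ zero f g = refl
  sumTo-+ (suc n) f g = trans (cong (f 0 + g 0 +_) (sumTo-+ n _ _))
    (solve 4 (λ a b c d → (a :+ b) :+ (c :+ d) := (a :+ c) :+ (b :+ d)) refl (f 0) (g 0) (sumTo n (λ l →
        f (suc l))) (sumTo n (λ l → g (suc l))))
    where open NatSolver.+-*-Solver

  sumTo-*ʳ : ∀ n f c → sumTo n (λ l → f l * c) ≡ sumTo n f * c
  sumTo-*ʳ zero f c = refl
  sumTo-*ʳ (suc n) f c = trans (cong (f 0 * c +_) (sumTo-*ʳ n _ c)) (sym (*-distribʳ-+ c (f 0) _))

  sumTo-const : ∀ n c → sumTo n (λ _ → c) ≡ n * c
  sumTo-const zero c = refl
  sumTo-const (suc n) c = cong (c +_) (sumTo-const n c)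

  sumTo-mono : ∀ n {f g} → (∀ l → f l ≤ g l) → sumTo n f ≤ sumTo n g
  sumTo-mono zero le = z≤n
  sumTo-mono (suc n) le = +-mono-≤ (le 0) (sumTo-mono n (λ l → le (suc l)))

  sumTo-last : ∀ n f → sumTo (suc n) f ≡ sumTo n f + f n
  sumTo-last zero f = +-identityʳ (f 0)
  sumTo-last (suc n) f = trans (cong (f 0 +_) (sumTo-last n (λ l → f (suc l)))) (sym (+-assoc (f 0) _ _))

  sumTo-periodic : ∀ n f → f n ≡ f 0 → sumTo n (λ l → f (suc l)) ≡ sumTo n f
  sumTo-periodic n f e = +-cancelˡ-≡ (f 0) _ _ (begin
    sumTo (suc n) f     ≡⟨ sumTo-last n f ⟩
    sumTo n f + f n     ≡⟨ cong (sumTo n f +_) e ⟩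
    sumTo n f + f 0     ≡⟨ +-comm _ (f 0) ⟩
    f 0 + sumTo n f     ∎)
    where open ≡-Reasoning

  geometric : ∀ p .{{_ : NonZero p}} n → suc (pred p * sumTo n (p ^_)) ≡ p ^ n
  geometric p zero = cong suc (*-zeroʳ (pred p))
  geometric p@(suc c) (suc n) = begin
    suc (c * sumTo (suc n) (p ^_))           ≡⟨ cong (λ z → suc (c * z)) (sumTo-last n (p ^_)) ⟩
    suc (c * (sumTo n (p ^_) + p ^ n))       ≡⟨ cong suc (*-distribˡ-+ c _ _) ⟩
    suc (c * sumTo n (p ^_)) + c * p ^ n     ≡⟨ cong (_+ c * p ^ n) (geometric p n) ⟩
    p ^ n + c * p ^ n                        ∎
    where open ≡-Reasoning

  module Congruence (r : ℕ) where
    infix 4 _≡ₘ_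

    -- Multiples of r are added on both sides, which expresses congruence in ℕ without subtraction.
    _≡ₘ_ : ℕ → ℕ → Set
    x ≡ₘ y = ∃₂ λ a b → x + a * r ≡ y + b * r

    ≡ₘ-reflexive : ∀ {x y} → x ≡ y → x ≡ₘ y
    ≡ₘ-reflexive e = 0 , 0 , cong (_+ 0) e

    ≡ₘ-+ : ∀ {x y x′ y′} → x ≡ₘ y → x′ ≡ₘ y′ → x + x′ ≡ₘ y + y′
    ≡ₘ-+ {x} {y} {x′} {y′} (a , b , e) (a′ , b′ , e′) = a + a′ , b + b′ , trans (lemma x x′ a a′) (trans
        (cong₂ _+_ e e′) (sym (lemma y y′ b b′)))
      where
      open NatSolver.+-*-Solver
      lemma : ∀ x y a b → x + y + (a + b) * r ≡ (x + a * r) + (y + b * r)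
      lemma x y a b = solve 5 (λ x y a b r → x :+ y :+ (a :+ b) :* r := (x :+ a :* r) :+ (y :+ b :* r)) refl x y a b r

    ≡ₘ-*ˡ : ∀ c {x y} → x ≡ₘ y → c * x ≡ₘ c * y
    ≡ₘ-*ˡ c {x} {y} (a , b , e) = c * a , c * b , trans (lemma x a) (trans (cong (c *_) e) (sym (lemma y b)))
      where
      open NatSolver.+-*-Solver
      lemma : ∀ x a → c * x + c * a * r ≡ c * (x + a * r)
      lemma x a = solve 4 (λ c x a r → c :* x :+ c :* a :* r := c :* (x :+ a :* r)) refl c x a r

    ≡ₘ-∣ : ∀ {x y} → x ≡ₘ y → r ∣ y → r ∣ x
    ≡ₘ-∣ {x} {y} (a , b , e) r∣y = ∣m+n∣m⇒∣n (subst (r ∣_) (trans (sym e) (+-comm x (a * r))) (∣m∣n⇒∣m+n r∣y (n∣m*n b)))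
        (n∣m*n a)

  module DigitWeights (p s r : ℕ) .{{_ : NonZero p}} .{{_ : NonZero s}} (p^s≡1+r : p ^ s ≡ suc r) where
    open Congruence r

    weight : ℕ → ℕ
    weight l = p ^ (l % s)

    weight>0 : ∀ l → 0 < weight l
    weight>0 l = m^n>0 p (l % s)

    -- p ^ s = q is 1 modulo q - 1, so only l modulo s matters.
    weight-≡ₘ : ∀ l → weight l ≡ₘ p ^ l
    weight-≡ₘ l = subst (weight l ≡ₘ_) (sym eq) (go (l / s))
      where
      eq : p ^ l ≡ weight l * (p ^ s) ^ (l / s)
      eq = begin
        p ^ l                               ≡⟨ cong (p ^_) (m≡m%n+[m/n]*n l s) ⟩
        p ^ (l % s + l / s * s)             ≡⟨ ^-distribˡ-+-* p (l % s) (l / s * s) ⟩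
        weight l * p ^ (l / s * s)          ≡⟨ cong (λ z → weight l * p ^ z) (*-comm (l / s) s) ⟩
        weight l * p ^ (s * (l / s))        ≡⟨ cong (weight l *_) (^-*-assoc p s (l / s)) ⟨
        weight l * (p ^ s) ^ (l / s)        ∎
        where open ≡-Reasoning
      go : ∀ k → weight l ≡ₘ weight l * (p ^ s) ^ k
      go zero = ≡ₘ-reflexive (sym (*-identityʳ _))
      go (suc k) with go k
      ... | a , b , e = a + z , b , (begin
        weight l + (a + z) * r              ≡⟨ solve 4 (λ w a z r → w :+ (a :+ z) :* r := (w :+ a :* r) :+ z :* r) refl
            (weight l) a z r ⟩
        (weight l + a * r) + z * r          ≡⟨ cong (_+ z * r) e ⟩
        (z + b * r) + z * r                 ≡⟨ solve 3 (λ z b r → (z :+ b :* r) :+ z :* r := z :*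
            (con 1 :+ r) :+ b :* r) refl z b r ⟩
        z * suc r + b * r                   ≡⟨ cong (λ t → z * t + b * r) p^s≡1+r ⟨
        z * p ^ s + b * r                   ≡⟨ cong (_+ b * r) (trans (*-assoc (weight l) ((p ^ s) ^ k) (p ^ s)) (cong
            (weight l *_) (*-comm ((p ^ s) ^ k) (p ^ s)))) ⟩
        weight l * (p ^ s) ^ suc k + b * r  ∎)
        where
        open ≡-Reasoning
        open NatSolver.+-*-Solver
        z = weight l * (p ^ s) ^ k

    -- Any s consecutive weights are 1, p, ..., p ^ (s - 1) in cyclic order, with sum (q - 1) / (p -
    -- 1). The free starting point `a` makes the identity stable under the index shift caused by
    -- p-th powers.
    weight-sum : ∀ a → pred p * sumTo s (λ l → weight (a + l)) ≡ r
    weight-sum zero = suc-injective (begin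
      suc (pred p * sumTo s weight)   ≡⟨ cong (λ z → suc (pred p * z)) (sumTo-cong s (λ l l<s →
          cong (p ^_) (m<n⇒m%n≡m l<s))) ⟩
      suc (pred p * sumTo s (p ^_))   ≡⟨ geometric p s ⟩
      p ^ s                           ≡⟨ p^s≡1+r ⟩
      suc r                           ∎)
      where open ≡-Reasoning
    weight-sum (suc a) = trans (cong (pred p *_) (trans (sumTo-cong s (λ l _ → cong weight (sym (+-suc a l))))
      (sumTo-periodic s (λ l → weight (a + l)) (cong (p ^_) (trans ([m+n]%n≡m%n a s) (cong (_% s) (sym
          (+-identityʳ a)))))))) (weight-sum a)

  ceilDiv-≤ : ∀ a b k → 0 < b → a ≤ b * k → ceilDiv a b ≤ k
  ceilDiv-≤ a (suc b) k _ a≤bk = ≤-pred (m<n*o⇒m/o<n (begin-strict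
    a + b             ≤⟨ +-monoˡ-≤ b a≤bk ⟩
    suc b * k + b     <⟨ +-monoʳ-< (suc b * k) (n<1+n b) ⟩
    suc b * k + suc b ≡⟨ trans (+-comm (suc b * k) (suc b)) (cong (suc b +_) (*-comm (suc b) k)) ⟩
    suc k * suc b     ∎))
    where open ≤-Reasoning

open DigitSums

-- Lower bounds from the definition of ω

module OmegaBounds where
  open import Data.Nat using (_+_; _*_)
  open import Data.Nat.Properties hiding (_≟_)
  open import Data.Nat.DivMod using (m%n≤m)
  open import Data.Nat.Divisibility using (∣m+n∣m⇒∣n; n∣m*n)
  open import Data.Fin.Properties using (_≟_; punchInᵢ≢i; toℕ-fromℕ<)
  open import Relation.Binary.PropositionalEquality
  open import Algebra.Properties.Semiring.Sum +-*-semiring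
    using (sum; sum-cong-≗; ∑-distrib-+; sum-remove; sum-replicate-zero; *-distribʳ-sum)

  sum-allFin : ∀ {n} (f : Fin n → ℕ) → ListAction.sum (List.map f (allFin n)) ≡ sum f
  sum-allFin f = trans (cong ListAction.sum (map-tabulate (λ i → i) f)) (go f)
    where
    go : ∀ {n} (f : Fin n → ℕ) → ListAction.sum (tabulate f) ≡ sum f
    go {zero} f = refl
    go {suc n} f = cong (f Fin.zero +_) (go (λ i → f (Fin.suc i)))

  sum-mono : ∀ {n} {f g : Fin n → ℕ} → (∀ i → f i ≤ g i) → sum f ≤ sum g
  sum-mono {zero} le = z≤n
  sum-mono {suc n} le = +-mono-≤ (le Fin.zero) (sum-mono (λ i → le (Fin.suc i)))

  sum-pos : ∀ {n} {f g : Fin n → ℕ} → (∀ i → 0 < f i → 0 < g i) → 0 < sum f → 0 < sum g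
  sum-pos {suc n} {f} {g} pos 0<f with f Fin.zero in e
  ... | suc _ = <-≤-trans (pos Fin.zero (subst (0 <_) (sym e) (s≤s z≤n))) (m≤m+n _ _)
  ... | zero = <-≤-trans (sum-pos (λ i → pos (Fin.suc i)) 0<f) (m≤n+m _ _)

  single : ∀ {n} → Fin n → ℕ → Fin n → ℕ
  single k x i = if does (i ≟ k) then x else 0

  sum-single : ∀ {n} (m : Fin n → ℕ) k x → sum (λ i → m i * single k x i) ≡ m k * x
  sum-single {suc n} m k x = trans (sum-remove {n} {k} (λ i → m i * single k x i)) (trans (cong₂ _+_ diag off)
      (+-identityʳ _))
    where
    diag : m k * single k x k ≡ m k * x
    diag rewrite dec-true (k ≟ k) refl = refl
    zero-term : ∀ j → m (punchIn k j) * single k x (punchIn k j) ≡ 0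
    zero-term j rewrite dec-false (punchIn k j ≟ k) (punchInᵢ≢i k j) = *-zeroʳ (m (punchIn k j))
    off : sum (λ j → m (punchIn k j) * single k x (punchIn k j)) ≡ 0
    off = trans (sum-cong-≗ zero-term) (sum-replicate-zero n)

  module Representation {c ℓ : Level} (F : FiniteField c ℓ) where
    open FiniteField F using (q)
    open Field F using (r-nonZero; 1<q)

    r : ℕ
    r = q ∸ 1

    open Congruence r

    exponent : (f : UPoly F) → Fin (length (UPoly.terms f)) → ℕ
    exponent f k = proj₂ (List.lookup (UPoly.terms f) k)

    -- `γ` is unbounded so that representations can be added; `omega-≤` cuts it down to at most q -
    -- 1 at the end. Positivity is carried separately because a congruence cannot tell 0 from a
    -- positive multiple of r, and ω admits only the latter.
    record Rep (f : UPoly F) (g u : ℕ) : Set where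
      constructor rep
      field
        γ     : Fin (length (UPoly.terms f)) → ℕ
        total : sum γ ≡ g
        value : sum (λ k → exponent f k * γ k) ≡ₘ u
        pos   : 0 < u → 0 < sum (λ k → exponent f k * γ k)
    open Rep

    rep-0 : ∀ f → Rep f 0 0
    rep-0 f = rep (λ _ → 0) (sum-replicate-zero len) (≡ₘ-reflexive (trans (sum-cong-≗ (λ k → *-zeroʳ (exponent f k)))
        (sum-replicate-zero len))) λ ()
      where len = length (UPoly.terms f)

    rep-+ : ∀ f {g g′ u u′} → Rep f g u → Rep f g′ u′ → Rep f (g + g′) (u + u′)
    rep-+ f {u = u} ρ ρ′ = rep (λ k → γ ρ k + γ ρ′ k) (trans (∑-distrib-+ (γ ρ) (γ ρ′)) (cong₂ _+_ (total ρ)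
        (total ρ′)))
      (subst (_≡ₘ _) (sym split) (≡ₘ-+ (value ρ) (value ρ′)))
      (λ 0<u → subst (0 <_) (sym split) (positive u (pos ρ) (pos ρ′) 0<u))
      where
      split : sum (λ k → exponent f k * (γ ρ k + γ ρ′ k)) ≡ sum (λ k → exponent f k * γ ρ k) + sum (λ k →
          exponent f k * γ ρ′ k)
      split = trans (sum-cong-≗ (λ k → *-distribˡ-+ (exponent f k) _ _)) (∑-distrib-+ (λ k → exponent f k * γ ρ k) _)
      positive : ∀ u {u′ a b} → (0 < u → 0 < a) → (0 < u′ → 0 < b) → 0 < u + u′ → 0 < a + b
      positive zero {b = b} _ h 0<u′ = <-≤-trans (h 0<u′) (m≤n+m b _)
      positive (suc u) {a = a} h _ _ = <-≤-trans (h (s≤s z≤n)) (m≤m+n a _)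

    -- With g = `weight l` and u = p ^ l this is the cost of one term of f after its exponent is
    -- multiplied by p ^ l and folded.
    rep-single : ∀ f k g u → g ≡ₘ u → 0 < g → Rep f g (exponent f k * u)
    rep-single f k g u g≡u 0<g = rep (single k g) (trans (sum-cong-≗ (λ i → sym (*-identityˡ (single k g i)))) (trans
        (sum-single (λ _ → 1) k g) (*-identityˡ g)))
      (subst (_≡ₘ _) (sym eq) (≡ₘ-*ˡ (exponent f k) g≡u))
      (λ 0<mu → subst (0 <_) (sym eq) (*-mono-≤ (0<m*n⇒0<m (exponent f k) 0<mu) 0<g))
      where
      eq = sum-single (exponent f) k g
      0<m*n⇒0<m : ∀ m {n} → 0 < m * n → 0 < m
      0<m*n⇒0<m (suc m) _ = s≤s z≤n

    -- The representative in {0, …, r} of x modulo r that is zero only when x is.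
    reduce : ℕ → ℕ
    reduce zero = zero
    reduce (suc x) = suc (x % r)

    reduce<q : ∀ x → reduce x < q
    reduce<q zero = <-trans (s≤s z≤n) 1<q
    reduce<q (suc x) = <-≤-trans (s≤s (m%n<n x r)) (≤-reflexive (m+[n∸m]≡n (<⇒≤ 1<q)))

    reduce-≤ : ∀ x → reduce x ≤ x
    reduce-≤ zero = z≤n
    reduce-≤ (suc x) = s≤s (m%n≤m x r)

    reduce-pos : ∀ m x → 0 < m * x → 0 < m * reduce x
    reduce-pos m zero h = h
    reduce-pos (suc m) (suc x) _ = s≤s z≤n

    reduce-eq : ∀ x → ∃ λ k → x ≡ reduce x + k * r
    reduce-eq zero = 0 , refl
    reduce-eq (suc x) = x / r , cong suc (m≡m%n+[m/n]*n x r)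

    -- Applying `reduce` to each γ changes the weighted sum by a multiple of r, keeps it positive
    -- and does not increase the total, so the reduced tuple competes in the minimum.
    omega-≤ : ∀ f {ω} → IsOmega F f ω → ∀ {g u} → Rep f g u → r ∣ u → 0 < u → ω ≤ g
    omega-≤ f (_ , minimal) {g} {u} ρ r∣u 0<u = begin
      _                                   ≤⟨ minimal γ′ (admissible (quotient r∣) (_∣_.equality r∣)) ⟩
      γsum F f γ′                         ≡⟨ sum-allFin (λ k → toℕ (γ′ k)) ⟩
      sum (λ k → toℕ (γ′ k))              ≤⟨ sum-mono (λ k → ≤-trans (≤-reflexive (toℕ-γ′ k)) (reduce-≤ (γ ρ k))) ⟩
      sum (γ ρ)                           ≡⟨ total ρ ⟩
      g                                   ∎
      where
      open ≤-Reasoning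
      m = exponent f
      γ′ : Gamma F f
      γ′ k = fromℕ< (reduce<q (γ ρ k))
      toℕ-γ′ : ∀ k → toℕ (γ′ k) ≡ reduce (γ ρ k)
      toℕ-γ′ k = toℕ-fromℕ< (reduce<q (γ ρ k))
      S = sum (λ k → m k * reduce (γ ρ k))
      ws : weightedSum F f γ′ ≡ S
      ws = trans (sum-allFin (λ k → m k * toℕ (γ′ k))) (sum-cong-≗ (λ k → cong (m k *_) (toℕ-γ′ k)))
      K = sum (λ k → m k * proj₁ (reduce-eq (γ ρ k)))
      S-eq : sum (λ k → m k * γ ρ k) ≡ K * r + S
      S-eq = trans (sum-cong-≗ (λ k → trans (cong (m k *_) (proj₂ (reduce-eq (γ ρ k))))
                (solve 4 (λ m a k r → m :* (a :+ k :* r) := (m :* k) :* r :+ m :* a) refl (m k) (reduce (γ ρ k)) (proj₁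
                    (reduce-eq (γ ρ k))) r)))
              (trans (∑-distrib-+ (λ k → (m k * proj₁ (reduce-eq (γ ρ k))) * r) _) (cong (_+ S) (sym (*-distribʳ-sum r
                  (λ k → m k * proj₁ (reduce-eq (γ ρ k)))))))
        where open NatSolver.+-*-Solver
      r∣ : r ∣ S
      r∣ = ∣m+n∣m⇒∣n (subst (r ∣_) S-eq (≡ₘ-∣ (value ρ) r∣u)) (n∣m*n K)
      0<S : 0 < S
      0<S = sum-pos {f = λ k → m k * γ ρ k} (λ k → reduce-pos (m k) (γ ρ k)) (pos ρ 0<u)
      admissible : ∀ t → S ≡ t * r → Admissible F f γ′
      admissible zero e = contradiction (subst (0 <_) e 0<S) λ ()
      admissible (suc t) e = t , sym (trans ws e)

    -- The value r placed on one nonconstant term is enough. This bound settles the variables whose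
    -- power sum contributes a factor q.
    omega-≤-r : ∀ f {ω} → NonConstant F f → IsOmega F f ω → ω ≤ r
    omega-≤-r f nc om = omega-≤ f om (rep-single f k r r (≡ₘ-reflexive refl) r>0) (n∣m*n (exponent f k)) (*-mono-≤
        (lookup-index nc) r>0)
      where
      k = Any.index nc
      r>0 : 0 < r
      r>0 = m<n⇒0<n∸m 1<q

open OmegaBounds

open import Algebra.Properties.CommutativeMonoid.Sum ℕₚ.+-0-commutativeMonoid using () renaming (sum to ℕsum)

∈⇒≤max : ∀ {x xs} → x ∈ˡ xs → x ≤ List.foldr ℕ._⊔_ 0 xs
∈⇒≤max (Any.here ≡.refl) = ℕₚ.m≤m⊔n _ _
∈⇒≤max (Any.there x∈) = ℕₚ.≤-trans (∈⇒≤max x∈) (ℕₚ.m≤n⊔m _ _)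

-- Additive spans

module AdditiveSpan {c ℓ : Level} (R : CommutativeRing c ℓ) where
  open CommutativeRing R
  open import Algebra.Properties.CommutativeSemiring.Exp commutativeSemiring using (_^_)

  -- Expansions into monomials are kept only as membership in a span: the properties shared by all
  -- monomials are tracked, and multinomial coefficients never appear.
  data Span {t} (P : Carrier → Set t) : Carrier → Set (c ⊔ ℓ ⊔ t) where
    span-incl : ∀ {x} → P x → Span P x
    span-0# : Span P 0#
    span-+ : ∀ {x y} → Span P x → Span P y → Span P (x + y)
    span-resp : ∀ {x y} → x ≈ y → Span P x → Span P y

  span-bind : ∀ {t t′} {P : Carrier → Set t} {Q : Carrier → Set t′} → (∀ {x} → P x → Span Q x) → ∀ {x} → Span P x →
      Span Q x
  span-bind f (span-incl x) = f x
  span-bind f span-0# = span-0#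
  span-bind f (span-+ x y) = span-+ (span-bind f x) (span-bind f y)
  span-bind f (span-resp e x) = span-resp e (span-bind f x)

  span-* : ∀ {t t′ t″} {P : Carrier → Set t} {Q : Carrier → Set t′} {T : Carrier → Set t″} →
    (∀ {x y} → P x → Q y → T (x * y)) → ∀ {x y} → Span P x → Span Q y → Span T (x * y)
  span-* f {y = y} span-0# y∈ = span-resp (sym (zeroˡ y)) span-0#
  span-* f {y = y} (span-+ a b) y∈ = span-resp (sym (distribʳ y _ _)) (span-+ (span-* f a y∈) (span-* f b y∈))
  span-* f (span-resp e a) y∈ = span-resp (*-congʳ e) (span-* f a y∈)
  span-* f {x} (span-incl px) span-0# = span-resp (sym (zeroʳ x)) span-0#
  span-* f {x} (span-incl px) (span-+ a b) = span-resp (sym (distribˡ x _ _)) (span-+ (span-* f (span-incl px) a)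
      (span-* f (span-incl px) b))
  span-* f {x} (span-incl px) (span-resp e a) = span-resp (*-congˡ e) (span-* f (span-incl px) a)
  span-* f (span-incl px) (span-incl qy) = span-incl (f px qy)

-- Lifted polynomials and sums of monomials over all points

module ZeroCounting {c ℓ : Level} (F : FiniteField c ℓ) {p : ℕ} (p-prime : Prime p)
  (p·1≈0 : Field.IsCharacteristic F p) (s : ℕ) (q≡p^s : FiniteField.q F ≡ p ℕ.^ s)
  (R : CommutativeRing 0ℓ 0ℓ) (lift : TeichmüllerLift F R p) where

  private module F where
    open FiniteField F public
    open Field F public using (^F≈^; r-nonZero; 1<q; fermat; module Characteristic)
    open Characteristic p-prime p·1≈0 public using (k<p^k)
    open import Algebra.Properties.CommutativeSemiring.Exp commutativeSemiring public using (_^_; ^-congˡ)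
  open F using (q; enum)
  open CommutativeRing R hiding (zero)
  open import Algebra.Properties.Semiring.Mult semiring renaming (_×_ to _·_)
  open import Algebra.Properties.CommutativeMonoid.Mult +-commutativeMonoid using () renaming
      (×-distrib-+ to ·-distrib-+)
  open import Algebra.Properties.CommutativeSemiring.Exp commutativeSemiring
  open import Algebra.Properties.Semiring.Sum semiring using (sum; sum-cong-≋; *-distribˡ-sum)
  open import Algebra.Properties.Ring ring using (-1*x≈-x)
  open import Algebra.Solver.Ring.NaturalCoefficients.Default commutativeSemiring
  open import Relation.Binary.Reasoning.Setoid setoid
  open TeichmüllerLift lift
  open LiftProperties F p-prime p·1≈0 R lift using
      (Ker; Ker-*ˡ; p∈Ker; powerSum; powerSum-0; powerSum-∤; pow-integer; π-^; pow-p^s)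
  open IdealPowers R Ker Ker-*ˡ
  open Representation F using (r; exponent; Rep; rep-0; rep-+; rep-single; omega-≤; omega-≤-r)

  instance
    p-nonZero : NonZero p
    p-nonZero = prime⇒nonZero p-prime
    s-nonZero : NonZero s
    s-nonZero = ℕ.≢-nonZero λ s≡0 → ℕₚ.<-irrefl (≡.sym (≡.trans q≡p^s (≡.cong (p ℕ.^_) s≡0))) F.1<q

  p^s≡1+r : p ℕ.^ s ≡ suc r
  p^s≡1+r = ≡.trans (≡.sym q≡p^s) (≡.sym (ℕₚ.m+[n∸m]≡n (ℕₚ.<⇒≤ F.1<q)))

  -- p ^ k - 1, built from k base-p digits equal to p - 1. For k = s it is q - 1, in the form
  -- followed by the recursion of `span-term-^[p^k-1]`.
  repunit : ℕ → ℕ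
  repunit zero = 0
  repunit (suc k) = ℕ.pred p ℕ.+ p ℕ.* repunit k

  suc-repunit : ∀ k → suc (repunit k) ≡ p ℕ.^ k
  suc-repunit zero = ≡.refl
  suc-repunit (suc k) = ≡.trans (≡.cong (ℕ._+ p ℕ.* repunit k) (ℕₚ.suc-pred p)) (≡.trans (≡.sym (ℕₚ.*-suc p
      (repunit k))) (≡.cong (p ℕ.*_) (suc-repunit k)))

  open Congruence r
  open DigitWeights p s r p^s≡1+r

  Fn : Set → CommutativeRing 0ℓ 0ℓ
  Fn X = Pointwise.commutativeRing X R

  module Fn {X : Set} where
    open AdditiveSpan (Fn X) public
    open CommutativeRing (Fn X) public using () renaming (_*_ to _*ᶠ_; _+_ to _+ᶠ_; 1# to 1ᶠ)
    open import Algebra.Properties.CommutativeSemiring.Exp (CommutativeRing.commutativeSemiring (Fn X)) public using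
        () renaming (_^_ to _^ᶠ_)
    open import Algebra.Properties.Semiring.Mult (CommutativeRing.semiring (Fn X)) public using () renaming
        (_×_ to _·ᶠ_)

    ^ᶠ-at : ∀ Φ k x → (Φ ^ᶠ k) x ≈ Φ x ^ k
    ^ᶠ-at Φ zero x = refl
    ^ᶠ-at Φ (suc k) x = *-congˡ (^ᶠ-at Φ k x)

    ·ᶠ-at : ∀ k Φ x → (k ·ᶠ Φ) x ≈ k · Φ x
    ·ᶠ-at zero Φ x = refl
    ·ᶠ-at (suc k) Φ x = +-congˡ (·ᶠ-at k Φ x)

    ^ᶠ-^ᶠ : ∀ Φ j k x → ((Φ ^ᶠ j) ^ᶠ k) x ≈ Φ x ^ (j ℕ.* k)
    ^ᶠ-^ᶠ Φ j k x = trans (^ᶠ-at (Φ ^ᶠ j) k x) (trans (^-congˡ k (^ᶠ-at Φ j x)) (^-assocʳ (Φ x) j k))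

    span-∑ : ∀ {t} {P : (X → Carrier) → Set t} {n} (Φ : Fin n → X → Carrier) → (∀ k → Span P (Φ k)) → Span P (λ x →
        sum (λ k → Φ k x))
    span-∑ {n = zero} Φ e = span-0#
    span-∑ {n = suc n} Φ e = span-+ (e Fin.zero) (span-∑ (λ k → Φ (Fin.suc k)) (λ k → e (Fin.suc k)))
  open Fn

  span-pullback : ∀ {t t′} {X Y : Set} {P : (X → Carrier) → Set t} {Q : (Y → Carrier) → Set t′} (ρ : Y → X) →
    (∀ {Φ} → P Φ → Q (Φ ∘ ρ)) → ∀ {Φ} → Span P Φ → Span Q (Φ ∘ ρ)
  span-pullback ρ f (span-incl x) = span-incl (f x)
  span-pullback ρ f span-0# = span-0#
  span-pullback ρ f (span-+ x y) = span-+ (span-pullback ρ f x) (span-pullback ρ f y)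
  span-pullback ρ f (span-resp e x) = span-resp (λ y → e (ρ y)) (span-pullback ρ f x)

  ·-*-· : ∀ m n a b → (m · a) * (n · b) ≈ (m ℕ.* n) · (a * b)
  ·-*-· m n a b = trans (×-assoc-* m a _) (trans (×-congʳ m (×-comm-* n a b)) (×-assocˡ _ m n))

  ·-^ : ∀ n a k → (n · a) ^ k ≈ (n ℕ.^ k) · a ^ k
  ·-^ n a zero = sym (×-homo-1 1#)
  ·-^ n a (suc k) = trans (*-congˡ (·-^ n a k)) (·-*-· n (n ℕ.^ k) a (a ^ k))

  -- One-variable factors.  The weight g l of τ ^ u bounds ω from above after multiplying u by p ^ l;
  -- variables outside I carry no weight.
  Factor : Bool → UPoly F → (ℕ → ℕ) → (Fin q → Carrier) → Set
  Factor false f g h = ∀ l → g l ≡ 0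
  Factor true f g h = ∃₂ λ c u → (∀ x → h x ≈ c * τ (enum x) ^ u) × (∀ l → Rep f (g l) (p ℕ.^ l ℕ.* u))

  factor-const : ∀ b f c → Factor b f (λ _ → 0) (λ _ → c)
  factor-const false f c l = ≡.refl
  factor-const true f c = c , 0 , (λ x → sym (*-identityʳ c)) , λ l → ≡.subst (Rep f 0) (≡.sym (ℕₚ.*-zeroʳ (p ℕ.^ l)))
      (rep-0 f)

  factor-* : ∀ b f {g g′ h h′} → Factor b f g h → Factor b f g′ h′ → Factor b f (λ l → g l ℕ.+ g′ l) (λ x → h x * h′ x)
  factor-* false f fac fac′ l = ≡.cong₂ ℕ._+_ (fac l) (fac′ l)
  factor-* true f (c , u , e , ρ) (c′ , u′ , e′ , ρ′) = c * c′ , u ℕ.+ u′ ,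
    (λ x → trans (*-cong (e x) (e′ x)) (trans (solve 4 (λ a b c d → (a :* b) :* (c :* d) := (a :* c) :* (b :* d)) refl c
        (τ (enum x) ^ u) c′ (τ (enum x) ^ u′)) (*-congˡ (sym (^-homo-* (τ (enum x)) u u′))))) ,
    λ l → ≡.subst (Rep f _) (≡.sym (ℕₚ.*-distribˡ-+ (p ℕ.^ l) u u′)) (rep-+ f (ρ l) (ρ′ l))

  -- Since p ^ l · (u · p) = p ^ (l + 1) · u, a p-th power only shifts the index of the weights.
  factor-^p : ∀ b f {g h} → Factor b f g h → Factor b f (λ l → g (suc l)) (λ x → h x ^ p)
  factor-^p false f fac l = fac (suc l)
  factor-^p true f (c , u , e , ρ) = c ^ p , u ℕ.* p ,
    (λ x → trans (^-congˡ p (e x)) (trans (^-distrib-* c _ p) (*-congˡ (^-assocʳ (τ (enum x)) u p)))) ,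
    λ l → ≡.subst (Rep f _) (NatSolver.+-*-Solver.solve 3 (λ p t u → (p N.:* t) N.:* u N.:= t N.:* (u N.:* p)) ≡.refl p
        (p ℕ.^ l) u) (ρ (suc l))
    where module N = NatSolver.+-*-Solver

  -- Functions with separated variables, whose sum over all points is a product of one-variable
  -- sums. Outside `I` the factor is an arbitrary function; constants are absorbed at the empty
  -- vector.
  Mon : ∀ {n} → Subset n → (Fin n → UPoly F) → (ℕ → ℕ) → (Vec (Fin q) n → Carrier) → Set
  Mon [] f g Φ = ∀ l → g l ≡ 0
  Mon (b ∷ I) f g Φ = ∃₂ λ g₁ g₂ → ∃₂ λ h Ψ → Factor b (f Fin.zero) g₁ h × Mon I (f ∘ Fin.suc) g₂ Ψ
    × (∀ a xs → Φ (a ∷ xs) ≈ h a * Ψ xs) × (∀ l → g l ≡ g₁ l ℕ.+ g₂ l)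

  mon-resp : ∀ {n} (I : Subset n) f {g g′ Φ Φ′} → (∀ l → g l ≡ g′ l) → (∀ x → Φ x ≈ Φ′ x) → Mon I f g Φ → Mon I f g′ Φ′
  mon-resp [] f eg eΦ m l = ≡.trans (≡.sym (eg l)) (m l)
  mon-resp (b ∷ I) f eg eΦ (g₁ , g₂ , h , Ψ , fac , m , e , e′) = g₁ , g₂ , h , Ψ , fac , m , (λ a xs →
      trans (sym (eΦ _)) (e a xs)) , λ l → ≡.trans (≡.sym (eg l)) (e′ l)

  mon-const : ∀ {n} (I : Subset n) f c → Mon I f (λ _ → 0) (λ _ → c)
  mon-const [] f c l = ≡.refl
  mon-const (b ∷ I) f c = _ , _ , _ , _ , factor-const b (f Fin.zero) 1# , mon-const I (f ∘ Fin.suc) c , (λ a xs →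
      sym (*-identityˡ c)) , λ l → ≡.refl

  mon-* : ∀ {n} (I : Subset n) f {g g′ Φ Φ′} → Mon I f g Φ → Mon I f g′ Φ′ → Mon I f (λ l → g l ℕ.+ g′ l) (λ x →
      Φ x * Φ′ x)
  mon-* [] f m m′ l = ≡.cong₂ ℕ._+_ (m l) (m′ l)
  mon-* (b ∷ I) f (g₁ , g₂ , h , Ψ , fac , m , e , e′) (g₁′ , g₂′ , h′ , Ψ′ , fac′ , m′ , d , d′) =
    _ , _ , _ , _ , factor-* b (f Fin.zero) fac fac′ , mon-* I (f ∘ Fin.suc) m m′ ,
    (λ a xs → trans (*-cong (e a xs) (d a xs)) (solve 4 (λ a b c d → (a :* b) :* (c :* d) := (a :* c) :* (b :* d)) refl
        (h a) (Ψ xs) (h′ a) (Ψ′ xs))) ,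
    λ l → ≡.trans (≡.cong₂ ℕ._+_ (e′ l) (d′ l)) (N.solve 4 (λ a b c d → (a N.:+ b) N.:+ (c N.:+ d) N.:= (a N.:+ c) N.:+
        (b N.:+ d)) ≡.refl (g₁ l) (g₂ l) (g₁′ l) (g₂′ l))
    where module N = NatSolver.+-*-Solver

  mon-^p : ∀ {n} (I : Subset n) f {g Φ} → Mon I f g Φ → Mon I f (λ l → g (suc l)) (λ x → Φ x ^ p)
  mon-^p [] f m l = m (suc l)
  mon-^p (b ∷ I) f (g₁ , g₂ , h , Ψ , fac , m , e , e′) = _ , _ , _ , _ , factor-^p b (f Fin.zero) fac , mon-^p I
      (f ∘ Fin.suc) m ,
    (λ a xs → trans (^-congˡ p (e a xs)) (^-distrib-* (h a) (Ψ xs) p)) , λ l → e′ (suc l)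

  liftU : UPoly F → Fin q → Carrier
  liftU f x = sum (λ k → τ (proj₁ (List.lookup (UPoly.terms f) k)) * τ (enum x) ^ exponent f k)

  liftMono : ∀ {n} → (Fin n → UPoly F) → Vec ℕ n → Vec (Fin q) n → Carrier
  liftMono f [] [] = 1#
  liftMono f (m ∷ ms) (x ∷ xs) = liftU (f Fin.zero) x ^ m * liftMono (f ∘ Fin.suc) ms xs

  liftM : ∀ {n} → (Fin n → UPoly F) → MPoly F n → Vec (Fin q) n → Carrier
  liftM f P x = sum (λ k → τ (proj₁ (List.lookup (MPoly.terms P) k)) * liftMono f (proj₂ (List.lookup
      (MPoly.terms P) k)) x)

  π-liftU : ∀ f x → π (liftU f x) F.≈ evalU F f (enum x)
  π-liftU f x = go (UPoly.terms f)
    where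
    go : ∀ ts → π (sum (λ k → τ (proj₁ (List.lookup ts k)) * τ (enum x) ^ proj₂ (List.lookup ts k)))
         F.≈ List.foldr (λ t acc → (proj₁ t F.* (enum x F.^F proj₂ t)) F.+ acc) F.0# ts
    go [] = π-0#
    go (t ∷ ts) = F.trans (π-+ _ _) (F.+-cong (F.trans (π-* _ _) (F.*-cong (π-τ _)
      (F.trans (π-^ _ (proj₂ t)) (F.trans (F.^-congˡ (proj₂ t) (π-τ _)) (F.sym (F.^F≈^ _ (proj₂ t))))))) (go ts))

  π-liftMono : ∀ {n} (f : Fin n → UPoly F) ms xs → π (liftMono f ms xs) F.≈ monoVal F (point F f xs) ms
  π-liftMono f [] [] = π-1#
  π-liftMono f (m ∷ ms) (x ∷ xs) = F.trans (π-* _ _) (F.*-cong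
    (F.trans (π-^ _ m) (F.trans (F.^-congˡ m (π-liftU (f Fin.zero) x)) (F.sym (F.^F≈^ _ m)))) (π-liftMono
        (f ∘ Fin.suc) ms xs))

  π-liftM : ∀ {n} (f : Fin n → UPoly F) P xs → π (liftM f P xs) F.≈ evalM F P (point F f xs)
  π-liftM f P xs = go (MPoly.terms P)
    where
    go : ∀ ts → π (sum (λ k → τ (proj₁ (List.lookup ts k)) * liftMono f (proj₂ (List.lookup ts k)) xs))
         F.≈ List.foldr (λ t acc → (proj₁ t F.* monoVal F (point F f xs) (proj₂ t)) F.+ acc) F.0# ts
    go [] = π-0#
    go (t ∷ ts) = F.trans (π-+ _ _) (F.+-cong (F.trans (π-* _ _) (F.*-cong (π-τ _) (π-liftMono f (proj₂ t) xs)))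
        (go ts))

  span-factor-^ : ∀ b f {g h} → Span (Factor b f g) h → ∀ m → Span (Factor b f (λ l → m ℕ.* g l)) (λ x → h x ^ m)
  span-factor-^ b f h∈ zero = span-incl (factor-const b f 1#)
  span-factor-^ b f h∈ (suc m) = span-* (factor-* b f) h∈ (span-factor-^ b f h∈ m)

  -- For a term of exponent m, placing γ = `weight l` on it represents p ^ l · m modulo r, so every
  -- term has the same weight.
  span-liftU : ∀ f → Span (Factor true f weight) (liftU f)
  span-liftU f = span-∑ _ λ k → span-incl (_ , _ , (λ x → refl) , λ l →
    ≡.subst (Rep f (weight l)) (ℕₚ.*-comm (exponent f k) (p ℕ.^ l)) (rep-single f k (weight l) (p ℕ.^ l) (weight-≡ₘ l)
        (weight>0 l)))

  span-mon-∷ : ∀ {n} b (I : Subset n) f {g₁ g₂ h Ψ} → Span (Factor b (f Fin.zero) g₁) h → Span (Mon I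
      (f ∘ Fin.suc) g₂) Ψ →
    Span (Mon (b ∷ I) f (λ l → g₁ l ℕ.+ g₂ l)) (λ x → h (head x) * Ψ (tail x))
  span-mon-∷ {n} b I f {g₁} {g₂} h∈ Ψ∈ = span-* {P = P} {Q = Q} factor-mon
    (span-pullback head (λ {h} fac → h , fac , λ x → refl) h∈) (span-pullback tail (λ {Ψ} m → Ψ , m , λ x → refl) Ψ∈)
    where
    P Q : (Vec (Fin q) (suc n) → Carrier) → Set
    P Φ = ∃ λ h → Factor b (f Fin.zero) g₁ h × (∀ x → Φ x ≈ h (head x))
    Q Φ = ∃ λ Ψ → Mon I (f ∘ Fin.suc) g₂ Ψ × (∀ x → Φ x ≈ Ψ (tail x))
    factor-mon : ∀ {Φ Φ′} → P Φ → Q Φ′ → Mon (b ∷ I) f (λ l → g₁ l ℕ.+ g₂ l) (λ x → Φ x * Φ′ x)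
    factor-mon (h , fac , e) (Ψ , m , e′) = g₁ , g₂ , h , Ψ , fac , m , (λ a xs → *-cong (e (a ∷ xs)) (e′ (a ∷ xs))) ,
        λ l → ≡.refl

  span-liftMono : ∀ {n} (I : Subset n) f ms → Span (Mon I f (λ l → sumI I (lookup ms) ℕ.* weight l)) (liftMono f ms)
  span-liftMono [] f [] = span-incl (λ l → ≡.refl)
  span-liftMono (true ∷ I) f (m ∷ ms) = span-resp (λ { (x ∷ xs) → refl }) (span-bind
    (λ {Φ} mon → span-incl (mon-resp (true ∷ I) f {Φ = Φ} (λ l → ≡.sym (ℕₚ.*-distribʳ-+ (weight l) m _)) (λ _ →
        refl) mon))
    (span-mon-∷ true I f (span-factor-^ true (f Fin.zero) (span-liftU (f Fin.zero)) m) (span-liftMono I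
        (f ∘ Fin.suc) ms)))
  -- Outside `I` the power of the lifted polynomial stays unexpanded and adds no weight, so only the
  -- I-degree is counted.
  span-liftMono (false ∷ I) f (m ∷ ms) = span-resp (λ { (x ∷ xs) → refl })
    (span-mon-∷ false I f {g₁ = λ _ → 0} (span-incl (λ l → ≡.refl)) (span-liftMono I (f ∘ Fin.suc) ms))

  sumL : List Carrier → Carrier
  sumL = List.foldr _+_ 0#

  sumL-++ : ∀ xs ys → sumL (xs ++ ys) ≈ sumL xs + sumL ys
  sumL-++ [] ys = sym (+-identityˡ _)
  sumL-++ (x ∷ xs) ys = trans (+-congˡ (sumL-++ xs ys)) (sym (+-assoc _ _ _))

  sumL-allFin : ∀ {n} (h : Fin n → Carrier) → sumL (List.map h (allFin n)) ≈ sum h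
  sumL-allFin h = trans (reflexive (≡.cong sumL (map-tabulate (λ i → i) h))) (go h)
    where
    go : ∀ {n} (h : Fin n → Carrier) → sumL (tabulate h) ≈ sum h
    go {zero} h = refl
    go {suc n} h = +-congˡ (go (λ i → h (Fin.suc i)))

  sumTuples : ∀ {n} → (Vec (Fin q) n → Carrier) → Carrier
  sumTuples {n} Φ = sumL (List.map Φ (allTuples F n))

  sumL-map-cong : ∀ {X : Set} {Φ Ψ : X → Carrier} → (∀ x → Φ x ≈ Ψ x) → ∀ xs → sumL (List.map Φ xs) ≈ sumL
      (List.map Ψ xs)
  sumL-map-cong e [] = refl
  sumL-map-cong e (x ∷ xs) = +-cong (e x) (sumL-map-cong e xs)

  sumL-map-+ : ∀ {X : Set} (Φ Ψ : X → Carrier) xs → sumL (List.map (λ x → Φ x + Ψ x) xs) ≈ sumL (List.map Φ xs) + sumL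
      (List.map Ψ xs)
  sumL-map-+ Φ Ψ [] = sym (+-identityˡ 0#)
  sumL-map-+ Φ Ψ (x ∷ xs) = trans (+-congˡ (sumL-map-+ Φ Ψ xs))
    (solve 4 (λ a b c d → (a :+ b) :+ (c :+ d) := (a :+ c) :+ (b :+ d)) refl (Φ x) (Ψ x) (sumL (List.map Φ xs)) (sumL
        (List.map Ψ xs)))

  sumL-map-*ˡ : ∀ {X : Set} c (Φ : X → Carrier) xs → sumL (List.map (λ x → c * Φ x) xs) ≈ c * sumL (List.map Φ xs)
  sumL-map-*ˡ c Φ [] = sym (zeroʳ c)
  sumL-map-*ˡ c Φ (x ∷ xs) = trans (+-congˡ (sumL-map-*ˡ c Φ xs)) (sym (distribˡ c _ _))

  pow-count : ∀ {X : Set} {t} {Z : X → Set t} (Z? : ∀ x → Dec (Z x)) {M} (Φ : X → Carrier) →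
    (∀ x → Z x → ∃ λ e → Pow M e × Φ x ≈ 1# + e) → (∀ x → ¬ Z x → Pow M (Φ x)) →
    ∀ xs → ∃ λ e → Pow M e × sumL (List.map Φ xs) + e ≈ length (filter Z? xs) · 1#
  pow-count Z? Φ on off [] = 0# , pow-0# , +-identityˡ 0#
  pow-count Z? Φ on off (x ∷ xs) with Z? x | pow-count Z? Φ on off xs
  ... | no nz | e , x∈ , eq = e - Φ x , pow-+ x∈ (pow-neg (off x nz)) , (begin
    (Φ x + S) + (e - Φ x)         ≈⟨ solve 4 (λ a s e b → (a :+ s) :+ (e :+ b) := (s :+ e) :+ (a :+ b)) refl (Φ x) S e
        (- Φ x) ⟩
    (S + e) + (Φ x - Φ x)         ≈⟨ +-cong eq (-‿inverseʳ (Φ x)) ⟩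
    N · 1# + 0#                   ≈⟨ +-identityʳ _ ⟩
    N · 1#                        ∎)
    where S = sumL (List.map Φ xs)
          N = length (filter Z? xs)
  ... | yes z | e , x∈ , eq with on x z
  ...   | e′ , x′∈ , eq′ = e - e′ , pow-+ x∈ (pow-neg x′∈) , (begin
    (Φ x + S) + (e - e′)          ≈⟨ +-congʳ (+-congʳ eq′) ⟩
    ((1# + e′) + S) + (e - e′)    ≈⟨ solve 5 (λ o a s e b → ((o :+ a) :+ s) :+ (e :+ b) := (o :+ (s :+ e)) :+
        (a :+ b)) refl 1# e′ S e (- e′) ⟩
    (1# + (S + e)) + (e′ - e′)    ≈⟨ +-cong (+-congˡ eq) (-‿inverseʳ e′) ⟩
    (1# + N · 1#) + 0#            ≈⟨ +-identityʳ _ ⟩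
    1# + N · 1#                   ∎)
    where S = sumL (List.map Φ xs)
          N = length (filter Z? xs)

  sumTuples-∷ : ∀ {n} (h : Fin q → Carrier) (Ψ : Vec (Fin q) n → Carrier) Φ → (∀ a xs → Φ (a ∷ xs) ≈ h a * Ψ xs) →
    sumTuples Φ ≈ sum h * sumTuples Ψ
  sumTuples-∷ {n} h Ψ Φ e = trans (go (allFin q)) (*-congʳ (sumL-allFin h))
    where
    T = allTuples F n
    go : ∀ as → sumL (List.map Φ (concatMap (λ a → List.map (a ∷_) T) as)) ≈ sumL (List.map h as) * sumL (List.map Ψ T)
    go [] = sym (zeroˡ _)
    go (a ∷ as) = begin
      sumL (List.map Φ (List.map (a ∷_) T ++ rest))                ≡⟨ ≡.cong sumL (map-++ Φ (List.map (a ∷_) T) rest) ⟩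
      sumL (List.map Φ (List.map (a ∷_) T) ++ List.map Φ rest)     ≈⟨ sumL-++ (List.map Φ (List.map (a ∷_) T)) _ ⟩
      sumL (List.map Φ (List.map (a ∷_) T)) + sumL (List.map Φ rest) ≈⟨ +-cong (trans (reflexive (≡.cong sumL (≡.sym
          (map-∘ T)))) (trans (sumL-map-cong (e a) T) (sumL-map-*ˡ (h a) Ψ T))) (go as) ⟩
      h a * sumL (List.map Ψ T) + sumL (List.map h as) * sumL (List.map Ψ T) ≈⟨ distribʳ _ _ _ ⟨
      (h a + sumL (List.map h as)) * sumL (List.map Ψ T)           ∎
      where rest = concatMap (λ a → List.map (a ∷_) T) as

  -- z counts the factors q gained from the sum. If r does not divide u, or u = 0, then z = 1 and z
  -- · r already covers ω. If r divides u > 0, then z = 0 and the weights bound ω, as r also divides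
  -- each p ^ l · u.
  factor-sum : ∀ f {ω} → NonConstant F f → IsOmega F f ω → ∀ {g h} → Factor true f g h →
    ∃ λ z → Pow (s ℕ.* z) (sum h) × (∀ l → ω ≤ z ℕ.* r ℕ.+ g l)
  factor-sum f {ω} nc om {g} {h} (c , u , e , ρ) = result
    where
    sum-h : c * powerSum u ≈ sum h
    sum-h = trans (*-distribˡ-sum c (λ x → τ (enum x) ^ u)) (sum-cong-≋ (λ x → sym (e x)))
    z=1 : Pow s (powerSum u) → ∃ λ z → Pow (s ℕ.* z) (sum h) × (∀ l → ω ≤ z ℕ.* r ℕ.+ g l)
    z=1 x = 1 , pow-resp sum-h (pow-*ˡ c (≡.subst (λ k → Pow k (powerSum u)) (≡.sym (ℕₚ.*-identityʳ s)) x)) ,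
      λ l → ℕₚ.≤-trans (omega-≤-r f nc om) (ℕₚ.≤-trans (ℕₚ.≤-reflexive (≡.sym (ℕₚ.*-identityˡ r))) (ℕₚ.m≤m+n (1 ℕ.* r)
          (g l)))
    result : ∃ λ z → Pow (s ℕ.* z) (sum h) × (∀ l → ω ≤ z ℕ.* r ℕ.+ g l)
    result with r ∣? u | u ℕ.≟ 0
    ... | no r∤u | _ = z=1 (powerSum-∤ u r∤u s)
    ... | yes _ | yes ≡.refl = z=1 (powerSum-0 s q≡p^s)
    ... | yes r∣u | no u≢0 = 0 , ≡.subst (λ k → Pow k (sum h)) (≡.sym (ℕₚ.*-zeroʳ s)) pow0 ,
      λ l → omega-≤ f om (ρ l) (∣n⇒∣m*n (p ℕ.^ l) r∣u) (ℕₚ.*-mono-≤ (ℕₚ.m^n>0 p l) (ℕₚ.n≢0⇒n>0 u≢0))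

  mon-sum : ∀ {n} (I : Subset n) f (ω : Fin n → ℕ) → (∀ i → i ∈ I → NonConstant F (f i)) → (∀ i → i ∈ I →
      IsOmega F (f i) (ω i)) →
    ∀ {g Φ} → Mon I f g Φ → ∃ λ z → Pow (s ℕ.* z) (sumTuples Φ) × (∀ l → sumI I ω ≤ z ℕ.* r ℕ.+ g l)
  mon-sum [] f ω nc om {Φ = Φ} m = 0 , ≡.subst (λ k → Pow k (sumTuples Φ)) (≡.sym (ℕₚ.*-zeroʳ s)) pow0 , λ l → z≤n
  mon-sum (false ∷ I) f ω nc om {Φ = Φ} (g₁ , g₂ , h , Ψ , fac , m , e , e′)
    with mon-sum I (f ∘ Fin.suc) (ω ∘ Fin.suc) (λ i i∈ → nc (Fin.suc i) (there i∈)) (λ i i∈ →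
        om (Fin.suc i) (there i∈)) m
  ... | z , x , le = z , pow-resp (sym (sumTuples-∷ h Ψ Φ e)) (pow-*ˡ (sum h) x) ,
    λ l → ℕₚ.≤-trans (le l) (ℕₚ.+-monoʳ-≤ (z ℕ.* r) (ℕₚ.≤-trans (ℕₚ.m≤n+m (g₂ l) (g₁ l)) (ℕₚ.≤-reflexive (≡.sym
        (e′ l)))))
  mon-sum (true ∷ I) f ω nc om {g} {Φ} (g₁ , g₂ , h , Ψ , fac , m , e , e′)
    with factor-sum (f Fin.zero) (nc Fin.zero here) (om Fin.zero here) fac
       | mon-sum I (f ∘ Fin.suc) (ω ∘ Fin.suc) (λ i i∈ → nc (Fin.suc i) (there i∈)) (λ i i∈ →
           om (Fin.suc i) (there i∈)) m
  ... | z , x , le | z′ , x′ , le′ = z ℕ.+ z′ ,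
    pow-resp (sym (sumTuples-∷ h Ψ Φ e)) (≡.subst (λ k → Pow k (sum h * sumTuples Ψ)) (≡.sym (ℕₚ.*-distribˡ-+ s z z′))
        (pow-* x x′)) ,
    λ l → ℕₚ.≤-trans (ℕₚ.+-mono-≤ (le l) (le′ l)) (ℕₚ.≤-reflexive (≡.trans
      (N.solve 5 (λ z a z′ b r → (z N.:* r N.:+ a) N.:+ (z′ N.:* r N.:+ b) N.:= (z N.:+ z′) N.:* r N.:+
          (a N.:+ b)) ≡.refl z (g₁ l) z′ (g₂ l) r)
      (≡.cong ((z ℕ.+ z′) ℕ.* r ℕ.+_) (≡.sym (e′ l)))))
    where module N = NatSolver.+-*-Solver

  -- Digit bookkeeping in powers of a polynomial, indicators and the count

  module _ {n} (I : Subset n) (f : Fin n → UPoly F) where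

    private Fun = Vec (Fin q) n → Carrier

    -- A monomial p ^ v · Ψ occurring in the expansion of a power of a polynomial of I-degree at most d.
    -- W l is the degree of the monomial after the exponents are multiplied by p ^ l and their base-p
    -- digits are folded modulo s; w and D are the digit sum and the value of the exponent of the power.
    record Term (d w D : ℕ) (Φ : Fun) : Set where
      field
        v     : ℕ
        g W   : ℕ → ℕ
        Ψ     : Fun
        eq    : ∀ x → Φ x ≈ (p ℕ.^ v) · Ψ x
        mon   : Mon I f g Ψ
        g≤    : ∀ l → g l ≤ d ℕ.* W l
        W-≡ₘ  : ∀ l → W l ≡ₘ p ℕ.^ l ℕ.* D
        W-pos : 0 < D → ∀ l → 0 < W l
        W-sum : ∀ a → ℕ.pred p ℕ.* sumTo s (λ l → W (a ℕ.+ l)) ≡ (w ℕ.+ ℕ.pred p ℕ.* v) ℕ.* r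

    term-1 : ∀ {d} → Term d 0 0 (λ _ → 1#)
    term-1 {d} = record
      { v = 0 ; g = λ _ → 0 ; W = λ _ → 0 ; Ψ = λ _ → 1# ; eq = λ x → sym (×-homo-1 1#) ; mon = mon-const I f 1#
      ; g≤ = λ l → z≤n ; W-≡ₘ = λ l → ≡ₘ-reflexive (≡.sym (ℕₚ.*-zeroʳ (p ℕ.^ l))) ; W-pos = λ ()
      ; W-sum = λ a → ≡.trans (≡.cong (ℕ.pred p ℕ.*_) (≡.trans (sumTo-const s 0) (ℕₚ.*-zeroʳ s))) (≡.trans (ℕₚ.*-zeroʳ
          (ℕ.pred p)) (≡.sym (≡.cong (ℕ._* r) (ℕₚ.*-zeroʳ (ℕ.pred p))))) }

    term-* : ∀ {d w w′ D D′ Φ Φ′} → Term d w D Φ → Term d w′ D′ Φ′ → Term d (w ℕ.+ w′) (D ℕ.+ D′) (λ x → Φ x * Φ′ x)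
    term-* {d} {w} {w′} {D} {D′} t t′ = record
      { v = T.v ℕ.+ T′.v ; g = λ l → T.g l ℕ.+ T′.g l ; W = λ l → T.W l ℕ.+ T′.W l ; Ψ = λ x → T.Ψ x * T′.Ψ x
      ; eq = λ x → trans (*-cong (T.eq x) (T′.eq x)) (trans (·-*-· (p ℕ.^ T.v) (p ℕ.^ T′.v) _ _)
          (×-congˡ {T.Ψ x * T′.Ψ x} (≡.sym (ℕₚ.^-distribˡ-+-* p T.v T′.v))))
      ; mon = mon-* I f {Φ = T.Ψ} {Φ′ = T′.Ψ} T.mon T′.mon
      ; g≤ = λ l → ℕₚ.≤-trans (ℕₚ.+-mono-≤ (T.g≤ l) (T′.g≤ l)) (ℕₚ.≤-reflexive (≡.sym (ℕₚ.*-distribˡ-+ d (T.W l)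
          (T′.W l))))
      ; W-≡ₘ = λ l → ≡.subst ((T.W l ℕ.+ T′.W l) ≡ₘ_) (≡.sym (ℕₚ.*-distribˡ-+ (p ℕ.^ l) D D′))
          (≡ₘ-+ {T.W l} {p ℕ.^ l ℕ.* D} {T′.W l} {p ℕ.^ l ℕ.* D′} (T.W-≡ₘ l) (T′.W-≡ₘ l))
      ; W-pos = pos D T.W-pos
      ; W-sum = λ a → ≡.trans (≡.cong (ℕ.pred p ℕ.*_) (sumTo-+ s (λ l → T.W (a ℕ.+ l)) (λ l → T′.W (a ℕ.+ l)))) (≡.trans
          (ℕₚ.*-distribˡ-+ (ℕ.pred p) (sumTo s (λ l → T.W (a ℕ.+ l))) _)
          (≡.trans (≡.cong₂ ℕ._+_ (T.W-sum a) (T′.W-sum a))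
            (N.solve 6 (λ w c v r w′ v′ → (w N.:+ c N.:* v) N.:* r N.:+ (w′ N.:+ c N.:* v′) N.:* r N.:=
                ((w N.:+ w′) N.:+ c N.:* (v N.:+ v′)) N.:* r) ≡.refl w (ℕ.pred p) T.v r w′ T′.v))) }
      where
      module T = Term t
      module T′ = Term t′
      module N = NatSolver.+-*-Solver
      pos : ∀ D → (0 < D → ∀ l → 0 < T.W l) → 0 < D ℕ.+ D′ → ∀ l → 0 < T.W l ℕ.+ T′.W l
      pos zero _ 0<D′ l = ℕₚ.<-≤-trans (T′.W-pos 0<D′ l) (ℕₚ.m≤n+m _ _)
      pos (suc D) h _ l = ℕₚ.<-≤-trans (h (s≤s z≤n) l) (ℕₚ.m≤m+n _ _)

    -- Raising to the p-th power shifts the digits; the surplus power of p goes into the coefficient.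
    term-^p : ∀ {d D Φ} → Term d 1 D Φ → Term d 1 (p ℕ.* D) (λ x → Φ x ^ p)
    term-^p {d} {D} {Φ} t = record
      { v = v ; g = λ l → g (suc l) ; W = λ l → W (suc l) ; Ψ = λ x → const * Ψ x ^ p
      ; eq = λ x → begin
          Φ x ^ p                                                ≈⟨ ^-congˡ p (eq x) ⟩
          ((p ℕ.^ v) · Ψ x) ^ p                                  ≈⟨ ·-^ (p ℕ.^ v) (Ψ x) p ⟩
          ((p ℕ.^ v) ℕ.^ p) · Ψ x ^ p                            ≡⟨ ≡.cong (λ k → ((p ℕ.^ v) ℕ.^ k) · Ψ x ^ p) (≡.sym
              (ℕₚ.suc-pred p)) ⟩
          (p ℕ.^ v ℕ.* (p ℕ.^ v) ℕ.^ ℕ.pred p) · Ψ x ^ p         ≈⟨ ×-assocˡ (Ψ x ^ p) (p ℕ.^ v)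
              ((p ℕ.^ v) ℕ.^ ℕ.pred p) ⟨
          (p ℕ.^ v) · (((p ℕ.^ v) ℕ.^ ℕ.pred p) · Ψ x ^ p)       ≈⟨ ×-congʳ (p ℕ.^ v) (·-as-* ((p ℕ.^ v) ℕ.^ ℕ.pred p)
              (Ψ x ^ p)) ⟩
          (p ℕ.^ v) · (const * Ψ x ^ p)                          ∎
      ; mon = mon-* I f {Φ = λ _ → const} {Φ′ = λ x → Ψ x ^ p} (mon-const I f const) (mon-^p I f {Φ = Ψ} mon)
      ; g≤ = λ l → g≤ (suc l)
      ; W-≡ₘ = λ l → ≡.subst (W (suc l) ≡ₘ_) (≡.trans (≡.cong (ℕ._* D) (ℕₚ.*-comm p (p ℕ.^ l))) (ℕₚ.*-assoc
          (p ℕ.^ l) p D)) (W-≡ₘ (suc l))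
      ; W-pos = λ 0<pD l → W-pos (ℕₚ.n≢0⇒n>0 (λ D≡0 → ℕₚ.<-irrefl (≡.sym (≡.trans (≡.cong (p ℕ.*_) D≡0)
          (ℕₚ.*-zeroʳ p))) 0<pD)) (suc l)
      ; W-sum = λ a → W-sum (suc a) }
      where
      open Term t
      const = ((p ℕ.^ v) ℕ.^ ℕ.pred p) · 1#

    -- A carry: p + (p - 1) v = 1 + (p - 1)(v + 1), so digit sum p can be traded for digit sum 1 and
    -- a factor p with `W` unchanged.
    term-p· : ∀ {d D Φ} → Term d p D Φ → Term d 1 D (λ x → p · Φ x)
    term-p· {d} {D} {Φ} t = record
      { v = suc v ; g = g ; W = W ; Ψ = Ψ
      ; eq = λ x → trans (×-congʳ p (eq x)) (×-assocˡ (Ψ x) p (p ℕ.^ v))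
      ; mon = mon ; g≤ = g≤ ; W-≡ₘ = W-≡ₘ ; W-pos = W-pos
      ; W-sum = λ a → ≡.trans (W-sum a) (≡.cong (ℕ._* r) (≡.trans (≡.cong (ℕ._+ ℕ.pred p ℕ.* v) (≡.sym (ℕₚ.suc-pred p)))
          (≡.cong suc (≡.sym (ℕₚ.*-suc (ℕ.pred p) v))))) }
      where open Term t

    span-term-^ : ∀ {d w D Φ} → Span (Term d w D) Φ → ∀ k → Span (Term d (k ℕ.* w) (k ℕ.* D)) (Φ ^ᶠ k)
    span-term-^ x zero = span-incl term-1
    span-term-^ x (suc k) = span-* term-* x (span-term-^ x k)

    -- Digit sum 1 survives p-th powers even of sums: the mixed terms of `freshman` have p factors,
    -- hence digit sum p, and come with the factor p that pays for the carry in `term-p·`.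
    span-term-^p : ∀ {d D Φ} → Span (Term d 1 D) Φ → Span (Term d 1 (p ℕ.* D)) (Φ ^ᶠ p)
    span-term-^p {Φ = Φ} (span-incl t) = span-resp (λ x → sym (^ᶠ-at Φ p x)) (span-incl (term-^p t))
    span-term-^p span-0# = span-resp (λ x → sym (trans (^ᶠ-at (λ _ → 0#) p x) (trans (^-congʳ 0# (≡.sym
        (ℕₚ.suc-pred p))) (zeroˡ _)))) span-0#
    span-term-^p {d} {D} (span-+ {a} {b} x y)
      -- The property is imposed on p · Q and not on Q, since the mixed monomials alone have digit
      -- sum p.
      with Freshman.freshman (Fn (Vec (Fin q) n)) p-prime (λ Q → Span (Term d 1 (p ℕ.* D)) (λ x → p · Q x))
        (span-resp (λ x → sym (trans (·-as-* p 0#) (zeroʳ _))) span-0#)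
        (λ {Q} {Q′} u v → span-resp (λ x → sym (·-distrib-+ (Q x) (Q′ x) p)) (span-+ u v))
        a b cross
      where
      cross : ∀ i j → suc i ℕ.+ suc j ≡ p → Span (Term d 1 (p ℕ.* D)) (λ x → p · ((a ^ᶠ suc i) *ᶠ (b ^ᶠ suc j)) x)
      cross i j e = scale (≡.subst₂ (λ w D → Span (Term d w D) ((a ^ᶠ suc i) *ᶠ (b ^ᶠ suc j)))
        (≡.trans (≡.cong₂ ℕ._+_ (ℕₚ.*-identityʳ (suc i)) (ℕₚ.*-identityʳ (suc j))) e)
        (≡.trans (≡.sym (ℕₚ.*-distribʳ-+ D (suc i) (suc j))) (≡.cong (ℕ._* D) e))
        (span-* term-* (span-term-^ x (suc i)) (span-term-^ y (suc j))))
        where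
        scale : ∀ {D Φ} → Span (Term d p D) Φ → Span (Term d 1 D) (λ x → p · Φ x)
        scale (span-incl t) = span-incl (term-p· t)
        scale span-0# = span-resp (λ x → sym (trans (·-as-* p 0#) (zeroʳ _))) span-0#
        scale (span-+ {Φ} {Ψ} x y) = span-resp (λ x → sym (·-distrib-+ (Φ x) (Ψ x) p)) (span-+ (scale x) (scale y))
        scale (span-resp e x) = span-resp (λ x → ×-congʳ p (e x)) (scale x)
    ... | Q , xQ , eq = span-resp (λ z → trans (+-congˡ (sym (·ᶠ-at p Q z))) (sym (eq z)))
      (span-+ (span-+ (span-term-^p x) (span-term-^p y)) xQ)
    span-term-^p (span-resp e x) = span-resp (λ z → trans (^ᶠ-at _ p z) (trans (^-congˡ p (e z)) (sym (^ᶠ-at _ p z))))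
        (span-term-^p x)

    span-term-^p^k : ∀ {d D Φ} → Span (Term d 1 D) Φ → ∀ k → Span (Term d 1 (p ℕ.^ k ℕ.* D)) (Φ ^ᶠ (p ℕ.^ k))
    span-term-^p^k {d} {D} {Φ} x zero = span-resp (λ z → sym (*-identityʳ (Φ z))) (≡.subst (λ D → Span (Term d 1 D) Φ)
        (≡.sym (ℕₚ.*-identityˡ D)) x)
    span-term-^p^k {d} {D} {Φ} x (suc k) = span-resp (λ z → begin
        ((Φ ^ᶠ (p ℕ.^ k)) ^ᶠ p) z       ≈⟨ ^ᶠ-^ᶠ Φ (p ℕ.^ k) p z ⟩
        Φ z ^ (p ℕ.^ k ℕ.* p)           ≡⟨ ≡.cong (Φ z ^_) (ℕₚ.*-comm (p ℕ.^ k) p) ⟩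
        Φ z ^ (p ℕ.* p ℕ.^ k)           ≈⟨ ^ᶠ-at Φ (p ℕ.* p ℕ.^ k) z ⟨
        (Φ ^ᶠ (p ℕ.* p ℕ.^ k)) z        ∎)
      (≡.subst (λ D → Span (Term d 1 D) ((Φ ^ᶠ (p ℕ.^ k)) ^ᶠ p)) (≡.sym (ℕₚ.*-assoc p (p ℕ.^ k) D)) (span-term-^p
          (span-term-^p^k x k)))

    -- Each of the k digits p - 1 of the exponent adds p - 1 to the digit sum, because passing to
    -- the next digit is a p-th power and keeps the base at digit sum 1.
    span-term-^[p^k-1] : ∀ {d D Φ} → Span (Term d 1 D) Φ → ∀ k → Span (Term d (k ℕ.* ℕ.pred p) (repunit k ℕ.* D))
        (Φ ^ᶠ repunit k)
    span-term-^[p^k-1] x zero = span-incl term-1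
    span-term-^[p^k-1] {d} {D} {Φ} x (suc k) = span-resp (λ z → begin
        (Φ ^ᶠ ℕ.pred p) z * ((Φ ^ᶠ p) ^ᶠ repunit k) z    ≈⟨ *-cong (^ᶠ-at Φ (ℕ.pred p) z) (^ᶠ-^ᶠ Φ p (repunit k) z) ⟩
        Φ z ^ ℕ.pred p * Φ z ^ (p ℕ.* repunit k)         ≈⟨ ^-homo-* (Φ z) (ℕ.pred p) (p ℕ.* repunit k) ⟨
        Φ z ^ repunit (suc k)                            ≈⟨ ^ᶠ-at Φ (repunit (suc k)) z ⟨
        (Φ ^ᶠ repunit (suc k)) z                         ∎)
      (≡.subst₂ (λ w D → Span (Term d w D) ((Φ ^ᶠ ℕ.pred p) *ᶠ ((Φ ^ᶠ p) ^ᶠ repunit k)))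
        (≡.cong (ℕ._+ k ℕ.* ℕ.pred p) (ℕₚ.*-identityʳ (ℕ.pred p)))
        (N.solve 4 (λ c D e p → c N.:* D N.:+ e N.:* (p N.:* D) N.:= (c N.:+ p N.:* e) N.:* D) ≡.refl (ℕ.pred p) D
            (repunit k) p)
        (span-* term-* (span-term-^ x (ℕ.pred p)) (span-term-^[p^k-1] (span-term-^p x) k)))
      where module N = NatSolver.+-*-Solver

    -- Here r (ε l + 1) is the folded degree W l of a Term.
    record Bounded (d m : ℕ) (Φ : Fun) : Set where
      field
        g ε : ℕ → ℕ
        Ψ   : Fun
        eq  : ∀ x → Φ x ≈ (p ℕ.^ sumTo s ε) · Ψ x
        mon : Mon I f g Ψ
        g≤  : ∀ l → g l ≤ r ℕ.* (d ℕ.+ m ℕ.* ε l)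

    -- As r divides D > 0, each `W l` is a positive multiple r (1 + ε l). The digit sum s (p - 1)
    -- accounts for the s ones in `W-sum`, which leaves v as the sum of the ε l. Putting the common
    -- `m` in place of `d` in front of ε makes the bounds of different polynomials additive.
    term⇒bounded : ∀ {d m D Φ} → d ≤ m → 0 < D → r ∣ D → Term d (s ℕ.* ℕ.pred p) D Φ → Bounded d m Φ
    term⇒bounded {d} {m} {D} {Φ} d≤m 0<D r∣D t = record
      { g = g ; ε = ε ; Ψ = Ψ ; eq = λ x → trans (eq x) (×-congˡ {Ψ x} (≡.cong (p ℕ.^_) (≡.sym ε-sum))) ; mon = mon
      ; g≤ = λ l → ℕₚ.≤-trans (g≤ l) (ℕₚ.≤-trans (ℕₚ.≤-reflexive (≡.trans (≡.cong (d ℕ.*_) (W≡ l))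
          (N.solve 3 (λ d e r → d N.:* ((N.con 1 N.:+ e) N.:* r) N.:= r N.:* (d N.:+ d N.:* e)) ≡.refl d (ε l) r)))
          (ℕₚ.*-monoʳ-≤ r (ℕₚ.+-monoʳ-≤ d (ℕₚ.*-monoˡ-≤ (ε l) d≤m)))) }
      where
      open Term t
      module N = NatSolver.+-*-Solver
      r∣W : ∀ l → r ∣ W l
      r∣W l = ≡ₘ-∣ {W l} {p ℕ.^ l ℕ.* D} (W-≡ₘ l) (∣n⇒∣m*n (p ℕ.^ l) r∣D)
      -- The quotient is never 0, by `W-pos`, so the predecessor loses nothing; `W≡` relies on this.
      ε : ℕ → ℕ
      ε l = ℕ.pred (quotient (r∣W l))
      W≡ : ∀ l → W l ≡ suc (ε l) ℕ.* r
      W≡ l = go (quotient (r∣W l)) (_∣_.equality (r∣W l))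
        where
        go : ∀ k → W l ≡ k ℕ.* r → W l ≡ suc (ℕ.pred k) ℕ.* r
        go zero e = contradiction (≡.subst (0 <_) e (W-pos 0<D l)) λ ()
        go (suc k) e = e
      instance
        _ : NonZero (ℕ.pred p)
        _ = ℕ.>-nonZero (ℕₚ.suc[m]≤n⇒m≤pred[n] (ℕ.nonTrivial⇒n>1 p {{prime⇒nonTrivial p-prime}}))
        _ = F.r-nonZero
      sum-W : sumTo s W ≡ (s ℕ.+ sumTo s ε) ℕ.* r
      sum-W = ≡.trans (sumTo-cong s (λ l _ → W≡ l)) (≡.trans (sumTo-*ʳ s (λ l → suc (ε l)) r)
        (≡.cong (ℕ._* r) (≡.trans (sumTo-+ s (λ _ → 1) ε) (≡.cong (ℕ._+ sumTo s ε) (≡.trans (sumTo-const s 1)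
            (ℕₚ.*-identityʳ s))))))
      ε-sum : sumTo s ε ≡ v
      ε-sum = ℕₚ.+-cancelˡ-≡ s (sumTo s ε) v (ℕₚ.*-cancelʳ-≡ (s ℕ.+ sumTo s ε) (s ℕ.+ v) r (ℕₚ.*-cancelˡ-≡ _ _
          (ℕ.pred p)
        (≡.trans (≡.cong (ℕ.pred p ℕ.*_) (≡.sym sum-W)) (≡.trans (W-sum 0)
          (N.solve 4 (λ s c v r → (s N.:* c N.:+ c N.:* v) N.:* r N.:= c N.:* ((s N.:+ v) N.:* r)) ≡.refl s
              (ℕ.pred p) v r)))))

    bounded-const : ∀ {d m} c → Bounded d m (λ _ → c)
    bounded-const c = record
      { g = λ _ → 0 ; ε = λ _ → 0 ; Ψ = λ _ → c
      ; eq = λ x → sym (trans (×-congˡ {c} (≡.cong (p ℕ.^_) (≡.trans (sumTo-const s 0) (ℕₚ.*-zeroʳ s)))) (×-homo-1 c))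
      ; mon = mon-const I f c ; g≤ = λ l → z≤n }

    bounded-* : ∀ {d d′ m Φ Φ′} → Bounded d m Φ → Bounded d′ m Φ′ → Bounded (d ℕ.+ d′) m (λ x → Φ x * Φ′ x)
    bounded-* {d} {d′} {m} b b′ = record
      { g = λ l → B.g l ℕ.+ B′.g l ; ε = λ l → B.ε l ℕ.+ B′.ε l ; Ψ = λ x → B.Ψ x * B′.Ψ x
      ; eq = λ x → trans (*-cong (B.eq x) (B′.eq x)) (trans (·-*-· (p ℕ.^ sumTo s B.ε) (p ℕ.^ sumTo s B′.ε) _ _)
          (×-congˡ {B.Ψ x * B′.Ψ x}
          (≡.sym (≡.trans (≡.cong (p ℕ.^_) (sumTo-+ s B.ε B′.ε)) (ℕₚ.^-distribˡ-+-* p (sumTo s B.ε) (sumTo s B′.ε))))))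
      ; mon = mon-* I f {Φ = B.Ψ} {Φ′ = B′.Ψ} B.mon B′.mon
      ; g≤ = λ l → ℕₚ.≤-trans (ℕₚ.+-mono-≤ (B.g≤ l) (B′.g≤ l)) (ℕₚ.≤-reflexive
          (N.solve 6 (λ r d d′ m e e′ → r N.:* (d N.:+ m N.:* e) N.:+ r N.:* (d′ N.:+ m N.:* e′) N.:= r N.:*
              ((d N.:+ d′) N.:+ m N.:* (e N.:+ e′))) ≡.refl r d d′ m (B.ε l) (B′.ε l))) }
      where
      module B = Bounded b
      module B′ = Bounded b′
      module N = NatSolver.+-*-Solver

    module _ (ω : Fin n → ℕ) (nc : ∀ i → i ∈ I → NonConstant F (f i)) (om : ∀ i → i ∈ I → IsOmega F (f i) (ω i)) where

      -- For one monomial the coefficient supplies as many factors p as the sum of the ε l, and the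
      -- sum over all points supplies level s z. Their total is compared with s copies of the
      -- ceiling, one for each shift.
      span-bounded-sum : ∀ {d m Φ} → 0 < m → Span (Bounded d m) Φ → Pow (s ℕ.* ceilDiv (sumI I ω ∸ r ℕ.* d) (r ℕ.* m))
          (sumTuples Φ)
      span-bounded-sum {d} {m} {Φ} 0<m (span-incl b) with mon-sum I f ω nc om {Φ = Bounded.Ψ b} (Bounded.mon b)
      ... | z , x , le = pow-resp (sym sum-eq) (pow-≤ μ≤ (pow-* (pow-p^s V) x))
        where
        open Bounded b
        module N = NatSolver.+-*-Solver
        V = sumTo s ε
        μ = ceilDiv (sumI I ω ∸ r ℕ.* d) (r ℕ.* m)
        sum-eq : sumTuples Φ ≈ ((p ℕ.^ V) · 1#) * sumTuples Ψ
        sum-eq = trans (sumL-map-cong (λ x → trans (eq x) (·-as-* (p ℕ.^ V) (Ψ x))) (allTuples F n)) (sumL-map-*ˡ _ Ψ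
            (allTuples F n))
        r>0 : 0 < r
        r>0 = ℕ.>-nonZero⁻¹ r {{F.r-nonZero}}
        -- As m ≥ 1, r z may be enlarged to r m z, so that z and ε l share the divisor r m of the
        -- ceiling.
        μ≤z+ε : ∀ l → μ ≤ z ℕ.+ ε l
        μ≤z+ε l = ceilDiv-≤ _ (r ℕ.* m) (z ℕ.+ ε l) (ℕₚ.*-mono-≤ r>0 0<m) (ℕₚ.m≤n+o⇒m∸n≤o (sumI I ω) (r ℕ.* d) (R.begin
          sumI I ω                                             R.≤⟨ le l ⟩
          z ℕ.* r ℕ.+ g l                                      R.≤⟨ ℕₚ.+-mono-≤ (ℕₚ.≤-reflexive (ℕₚ.*-comm z r))
              (g≤ l) ⟩
          r ℕ.* z ℕ.+ r ℕ.* (d ℕ.+ m ℕ.* ε l)                  R.≤⟨ ℕₚ.+-monoˡ-≤ _ (ℕₚ.*-monoʳ-≤ r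
              (ℕₚ.m≤n*m z m {{ℕ.>-nonZero 0<m}})) ⟩
          r ℕ.* (m ℕ.* z) ℕ.+ r ℕ.* (d ℕ.+ m ℕ.* ε l)          R.≡⟨ N.solve 5 (λ r m z d e →
              r N.:* (m N.:* z) N.:+ r N.:* (d N.:+ m N.:* e) N.:= r N.:* d N.:+ r N.:* m N.:*
              (z N.:+ e)) ≡.refl r m z d (ε l) ⟩
          r ℕ.* d ℕ.+ r ℕ.* m ℕ.* (z ℕ.+ ε l)                  R.∎))
          where module R = ℕₚ.≤-Reasoning
        μ≤ : s ℕ.* μ ≤ V ℕ.+ s ℕ.* z
        μ≤ = R.begin
          s ℕ.* μ                           R.≡⟨ sumTo-const s μ ⟨
          sumTo s (λ _ → μ)                 R.≤⟨ sumTo-mono s μ≤z+ε ⟩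
          sumTo s (λ l → z ℕ.+ ε l)         R.≡⟨ sumTo-+ s (λ _ → z) ε ⟩
          sumTo s (λ _ → z) ℕ.+ V           R.≡⟨ ≡.cong (ℕ._+ V) (sumTo-const s z) ⟩
          s ℕ.* z ℕ.+ V                     R.≡⟨ ℕₚ.+-comm (s ℕ.* z) V ⟩
          V ℕ.+ s ℕ.* z                     R.∎
          where module R = ℕₚ.≤-Reasoning
      span-bounded-sum 0<m span-0# = pow-resp (sym (trans (sumL-map-cong (λ x → sym (zeroˡ 0#)) (allTuples F n)) (trans
          (sumL-map-*ˡ 0# (λ _ → 0#) (allTuples F n)) (zeroˡ _)))) pow-0#
      span-bounded-sum 0<m (span-+ {Φ} {Ψ} x y) = pow-resp (sym (sumL-map-+ Φ Ψ (allTuples F n))) (pow-+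
          (span-bounded-sum 0<m x) (span-bounded-sum 0<m y))
      span-bounded-sum 0<m (span-resp e x) = pow-resp (sumL-map-cong e (allTuples F n)) (span-bounded-sum 0<m x)

    monomial⇒term : ∀ {d g Φ} → (∀ l → g l ≤ d ℕ.* weight l) → Mon I f g Φ → Term d 1 1 Φ
    monomial⇒term {d} {g} {Φ} g≤ mon = record
      { v = 0 ; g = g ; W = weight ; Ψ = Φ ; eq = λ x → sym (×-homo-1 (Φ x)) ; mon = mon ; g≤ = g≤
      ; W-≡ₘ = λ l → ≡.subst (weight l ≡ₘ_) (≡.sym (ℕₚ.*-identityʳ (p ℕ.^ l))) (weight-≡ₘ l)
      ; W-pos = λ _ → weight>0
      ; W-sum = λ a → ≡.trans (weight-sum a) (≡.sym (≡.trans (≡.cong (λ k → (1 ℕ.+ k) ℕ.* r) (ℕₚ.*-zeroʳ (ℕ.pred p)))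
          (ℕₚ.*-identityˡ r))) }

    span-liftM : ∀ P → Span (Term (degI I P) 1 1) (liftM f P)
    span-liftM P = span-∑ _ λ k → span-* {P = Mon I f (λ _ → 0)} (λ {Φ} {Ψ} m m′ → monomial⇒term (λ l →
        ℕₚ.*-monoˡ-≤ (weight l) (deg≤ k)) (mon-* I f {Φ = Φ} {Φ′ = Ψ} m m′))
      (span-incl (mon-const I f (τ (proj₁ (List.lookup (MPoly.terms P) k))))) (span-liftMono I f (proj₂ (List.lookup
          (MPoly.terms P) k)))
      where
      deg≤ : ∀ k → sumI I (lookup (proj₂ (List.lookup (MPoly.terms P) k))) ≤ degI I P
      deg≤ k = ∈⇒≤max (∈-map⁺ (λ t → sumI I (lookup (proj₂ t))) (∈-lookup {xs = MPoly.terms P} k))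

    -- Congruent modulo Pow M to the indicator function of P (f₁(x₁), …, fₙ(xₙ)) = 0.
    indicator : ℕ → MPoly F n → Fun
    indicator M P x = 1# + - 1# * ((liftM f P ^ᶠ (p ℕ.^ M)) ^ᶠ repunit s) x

    repunit≡r : repunit s ≡ r
    repunit≡r = ℕₚ.suc-injective (≡.trans (suc-repunit s) p^s≡1+r)

    -- The power p ^ M is taken first and leaves the digit sum at 1; only the power r raises it, to
    -- s (p - 1). Hence the bound is the same for every M.
    span-indicator : ∀ M {m} P → degI I P ≤ m → Span (Bounded (degI I P) m) (indicator M P)
    span-indicator M {m} P d≤m = span-+ (span-incl (bounded-const 1#)) (span-* (bounded-* {d = 0}) (span-incl
        (bounded-const (- 1#)))
      (span-bind (λ t → span-incl (term⇒bounded d≤m 0<D r∣D t)) (span-term-^[p^k-1] (span-term-^p^k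
          (span-liftM P) M) s)))
      where
      D = repunit s ℕ.* (p ℕ.^ M ℕ.* 1)
      r∣D : r ∣ D
      r∣D = ≡.subst (λ z → r ∣ z ℕ.* (p ℕ.^ M ℕ.* 1)) (≡.sym repunit≡r) (m∣m*n (p ℕ.^ M ℕ.* 1))
      0<D : 0 < D
      0<D = ℕₚ.*-mono-≤ (≡.subst (0 <_) (≡.sym repunit≡r) (ℕ.>-nonZero⁻¹ r {{F.r-nonZero}})) (ℕₚ.*-mono-≤ (ℕₚ.m^n>0 p M)
          (s≤s z≤n))

    indicator-eq : ∀ M P x → indicator M P x ≈ 1# - liftM f P x ^ (p ℕ.^ M ℕ.* r)
    indicator-eq M P x = +-congˡ (trans (-1*x≈-x _) (-‿cong (trans (^ᶠ-^ᶠ (liftM f P) (p ℕ.^ M) (repunit s) x)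
        (^-congʳ _ (≡.cong (p ℕ.^ M ℕ.*_) repunit≡r)))))

    -- The lifted value lies in the kernel, and the exponent p ^ M · r is at least M.
    indicator-zero : ∀ M P x → evalM F P (point F f x) F.≈ F.0# → ∃ λ e → Pow M e × indicator M P x ≈ 1# + e
    indicator-zero M P x z = _ , pow-neg (pow-≤ M≤ (pow-^ (p ℕ.^ M ℕ.* r) (pow-1 (F.trans (π-liftM f P x) z)))) ,
        indicator-eq M P x
      where
      M≤ : M ≤ p ℕ.^ M ℕ.* r ℕ.* 1
      M≤ = ℕₚ.≤-trans (ℕₚ.<⇒≤ (F.k<p^k M)) (ℕₚ.≤-trans (ℕₚ.m≤m*n (p ℕ.^ M) r {{F.r-nonZero}}) (ℕₚ.≤-reflexive (≡.sym
          (ℕₚ.*-identityʳ _))))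

    -- Fermat gives y ^ r ≈ 1 + e with e in the kernel, and raising to the power p ^ M moves the
    -- error into the (M + 1)-st power of the kernel.
    indicator-nonzero : ∀ M P x → ¬ evalM F P (point F f x) F.≈ F.0# → Pow M (indicator M P x)
    indicator-nonzero M P x nz = result
      where
      y = liftM f P x
      e = y ^ r - 1#
      πy≉0 : ¬ π y F.≈ F.0#
      πy≉0 z = nz (F.trans (F.sym (π-liftM f P x)) z)
      e∈ : Ker e
      e∈ = F.trans (π-+ _ _) (F.trans (F.+-cong (F.trans (π-^ y r) (F.fermat (π y) πy≉0)) (F.trans (π-neg 1#)
          (F.-‿cong π-1#))) (F.-‿inverseʳ F.1#))
      y^r : y ^ r ≈ 1# + e
      y^r = sym (trans (+-comm 1# e) (trans (+-assoc _ _ _) (trans (+-congˡ (-‿inverseˡ 1#)) (+-identityʳ _))))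
      result : Pow M (indicator M P x)
      result with [1+e]^p^k p-prime p∈Ker M e (pow-1 e∈)
      ... | e′ , x∈ , eq = pow-resp (sym (begin
          indicator M P x                ≈⟨ indicator-eq M P x ⟩
          1# - y ^ (p ℕ.^ M ℕ.* r)       ≈⟨ +-congˡ (-‿cong (trans (^-congʳ y (ℕₚ.*-comm (p ℕ.^ M) r)) (trans (sym
              (^-assocʳ y r (p ℕ.^ M))) (trans (^-congˡ (p ℕ.^ M) y^r) eq)))) ⟩
          1# - (1# + e′)                 ≈⟨ +-congˡ (sym (⁻¹-∙-comm 1# e′)) ⟩
          1# + (- 1# - e′)               ≈⟨ +-assoc _ _ _ ⟨
          (1# - 1#) - e′                 ≈⟨ +-congʳ (-‿inverseʳ 1#) ⟩
          0# - e′                        ≈⟨ +-identityˡ _ ⟩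
          - e′                           ∎)) (pow-neg (pow-pred x∈))
        where open import Algebra.Properties.AbelianGroup +-abelianGroup using (⁻¹-∙-comm)

    indicators : ∀ M {k} → (Fin k → MPoly F n) → Fun
    indicators M {zero} P x = 1#
    indicators M {suc k} P x = indicator M (P Fin.zero) x * indicators M (P ∘ Fin.suc) x

    span-indicators : ∀ M {m k} (P : Fin k → MPoly F n) → (∀ j → degI I (P j) ≤ m) → Span (Bounded (ℕsum (λ j →
        degI I (P j))) m) (indicators M P)
    span-indicators M {k = zero} P d≤m = span-incl (bounded-const 1#)
    span-indicators M {k = suc k} P d≤m = span-* bounded-* (span-indicator M (P Fin.zero) (d≤m Fin.zero))
        (span-indicators M (P ∘ Fin.suc) (λ j → d≤m (Fin.suc j)))

    indicators-zero : ∀ M {k} (P : Fin k → MPoly F n) x → IsZero F P f x → ∃ λ e → Pow M e × indicators M P x ≈ 1# + e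
    indicators-zero M {zero} P x z = 0# , pow-0# , sym (+-identityʳ 1#)
    indicators-zero M {suc k} P x z with indicator-zero M (P Fin.zero) x (z Fin.zero) | indicators-zero M
        (P ∘ Fin.suc) x (λ j → z (Fin.suc j))
    ... | e , x∈ , eq | e′ , x′∈ , eq′ = e * (1# + e′) + e′ , pow-+ (pow-*ʳ _ x∈) x′∈ , (begin
      indicator M (P Fin.zero) x * indicators M (P ∘ Fin.suc) x  ≈⟨ *-cong eq eq′ ⟩
      (1# + e) * (1# + e′)                                       ≈⟨ distribʳ _ _ _ ⟩
      1# * (1# + e′) + e * (1# + e′)                             ≈⟨ +-congʳ (*-identityˡ _) ⟩
      (1# + e′) + e * (1# + e′)                                  ≈⟨ trans (+-assoc _ _ _) (+-congˡ (+-comm _ _)) ⟩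
      1# + (e * (1# + e′) + e′)                                  ∎)

    indicators-nonzero : ∀ M {k} (P : Fin k → MPoly F n) x → ¬ IsZero F P f x → Pow M (indicators M P x)
    indicators-nonzero M {zero} P x nz = contradiction (λ ()) nz
    indicators-nonzero M {suc k} P x nz with evalM F (P Fin.zero) (point F f x) F.≟F F.0#
    ... | no nz₀ = pow-*ʳ _ (indicator-nonzero M (P Fin.zero) x nz₀)
    ... | yes z₀ = pow-*ˡ _ (indicators-nonzero M (P ∘ Fin.suc) x (λ z → nz (λ { Fin.zero → z₀ ; (Fin.suc j) → z j })))

    zeroCount-divisible : ∀ {k} (P : Fin k → MPoly F n) (ω : Fin n → ℕ) → (∀ i → i ∈ I → NonConstant F (f i)) → (∀ i →
        i ∈ I → IsOmega F (f i) (ω i)) →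
      0 < maxDegI I P → q ℕ.^ ceilDiv (sumI I ω ∸ r ℕ.* sumDegI I P) (r ℕ.* maxDegI I P) ∣ zeroCount F n P f
    zeroCount-divisible {k} P ω nc om 0<m with pow-count (IsZero? F P f) (indicators M P) (indicators-zero M P)
        (indicators-nonzero M P) (allTuples F n)
      -- The precision of the indicators is set to the level wanted for the count itself.
      where M = s ℕ.* ceilDiv (sumI I ω ∸ r ℕ.* sumDegI I P) (r ℕ.* maxDegI I P)
    ... | e , x∈ , eq = ≡.subst (_∣ zeroCount F n P f) (≡.trans (≡.sym (ℕₚ.^-*-assoc p s μ)) (≡.cong (ℕ._^ μ)
        (≡.sym q≡p^s)))
        (pow-integer (s ℕ.* μ) (zeroCount F n P f) (pow-resp eq (pow-+ sum∈ x∈)))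
      where
      m = maxDegI I P
      μ = ceilDiv (sumI I ω ∸ r ℕ.* sumDegI I P) (r ℕ.* m)
      deg≤m : ∀ j → degI I (P j) ≤ m
      deg≤m j = ∈⇒≤max (∈-map⁺ (λ j → degI I (P j)) (∈-allFin j))
      sum∈ : Pow (s ℕ.* μ) (sumTuples (indicators (s ℕ.* μ) P))
      sum∈ = span-bounded-sum ω nc om 0<m (≡.subst (λ d → Span (Bounded d m) (indicators (s ℕ.* μ) P)) (≡.sym
          (sum-allFin (λ j → degI I (P j)))) (span-indicators (s ℕ.* μ) P deg≤m))

open import Data.Nat using (_*_; _^_)

theorem1p14 : ∀ {c ℓ : Level} (F : FiniteField c ℓ) (n r : ℕ)
    (P : Fin r → MPoly F n) → (∀ j → NonzeroPoly F (P j))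
    → (I : Subset n) → Nonempty I → 0 < maxDegI I P
    → (f : Fin n → UPoly F) → (∀ i → i ∈ I → NonConstant F (f i))
    → (ω : Fin n → ℕ) → (∀ i → i ∈ I → IsOmega F (f i) (ω i))
    → (FiniteField.q F ∸ 1) * sumDegI I P < sumI I ω
    → FiniteField.q F ^ ceilDiv (sumI I ω ∸ (FiniteField.q F ∸ 1) * sumDegI I P)
    ((FiniteField.q F ∸ 1) * maxDegI I P)
    ∣ zeroCount F n P f
theorem1p14 F n r P _ I _ 0<m f nc ω om _ with Field.characteristic F
... | p , p-prime , p·1≈0 with Field.Characteristic.order F p-prime p·1≈0
... | s , q≡p^s = zeroCount-divisible I f P ω nc om 0<m
  where
  open MonoidRingLift F p-prime p·1≈0 using (monoidRing; lift)
  open ZeroCounting F p-prime p·1≈0 s q≡p^s monoidRing lift using (zeroCount-divisible)
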